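{- For every sentence $\varphi\in\mathrm{EMSO}^2[\to,\lhd,\le]$ over $P$ and $\Sigma$, one can effectively construct a CFM $\mathcal A_\varphi$ over $P$ and $\Sigma$ with $2^{2^{\mathcal O(|\varphi|+|P|\log|P|)}}$ states per process such that $L(\mathcal A_\varphi)=L(\varphi)$.
   Context: Fix a finite set $P$ of processes and a finite alphabet $\Sigma$. A message sequence chart (MSC) over $P$ and $\Sigma$ is $M=((w_p)_{p\in P},\lhd)$ with $w_p\in\Sigma^*$, at least one of them nonempty. Its events are $E=\bigcup_{p}E_p$ with $E_p=\{p\}\times\{1,\dots,|w_p|\}$; the process relation $\to$ is given by $(p,i)\to(p,i+1)$ for $1\le i<|w_p|$; the labelling is $\lambda(p,i)=(p,a)$ where $a$ is the $i$-th letter of $w_p$. The message relation $\lhd\subseteq\bigcup_{p\neq q}E_p\times E_q$ must satisfy: $\to\cup\lhd$ is acyclic; each event belongs to at most one pair of $\lhd$; (FIFO) for $p\neq q$ and $(e,f),(e',f')\in\lhd\cap(E_p\times E_q)$, $e\to^*e'$ iff $f\to^*f'$. Let $\le=(\to\cup\lhd)^*$. An event in no $\lhd$-pair is internal. A CFM over $P$ and $\Sigma$ is $\mathcal A=((\mathcal A_p)_{p\in P},\mathit{Msg},\mathit{Acc})$ where $\mathit{Msg}$ is a finite set of messages, $\mathcal A_p=(S_p,\iota_p,\Delta_p)$ with $S_p$ finite (its states; "number of states per process" refers to $|S_p|$), $\iota_p\in S_p$, $\Delta_p\subseteq S_p\times\mathit{Act}_p\times S_p$ where $\mathit{Act}_p=\Sigma\cup(\Sigma\times\{!,?\}\times\mathit{Msg}\times(P\setminus\{p\}))$,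 and $\mathit{Acc}\subseteq\prod_pS_p$. A transition with action $a\in\Sigma$ is internal; with $(a,!,m,q)$ it sends $m$ to $q$; with $(a,?,m,q)$ it receives $m$ from $q$; its label is $a$. A run on $M$ maps each $e\in E_p$ to $\rho(e)\in\Delta_p$ such that: the label of $\rho(e)$ is the $\Sigma$-component of $\lambda(e)$; $\rho((p,1))$ has source $\iota_p$ when $E_p\ne\emptyset$; if $e\to f$ then the target of $\rho(e)$ is the source of $\rho(f)$; internal events get internal transitions; for $(e,f)\in\lhd$, $e\in E_p$, $f\in E_q$, $\rho(e)$ has action $(a,!,m,q)$ and $\rho(f)$ has action $(b,?,m,p)$ with the same $m$. It is accepting if $(s_p)_p\in\mathit{Acc}$, where $s_p$ is the target of $\rho$ at the last event of $p$, or $\iota_p$ if $E_p=\emptyset$. $L(\mathcal A)$ is the set of MSCs with an accepting run. MSO formulas: $\varphi::=p(x)\mid a(x)\mid x\in X\mid x=y\mid x\to y\mid x\lhd y\mid x\le y\mid\varphi\vee\varphi\mid\neg\varphi\mid\exists x.\varphi\mid\exists X.\varphi$, with first-order variables ranging over events and second-order over sets of events; $p(x)$ means $x\in E_p$, $a(x)$ that the $\Sigma$-label of $x$ is $a$. $\mathrm{FO}^2$: no second-order quantification, only the two first-order variables $x,y$ (reusable). $\mathrm{EMSO}^2$: formulas $\exists X_1\cdots\exists X_n.\psi$ with $\psi\in\mathrm{FO}^2$; $[\to,\lhd,\le]$ lists allowed binary predicates (equality always allowed). $|\varphi|$ is the length of $\varphi$ as a string, and $L(\varphi)$ the set of MSCs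 satisfying the sentence $\varphi$. -}

module Defs where

open import Data.Nat using (ℕ; zero; suc; _+_; _*_; _^_; _≤_; _<_)
open import Data.Fin using (Fin; toℕ; fromℕ)
open import Data.List using (List; length; lookup)
open import Data.Bool using (Bool; true; false; if_then_else_; _∨_)
open import Data.Maybe using (Maybe; just; nothing)
open import Data.Product using (Σ; _×_; _,_; proj₁; proj₂)
open import Data.Sum using (_⊎_)
open import Data.Empty using (⊥)
open import Data.Unit using (⊤)
open import Relation.Nullary using (¬_)
open import Relation.Binary.PropositionalEquality using (_≡_; _≢_)
open import Relation.Binary.Construct.Closure.ReflexiveTransitive using (Star)
open import Function.Bundles using (_⇔_)

-- Conventions: the process set P is Fin n, the alphabet Σ is Fin k.
-- Positions on a process are 0-indexed (Fin (length (w p))).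

Word : ℕ → ℕ → Set
Word n k = Fin n → List (Fin k)

Ev : ∀ {n k} → Word n k → Set
Ev {n} w = Σ (Fin n) (λ p → Fin (length (w p)))

PSucc : ∀ {n k} (w : Word n k) → Ev w → Ev w → Set
PSucc w e f = proj₁ e ≡ proj₁ f × suc (toℕ (proj₂ e)) ≡ toℕ (proj₂ f)

Step : ∀ {n k} (w : Word n k) → (Ev w → Ev w → Bool) → Ev w → Ev w → Set
Step w msg e f = PSucc w e f ⊎ msg e f ≡ true

record MSC (n k : ℕ) : Set where
  field
    w        : Word n k
    msg      : Ev w → Ev w → Bool
    nonempty : Σ (Fin n) (λ p → 0 < length (w p))
    msg-diff : ∀ e f → msg e f ≡ true → proj₁ e ≢ proj₁ f
    acyclic  : ∀ e f → Step w msg e f → ¬ Star (Step w msg) f e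
    one-pair : ∀ a b c d → msg a b ≡ true → msg c d ≡ true →
               (a ≡ c ⊎ a ≡ d ⊎ b ≡ c ⊎ b ≡ d) → (a ≡ c × b ≡ d)
    fifo     : ∀ e f e′ f′ → msg e f ≡ true → msg e′ f′ ≡ true →
               proj₁ e ≡ proj₁ e′ → proj₁ f ≡ proj₁ f′ →
               (Star (PSucc w) e e′ ⇔ Star (PSucc w) f f′)

module _ {n k : ℕ} (M : MSC n k) where
  open MSC M

  label : Ev w → Fin k
  label e = lookup (w (proj₁ e)) (proj₂ e)

  _≤ₘ_ : Ev w → Ev w → Set
  e ≤ₘ f = Star (Step w msg) e f

  Internal : Ev w → Set
  Internal e = ∀ f → (msg e f ≡ false) × (msg f e ≡ false)

data Act (n k m : ℕ) : Set where
  int : Fin k → Act n k m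
  snd : Fin k → Fin m → Fin n → Act n k m
  rcv : Fin k → Fin m → Fin n → Act n k m

actLabel : ∀ {n k m} → Act n k m → Fin k
actLabel (int a) = a
actLabel (snd a _ _) = a
actLabel (rcv a _ _) = a

InAct : ∀ {n k m} → Fin n → Act n k m → Set
InAct p (int _) = ⊤
InAct p (snd _ _ q) = q ≢ p
InAct p (rcv _ _ q) = q ≢ p

IsInt : ∀ {n k m} → Act n k m → Set
IsInt (int _) = ⊤
IsInt (snd _ _ _) = ⊥
IsInt (rcv _ _ _) = ⊥

IsSnd : ∀ {n k m} → Act n k m → Fin m → Fin n → Set
IsSnd (snd _ m′ q′) m q = m′ ≡ m × q′ ≡ q
IsSnd (int _) _ _ = ⊥
IsSnd (rcv _ _ _) _ _ = ⊥

IsRcv : ∀ {n k m} → Act n k m → Fin m → Fin n → Set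
IsRcv (rcv _ m′ q′) m q = m′ ≡ m × q′ ≡ q
IsRcv (int _) _ _ = ⊥
IsRcv (snd _ _ _) _ _ = ⊥

record CFM (n k : ℕ) : Set where
  field
    nMsg    : ℕ
    nStates : Fin n → ℕ
    init    : (p : Fin n) → Fin (nStates p)
    Δ       : (p : Fin n) → Fin (nStates p) → Act n k nMsg → Fin (nStates p) → Bool
    Δ-wf    : ∀ p s a s′ → Δ p s a s′ ≡ true → InAct p a
    Acc     : ((p : Fin n) → Fin (nStates p)) → Bool

module _ {n k : ℕ} (A : CFM n k) where
  open CFM A

  Trans : Fin n → Set
  Trans p = Fin (nStates p) × Act n k nMsg × Fin (nStates p)

  src : ∀ {p} → Trans p → Fin (nStates p)
  src t = proj₁ t

  act : ∀ {p} → Trans p → Act n k nMsg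
  act t = proj₁ (proj₂ t)

  tgt : ∀ {p} → Trans p → Fin (nStates p)
  tgt t = proj₂ (proj₂ t)

  lastState : ∀ {p} (ℓ : ℕ) → (Fin ℓ → Trans p) → Fin (nStates p) → Fin (nStates p)
  lastState zero    r s = s
  lastState (suc ℓ) r s = tgt (r (fromℕ ℓ))

  record Run (M : MSC n k) : Set where
    open MSC M
    field
      ρ        : (p : Fin n) → Fin (length (w p)) → Trans p
      inΔ      : ∀ p i → Δ p (src (ρ p i)) (act (ρ p i)) (tgt (ρ p i)) ≡ true
      lab      : ∀ p i → actLabel (act (ρ p i)) ≡ lookup (w p) i
      first    : ∀ p i → toℕ i ≡ 0 → src (ρ p i) ≡ init p
      chain    : ∀ p i j → suc (toℕ i) ≡ toℕ j → tgt (ρ p i) ≡ src (ρ p j)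
      internal : ∀ e → Internal M e → IsInt (act (ρ (proj₁ e) (proj₂ e)))
      message  : ∀ e f → msg e f ≡ true →
                 Σ (Fin nMsg) (λ m →
                   IsSnd (act (ρ (proj₁ e) (proj₂ e))) m (proj₁ f) ×
                   IsRcv (act (ρ (proj₁ f) (proj₂ f))) m (proj₁ e))

    finalStates : (p : Fin n) → Fin (nStates p)
    finalStates p = lastState (length (w p)) (ρ p) (init p)

  Accepts : MSC n k → Set
  Accepts M = Σ (Run M) (λ r → Acc (Run.finalStates r) ≡ true)

data Var : Set where
  vx vy : Var

_==ᵥ_ : Var → Var → Bool
vx ==ᵥ vx = true
vy ==ᵥ vy = true
vx ==ᵥ vy = false
vy ==ᵥ vx = false

data FO2 (n k nX : ℕ) : Set where
  proc  : Fin n → Var → FO2 n k nX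
  lab   : Fin k → Var → FO2 n k nX
  mem   : Var → Fin nX → FO2 n k nX
  eq    : Var → Var → FO2 n k nX
  succ  : Var → Var → FO2 n k nX
  msgR  : Var → Var → FO2 n k nX
  le    : Var → Var → FO2 n k nX
  or    : FO2 n k nX → FO2 n k nX → FO2 n k nX
  neg   : FO2 n k nX → FO2 n k nX
  ex    : Var → FO2 n k nX → FO2 n k nX

-- EMSO² formula ∃X₁⋯∃X_nX. ψ
record EMSO2 (n k : ℕ) : Set where
  constructor emso
  field
    nX   : ℕ
    body : FO2 n k nX

free : ∀ {n k nX} → Var → FO2 n k nX → Bool
free v (proc _ u) = v ==ᵥ u
free v (lab _ u) = v ==ᵥ u
free v (mem u _) = v ==ᵥ u
free v (eq u u′) = (v ==ᵥ u) ∨ (v ==ᵥ u′)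
free v (succ u u′) = (v ==ᵥ u) ∨ (v ==ᵥ u′)
free v (msgR u u′) = (v ==ᵥ u) ∨ (v ==ᵥ u′)
free v (le u u′) = (v ==ᵥ u) ∨ (v ==ᵥ u′)
free v (or φ ψ) = free v φ ∨ free v ψ
free v (neg φ) = free v φ
free v (ex u φ) = if v ==ᵥ u then false else free v φ

Sentence : ∀ {n k} → EMSO2 n k → Set
Sentence φ = (free vx (EMSO2.body φ) ≡ false) × (free vy (EMSO2.body φ) ≡ false)

-- length as a string: every variable / process / letter name is one symbol;
-- p(x), a(x): 4; x∈X, x=y, x→y, x⊲y, x≤y: 3; (φ∨ψ): +3; ¬φ: +1; ∃x.φ: +3;
-- each prefix ∃X_i : 2
fsize : ∀ {n k nX} → FO2 n k nX → ℕ
fsize (proc _ _) = 4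
fsize (lab _ _) = 4
fsize (mem _ _) = 3
fsize (eq _ _) = 3
fsize (succ _ _) = 3
fsize (msgR _ _) = 3
fsize (le _ _) = 3
fsize (or φ ψ) = 3 + fsize φ + fsize ψ
fsize (neg φ) = 1 + fsize φ
fsize (ex _ φ) = 3 + fsize φ

size : ∀ {n k} → EMSO2 n k → ℕ
size φ = 2 * EMSO2.nX φ + fsize (EMSO2.body φ)

module _ {n k : ℕ} (M : MSC n k) where
  open MSC M

  atom1 : Maybe (Ev w) → (Ev w → Set) → Set
  atom1 nothing  P = ⊥
  atom1 (just e) P = P e

  atom2 : Maybe (Ev w) → Maybe (Ev w) → (Ev w → Ev w → Set) → Set
  atom2 (just e) (just f) R = R e f
  atom2 _ _ R = ⊥

  upd : (Var → Maybe (Ev w)) → Var → Ev w → Var → Maybe (Ev w)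
  upd ν v e u = if v ==ᵥ u then just e else ν u

  sat : ∀ {nX} → (Fin nX → Ev w → Bool) → (Var → Maybe (Ev w)) → FO2 n k nX → Set
  sat σ ν (proc p u) = atom1 (ν u) (λ e → proj₁ e ≡ p)
  sat σ ν (lab a u) = atom1 (ν u) (λ e → label M e ≡ a)
  sat σ ν (mem u X) = atom1 (ν u) (λ e → σ X e ≡ true)
  sat σ ν (eq u u′) = atom2 (ν u) (ν u′) _≡_
  sat σ ν (succ u u′) = atom2 (ν u) (ν u′) (PSucc w)
  sat σ ν (msgR u u′) = atom2 (ν u) (ν u′) (λ e f → msg e f ≡ true)
  sat σ ν (le u u′) = atom2 (ν u) (ν u′) (_≤ₘ_ M)
  sat σ ν (or φ ψ) = sat σ ν φ ⊎ sat σ ν ψ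
  sat σ ν (neg φ) = ¬ sat σ ν φ
  sat σ ν (ex u φ) = Σ (Ev w) (λ e → sat σ (upd ν u e) φ)

  Models : EMSO2 n k → Set
  Models (emso nX ψ) = Σ (Fin nX → Ev w → Bool) (λ σ → sat σ (λ _ → nothing) ψ)

{-# OPTIONS --safe #-}
{-
A CFM can check every tiling of the events by finitely many tiles whose conditions involve an event, its
process neighbours and its message partner only. So it suffices to certify in this way the truth of each
subformula of the FO² matrix at each event, and this is possible as soon as every event e knows which
types (sets of true subformulas) occur, on which process, before e, after e, and concurrently to e.

Past and future sets propagate along the edges. For concurrency with events of type γ on process q, let
L(e) be the last event of q known to e via a sequence π of processes, and R(e) the first event of q that
knows e via a sequence π′. Sequences of at most |P| processes realise all causal paths, so γ occurs on q
concurrently to e iff for all π and π′ it occurs strictly between L(e) and R(e). For fixed π and π′,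
guess a set of marked γ-events such that between L(e) and R(e) there are one or two marked events if γ
occurs there, while otherwise the last γ-event before R(e) is marked; a greedy choice exists. Conversely,
if nothing is marked between L(e) and R(e) but the last γ-event before R(e) is, then γ does not occur
between them. The number of marked events between L(e) and R(e) is bounded and can be tracked along the
process of e: because channels are FIFO, the growth of L at a receive event is the growth of the
knowledge of the sender since its previous message on this channel, so counters up to three suffice.
There are |P|^O(|P|) pairs (π , π′) and 2^O(|φ|) types, whence the doubly exponential bound.
-}
module Submission where

open import Defs
open import Data.Nat using (ℕ; _+_; _*_; _^_; _≤_)
open import Data.Nat.Logarithm using (⌈log₂_⌉)
open import Data.Fin using (Fin)
open import Data.Product using (Σ; _×_)
open import Function.Bundles using (_⇔_)
open import Data.Nat using (zero; suc; _<_; z≤n; s≤s; _∸_; _<?_; _≤?_; _⊔_)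
open import Data.Nat.Properties
open import Data.Nat.Logarithm using (⌈log₂⌉-mono-≤; ⌈log₂⌈n/2⌉⌉≡⌈log₂n⌉∸1)
open import Data.Fin using (toℕ; fromℕ<; splitAt; inject≤; _↑ˡ_; _↑ʳ_; fromℕ; opposite; combine)
open import Data.Fin.Properties using (toℕ<n; toℕ-fromℕ<; toℕ-injective)
open import Data.Bool using (Bool; true; false; if_then_else_; not; _∨_)
open import Data.Maybe using (Maybe; just; nothing; maybe′; _>>=_; _<∣>_)
open import Data.Vec using (Vec; []; _∷_; replicate; head; tail; there; lookup; tabulate)
open import Data.Product using (_,_; proj₁; proj₂)
open import Data.Sum using (inj₁; inj₂; _⊎_)
open import Data.Unit using (⊤; tt)
open import Data.Empty using (⊥; ⊥-elim)
open import Relation.Nullary using (¬_; Dec; yes; no; does)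
open import Relation.Nullary.Decidable using (map′; _×-dec_; _→-dec_; ¬?; dec-true; dec-false; _⊎-dec_)
open import Relation.Binary.PropositionalEquality
open import Induction.WellFounded using (Acc; acc; WellFounded)
open import Data.Nat.Induction using (<-wellFounded)
open import Data.Fin.Subset using (Subset; _∈_; ∣_∣; _-_) renaming (⊤ to full)
open import Data.Fin.Subset.Properties using (x∈p⇒∣p-x∣<∣p∣; x∈p∧x≢y⇒x∈p-y; ∈⊤; ∣⊤∣≡n)
open import Data.Maybe.Properties using (just-injective)
open import Relation.Binary using (tri<; tri≈; tri>; IsStrictPartialOrder)
open import Relation.Binary.Construct.Closure.ReflexiveTransitive using (Star; ε; _◅_; _◅◅_; reverse; map)
open import Data.Nat.Solver using (module +-*-Solver)
open import Data.Fin.Induction using (spo-wellFounded; spo-noetherian)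
open import Data.List using (length)
open import Function using (flip; id)
open import Function.Bundles using (Equivalence; mk⇔)
import Data.Bool.Properties as Boolₚ
import Data.Vec.Properties as Vecₚ
import Data.Fin.Properties as Finₚ
import Data.Maybe as Maybe
import Data.Maybe.Properties as Maybeₚ

-- Bit codes of finite types

-- Past and future obey recursive equations along the edges; concurrency does not. Its two
-- boundaries on `q` come from opposite directions of time, and unboundedly many events may lie
-- between them. Only a difference of two counts stays finite, and only if the counted events are
-- sparse. Neighbouring events see how this difference changes, which leaves an additive constant
-- open; the acceptance condition, which inspects the ends of all processes together, fixes it. A
-- guessed marking may be empty, so a zero count proves nothing by itself; hence the mark of the
-- last γ-event before the upper boundary is transported separately. No process can tell which path
-- carries the most recent knowledge, and none has to: every path reports true knowledge only, so
-- each window contains all concurrent events of `q`, and the window of the two best paths contains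
-- nothing else. The boundary from the future is not treated on its own: it is the boundary from the
-- past in the reversed chart.

record Code (A : Set) (b : ℕ) : Set where
  field
    enc     : A → Vec Bool b
    dec     : Vec Bool b → A
    dec-enc : ∀ a → dec (enc a) ≡ a

open Code

codeUnit : Code ⊤ 0
codeUnit .enc _ = []
codeUnit .dec _ = tt
codeUnit .dec-enc _ = refl

codeBool : Code Bool 1
codeBool .enc b = b ∷ []
codeBool .dec (b ∷ []) = b
codeBool .dec-enc _ = refl

codeMap : ∀ {A B b} (f : A → B) (g : B → A) → (∀ y → f (g y) ≡ y) → Code A b → Code B b
codeMap f g fg c .enc y = c .enc (g y)
codeMap f g fg c .dec v = f (c .dec v)
codeMap f g fg c .dec-enc y = trans (cong f (c .dec-enc (g y))) (fg y)

split : ∀ a {b} → Vec Bool (a + b) → Vec Bool a × Vec Bool b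
split zero    v       = [] , v
split (suc a) (x ∷ v) = let l , r = split a v in x ∷ l , r

join : ∀ {a b} → Vec Bool a → Vec Bool b → Vec Bool (a + b)
join []      v = v
join (x ∷ u) v = x ∷ join u v

split-join : ∀ {a b} (u : Vec Bool a) (v : Vec Bool b) → split a (join u v) ≡ (u , v)
split-join []      v = refl
split-join (x ∷ u) v rewrite split-join u v = refl

code× : ∀ {A B a b} → Code A a → Code B b → Code (A × B) (a + b)
code× c d .enc (x , y) = join (c .enc x) (d .enc y)
code× {a = a} c d .dec v = c .dec (proj₁ (split a v)) , d .dec (proj₂ (split a v))
code× c d .dec-enc (x , y)
  rewrite split-join (c .enc x) (d .enc y) | c .dec-enc x | d .dec-enc y = refl

codeMaybe : ∀ {A a} → Code A a → Code (Maybe A) (suc a)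
codeMaybe c .enc nothing  = false ∷ replicate _ false
codeMaybe c .enc (just x) = true ∷ c .enc x
codeMaybe c .dec (false ∷ _) = nothing
codeMaybe c .dec (true ∷ v)  = just (c .dec v)
codeMaybe c .dec-enc nothing  = refl
codeMaybe c .dec-enc (just x) = cong just (c .dec-enc x)

codeVec : ∀ {A a} m → Code A a → Code (Vec A m) (m * a)
codeVec zero    c = codeMap (λ _ → []) (λ _ → tt) (λ { [] → refl }) codeUnit
codeVec (suc m) c = codeMap (λ (x , v) → x ∷ v) (λ { (x ∷ v) → x , v }) (λ { (x ∷ v) → refl })
                      (code× c (codeVec m c))

-- Functions on bit vectors, stored as binary trees so that equal tables are propositionally equal.
Tree : Set → ℕ → Set
Tree C zero    = C
Tree C (suc b) = Tree C b × Tree C b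

leaf : ∀ {C b} → Tree C b → Vec Bool b → C
leaf t       []          = t
leaf (l , r) (false ∷ v) = leaf l v
leaf (l , r) (true ∷ v)  = leaf r v

grow : ∀ {C b} → (Vec Bool b → C) → Tree C b
grow {b = zero}  f = f []
grow {b = suc b} f = grow (λ v → f (false ∷ v)) , grow (λ v → f (true ∷ v))

leaf-grow : ∀ {C b} (f : Vec Bool b → C) v → leaf (grow f) v ≡ f v
leaf-grow f []          = refl
leaf-grow f (false ∷ v) = leaf-grow (λ v → f (false ∷ v)) v
leaf-grow f (true ∷ v)  = leaf-grow (λ v → f (true ∷ v)) v

-- A table with `b`-bit keys has `2 ^ b` entries. Here the second exponential arises: keys of linear
-- length give tiles with exponentially many bits.
codeTree : ∀ {C c} b → Code C c → Code (Tree C b) (2 ^ b * c)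
codeTree {c = c} zero    k = subst (Code _) (sym (+-identityʳ c)) k
codeTree {c = c} (suc b) k =
  subst (Code _) (trans (sym (*-distribʳ-+ c (2 ^ b) (2 ^ b)))
                        (cong (λ x → (2 ^ b + x) * c) (sym (+-identityʳ (2 ^ b)))))
    (code× (codeTree b k) (codeTree b k))

module Tab {A : Set} {b : ℕ} (code : Code A b) where
  get : ∀ {C} → Tree C b → A → C
  get t a = leaf t (code .enc a)

  tab : ∀ {C} → (A → C) → Tree C b
  tab f = grow (λ v → f (code .dec v))

  get-tab : ∀ {C} (f : A → C) a → get (tab f) a ≡ f a
  get-tab f a = trans (leaf-grow _ (code .enc a)) (cong f (code .dec-enc a))

codeEq : ∀ {A b} → Code A b → (x y : A) → Dec (x ≡ y)
codeEq c x y = map′ (λ q → trans (sym (c .dec-enc x)) (trans (cong (c .dec) q) (c .dec-enc y)))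
                    (cong (c .enc)) (Vecₚ.≡-dec Boolₚ._≟_ (c .enc x) (c .enc y))

allBits? : ∀ b {P : Vec Bool b → Set} → (∀ v → Dec (P v)) → Dec (∀ v → P v)
allBits? zero    P? = map′ (λ { p [] → p }) (λ f → f []) (P? [])
allBits? (suc b) P? with allBits? b (λ v → P? (false ∷ v)) | allBits? b (λ v → P? (true ∷ v))
... | yes p | yes q = yes λ { (false ∷ v) → p v ; (true ∷ v) → q v }
... | no ¬p | _     = no λ f → ¬p (λ v → f _)
... | yes _ | no ¬q = no λ f → ¬q (λ v → f _)

anyBits? : ∀ b {P : Vec Bool b → Set} → (∀ v → Dec (P v)) → Dec (Σ _ P)
anyBits? zero    P? = map′ ([] ,_) (λ { ([] , p) → p }) (P? [])
anyBits? (suc b) P? with anyBits? b (λ v → P? (false ∷ v)) | anyBits? b (λ v → P? (true ∷ v))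
... | yes (v , p) | _           = yes (_ , p)
... | no _        | yes (v , p) = yes (_ , p)
... | no ¬p       | no ¬q       = no λ { (false ∷ v , p) → ¬p (v , p) ; (true ∷ v , p) → ¬q (v , p) }

-- `dec` is onto, having `enc` as a section, so running through the bit vectors meets every element.
-- Quantified conditions on tiles thereby become Boolean tests.
all? : ∀ {A b} → Code A b → {P : A → Set} → (∀ a → Dec (P a)) → Dec (∀ a → P a)
all? c {P} P? = map′ (λ f a → subst P (c .dec-enc a) (f (c .enc a))) (λ f v → f (c .dec v))
                     (allBits? _ (λ v → P? (c .dec v)))

any? : ∀ {A b} → Code A b → {P : A → Set} → (∀ a → Dec (P a)) → Dec (Σ A P)
any? c {P} P? = map′ (λ (v , p) → c .dec v , p)
                     (λ (a , p) → c .enc a , subst P (sym (c .dec-enc a)) p)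
                     (anyBits? _ (λ v → P? (c .dec v)))

bitsToFin : ∀ {b} → Vec Bool b → Fin (2 ^ b)
bitsToFin []                      = Fin.zero
bitsToFin {suc b} (false ∷ v) = bitsToFin v ↑ˡ (2 ^ b + 0)
bitsToFin {suc b} (true ∷ v)  = (2 ^ b) ↑ʳ (bitsToFin v ↑ˡ 0)

finToBits : ∀ b → Fin (2 ^ b) → Vec Bool b
finToBits zero    _ = []
finToBits (suc b) i with splitAt (2 ^ b) i
... | inj₁ j = false ∷ finToBits b j
... | inj₂ j with splitAt (2 ^ b) {0} j
...   | inj₁ l = true ∷ finToBits b l

finToBits-bitsToFin : ∀ {b} (v : Vec Bool b) → finToBits b (bitsToFin v) ≡ v
finToBits-bitsToFin [] = refl
finToBits-bitsToFin {suc b} (false ∷ v)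
  rewrite Finₚ.splitAt-↑ˡ (2 ^ b) (bitsToFin v) (2 ^ b + 0) =
  cong (false ∷_) (finToBits-bitsToFin v)
finToBits-bitsToFin {suc b} (true ∷ v)
  rewrite Finₚ.splitAt-↑ʳ (2 ^ b) (2 ^ b + 0) (bitsToFin v ↑ˡ 0)
        | Finₚ.splitAt-↑ˡ (2 ^ b) (bitsToFin v) 0 =
  cong (true ∷_) (finToBits-bitsToFin v)

bitsToFin-finToBits : ∀ b (i : Fin (2 ^ b)) → bitsToFin (finToBits b i) ≡ i
bitsToFin-finToBits zero Fin.zero = refl
bitsToFin-finToBits (suc b) i with splitAt (2 ^ b) i in e
... | inj₁ j = trans (cong (_↑ˡ _) (bitsToFin-finToBits b j)) (Finₚ.splitAt⁻¹-↑ˡ e)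
... | inj₂ j with splitAt (2 ^ b) {0} j in e′
...   | inj₁ l = trans (cong ((2 ^ b) ↑ʳ_)
          (trans (cong (_↑ˡ 0) (bitsToFin-finToBits b l)) (Finₚ.splitAt⁻¹-↑ˡ e′)))
          (Finₚ.splitAt⁻¹-↑ʳ e)

n≤2^⌈log₂n⌉ : ∀ n → n ≤ 2 ^ ⌈log₂ n ⌉
n≤2^⌈log₂n⌉ n = go n (<-wellFounded n)
  where
  open ≤-Reasoning
  go : ∀ n → Acc _<_ n → n ≤ 2 ^ ⌈log₂ n ⌉
  go 0 _ = z≤n
  go 1 _ = s≤s z≤n
  go n@(suc (suc m)) (acc rs) = begin
    n                                ≡⟨ sym (⌊n/2⌋+⌈n/2⌉≡n n) ⟩
    ⌊ n /2⌋ + ⌈ n /2⌉                ≤⟨ +-monoˡ-≤ _ (⌊n/2⌋≤⌈n/2⌉ n) ⟩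
    ⌈ n /2⌉ + ⌈ n /2⌉                ≡⟨ cong (⌈ n /2⌉ +_) (sym (+-identityʳ _)) ⟩
    2 * ⌈ n /2⌉                      ≤⟨ *-monoʳ-≤ 2 (go ⌈ n /2⌉ (rs (⌈n/2⌉<n m))) ⟩
    2 ^ suc ⌈log₂ ⌈ n /2⌉ ⌉          ≡⟨ cong (λ x → 2 ^ suc x) (⌈log₂⌈n/2⌉⌉≡⌈log₂n⌉∸1 n) ⟩
    2 ^ suc (⌈log₂ n ⌉ ∸ 1)          ≡⟨ cong (2 ^_) (m+[n∸m]≡n (⌈log₂⌉-mono-≤ {2} {n} (s≤s (s≤s z≤n)))) ⟩
    2 ^ ⌈log₂ n ⌉                    ∎
    where open Data.Nat using (⌊_/2⌋; ⌈_/2⌉)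

-- There may be more bit patterns than elements of `Fin n`; the spare ones decode to the default
-- `d`. Coding processes therefore presupposes a process, and the theorem treats the empty set of
-- processes separately.
truncate : ∀ {m n} → Fin n → Fin m → Fin n
truncate {n = n} d j with toℕ j <? n
... | yes lt = fromℕ< lt
... | no _   = d

truncate-inject≤ : ∀ {m n} (d i : Fin n) (leq : n ≤ m) → truncate d (inject≤ i leq) ≡ i
truncate-inject≤ {n = n} d i leq with toℕ (inject≤ i leq) <? n
... | yes lt = toℕ-injective (trans (toℕ-fromℕ< lt) (Finₚ.toℕ-inject≤ i leq))
... | no ge  = ⊥-elim (ge (subst (_< n) (sym (Finₚ.toℕ-inject≤ i leq)) (toℕ<n i)))

codeFin : ∀ {n} → Fin n → Code (Fin n) ⌈log₂ n ⌉
codeFin {n} d .enc i = finToBits _ (inject≤ i (n≤2^⌈log₂n⌉ n))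
codeFin {n} d .dec v = truncate d (bitsToFin v)
codeFin {n} d .dec-enc i =
  trans (cong (truncate d) (bitsToFin-finToBits ⌈log₂ n ⌉ _)) (truncate-inject≤ d i (n≤2^⌈log₂n⌉ n))

-- Charts

-- An event has at most one process predecessor and one sender, so two partial functions describe
-- its incoming edges. With these as parameters, the edges of the reversed chart are an instance of
-- the same definition.
Edge : {E : Set} → (E → Maybe E) → (E → Maybe E) → E → E → Set
Edge p s e f = p f ≡ just e ⊎ s f ≡ just e

-- An MSC without its labels. Every field comes with its mirror image, so that reversing time is a
-- mere exchange of fields (dual below); copos counts positions from the end of a process.
record Chart (n : ℕ) : Set₁ where
  field
    E          : Set
    site       : E → Fin n
    len        : Fin n → ℕ
    pos copos  : E → ℕ
    pos+copos  : ∀ e → pos e + suc (copos e) ≡ len (site e)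
    ev coev    : Fin n → ℕ → Maybe E
    ev-just    : ∀ {p x e} → ev p x ≡ just e → site e ≡ p × pos e ≡ x
    ev-self    : ∀ e → ev (site e) (pos e) ≡ just e
    ev-nothing : ∀ {p x} → ev p x ≡ nothing → len p ≤ x
    coev-just    : ∀ {p x e} → coev p x ≡ just e → site e ≡ p × copos e ≡ x
    coev-self    : ∀ e → coev (site e) (copos e) ≡ just e
    coev-nothing : ∀ {p x} → coev p x ≡ nothing → len p ≤ x
    prev next sender receiver : E → Maybe E
    prev-just    : ∀ {e g} → prev e ≡ just g → site g ≡ site e × suc (pos g) ≡ pos e
    prev-nothing : ∀ {e} → prev e ≡ nothing → pos e ≡ 0
    next-just    : ∀ {e g} → next e ≡ just g → site g ≡ site e × suc (copos g) ≡ copos e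
    next-nothing : ∀ {e} → next e ≡ nothing → copos e ≡ 0
    sender-receiver : ∀ {e f} → sender f ≡ just e → receiver e ≡ just f
    receiver-sender : ∀ {e f} → receiver e ≡ just f → sender f ≡ just e
    msg-site   : ∀ {e f} → sender f ≡ just e → site e ≢ site f
    one-msg    : ∀ {e g f} → sender e ≡ just g → receiver e ≡ just f → ⊥
    fifo       : ∀ {e f e′ f′} → sender f ≡ just e → sender f′ ≡ just e′ →
                 site e ≡ site e′ → site f ≡ site f′ → pos e < pos e′ → pos f < pos f′
    wf         : WellFounded (Edge prev sender)
    cowf       : WellFounded (Edge next receiver)

module ChartBasics {n : ℕ} (G : Chart n) where
  open Chart G public

  uniq : ∀ {e f} → site e ≡ site f → pos e ≡ pos f → e ≡ f
  uniq {e} {f} p q = just-injective (trans (sym (ev-self e)) (trans (cong₂ ev p q) (ev-self f)))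

  _≟E_ : (e f : E) → Dec (e ≡ f)
  e ≟E f = map′ (λ (p , q) → uniq p q) (λ { refl → refl , refl })
             ((site e Finₚ.≟ site f) ×-dec (pos e ≟ pos f))

  pos<len : ∀ e → pos e < len (site e)
  pos<len e = subst (pos e <_) (pos+copos e) (m<m+n (pos e) (s≤s z≤n))

  pos-copos : ∀ {e f} → site e ≡ site f → pos e + suc (copos e) ≡ pos f + suc (copos f)
  pos-copos {e} {f} p = trans (pos+copos e) (trans (cong len p) (sym (pos+copos f)))

  copos-uniq : ∀ {e f} → site e ≡ site f → copos e ≡ copos f → e ≡ f
  copos-uniq {e} {f} p q = uniq p (+-cancelʳ-≡ (suc (copos f)) (pos e) (pos f)
    (trans (cong (λ x → pos e + suc x) (sym q)) (pos-copos p)))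

  pos<⇒copos> : ∀ {e f} → site e ≡ site f → pos e < pos f → copos f < copos e
  pos<⇒copos> {e} {f} p lt = ≰⇒> λ leq →
    <-irrefl (pos-copos p) (+-mono-<-≤ lt (s≤s leq))

  copos<⇒pos> : ∀ {e f} → site e ≡ site f → copos e < copos f → pos f < pos e
  copos<⇒pos> {e} {f} p lt = ≰⇒> λ leq →
    <-irrefl (pos-copos p) (+-mono-≤-< leq (s≤s lt))

  prev⇒next : ∀ {e g} → prev e ≡ just g → next g ≡ just e
  prev⇒next {e} {g} pe with next g in ng
  ... | nothing = ⊥-elim (<-irrefl refl (<-≤-trans (pos<⇒copos> {g} {e} p (≤-reflexive q))
                    (subst (_≤ copos e) (sym (next-nothing ng)) z≤n)))
    where p = proj₁ (prev-just pe) ; q = proj₂ (prev-just pe)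
  ... | just e′ = cong just (copos-uniq (trans (proj₁ (next-just ng)) p)
                    (suc-injective (trans (proj₂ (next-just ng)) lem)))
    where
    p = proj₁ (prev-just pe) ; q = proj₂ (prev-just pe)
    lem : copos g ≡ suc (copos e)
    lem = +-cancelˡ-≡ (suc (pos g)) _ _
            (trans (sym (+-suc (pos g) (copos g))) (trans (pos-copos p)
              (cong (_+ suc (copos e)) (sym q))))

  next⇒prev : ∀ {e g} → next e ≡ just g → prev g ≡ just e
  next⇒prev {e} {g} ne with prev g in pg
  ... | nothing = ⊥-elim (<-irrefl refl (<-≤-trans (copos<⇒pos> {g} {e} p (≤-reflexive q))
                    (subst (_≤ pos e) (sym (prev-nothing pg)) z≤n)))
    where p = proj₁ (next-just ne) ; q = proj₂ (next-just ne)
  ... | just e′ = cong just (copos-uniq (trans (proj₁ (prev-just pg)) p)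
                    (trans (sym (proj₂ (next-just (prev⇒next pg)))) q))
    where p = proj₁ (next-just ne) ; q = proj₂ (next-just ne)

  sender-inj : ∀ {e f g} → sender e ≡ just g → sender f ≡ just g → e ≡ f
  sender-inj p q = just-injective (trans (sym (sender-receiver p)) (sender-receiver q))

  infix 4 _⊑_
  _⊑_ : E → E → Set
  _⊑_ = Star (Edge prev sender)

  ⊑-prev : ∀ {e g} → prev e ≡ just g → g ⊑ e
  ⊑-prev p = inj₁ p ◅ ε

  ⊑-sender : ∀ {e g} → sender e ≡ just g → g ⊑ e
  ⊑-sender p = inj₂ p ◅ ε

  ⊑-last : ∀ {f e} → f ⊑ e → f ≡ e ⊎ Σ E λ g → f ⊑ g × Edge prev sender g e
  ⊑-last ε = inj₁ refl
  ⊑-last (x ◅ r) with ⊑-last r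
  ... | inj₁ refl = inj₂ (_ , ε , x)
  ... | inj₂ (g , r′ , y) = inj₂ (g , x ◅ r′ , y)

  -- A cycle through `e` is also a cycle through its predecessor on the cycle, so well-founded
  -- recursion would descend forever.
  no-cycle : ∀ {e g} → e ⊑ g → Edge prev sender g e → ⊥
  no-cycle {e} r x = go (wf e) r x
    where
    go : ∀ {e g} → Acc (Edge prev sender) e → e ⊑ g → Edge prev sender g e → ⊥
    go (acc rs) r x with ⊑-last r
    ... | inj₁ refl          = go (rs x) ε x
    ... | inj₂ (h , r′ , y) = go (rs x) (x ◅ r′) y

  ⊑-antisym : ∀ {e f} → e ⊑ f → f ⊑ e → e ≡ f
  ⊑-antisym r s with ⊑-last s
  ... | inj₁ p = sym p
  ... | inj₂ (g , s′ , x) = ⊥-elim (no-cycle (r ◅◅ s′) x)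

  ⊑-process : ∀ {g e} → site g ≡ site e → pos g ≤ pos e → g ⊑ e
  ⊑-process {g} {e} p leq = go (pos e) e refl p leq
    where
    go : ∀ x e → pos e ≡ x → site g ≡ site e → pos g ≤ x → g ⊑ e
    go x e q p leq with m≤n⇒m<n∨m≡n leq
    ... | inj₂ r = subst (g ⊑_) (uniq p (trans r (sym q))) ε
    ... | inj₁ lt with prev e in pe
    ...   | nothing = ⊥-elim (n≮0 (subst (pos g <_) (trans (sym q) (prev-nothing pe)) lt))
    go (suc x) e q p leq | inj₁ (s≤s lt) | just e′ =
      go x e′ (suc-injective (trans (proj₂ (prev-just pe)) q)) (trans p (sym (proj₁ (prev-just pe)))) lt
      ◅◅ ⊑-prev pe

  ⊑-pos : ∀ {g e} → site g ≡ site e → g ⊑ e → pos g ≤ pos e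
  ⊑-pos {g} {e} p r with ≤-total (pos g) (pos e)
  ... | inj₁ leq = leq
  ... | inj₂ ge = ≤-reflexive (cong pos (⊑-antisym r (⊑-process (sym p) ge)))

  _⊑?_ : ∀ f e → Dec (f ⊑ e)
  f ⊑? e = go e (wf e)
    where
    via? : ∀ m → (∀ {g} → m ≡ just g → Dec (f ⊑ g)) → Dec (Σ E λ g → m ≡ just g × f ⊑ g)
    via? nothing  _ = no λ ()
    via? (just g) d = map′ (λ r → g , refl , r) (λ { (g , refl , r) → r }) (d refl)
    go : ∀ e → Acc (Edge prev sender) e → Dec (f ⊑ e)
    go e (acc rs) with f ≟E e
    ... | yes refl = yes ε
    ... | no f≢e with via? (prev e) (λ p → go _ (rs (inj₁ p))) | via? (sender e) (λ p → go _ (rs (inj₂ p)))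
    ...   | yes (g , p , r) | _               = yes (r ◅◅ ⊑-prev p)
    ...   | no _            | yes (g , p , r) = yes (r ◅◅ ⊑-sender p)
    ...   | no ¬a           | no ¬b           = no λ r → lem (⊑-last r)
      where
      lem : f ≡ e ⊎ Σ E (λ g → f ⊑ g × Edge prev sender g e) → ⊥
      lem (inj₁ q) = f≢e q
      lem (inj₂ (g , r , inj₁ p)) = ¬a (g , p , r)
      lem (inj₂ (g , r , inj₂ p)) = ¬b (g , p , r)

  someE? : {P : E → Set} → (∀ e → Dec (P e)) → Dec (Σ E P)
  someE? {P} P? = map′ (λ { (p , x , lt , e , _ , pe) → e , pe })
                       (λ (e , pe) → site e , pos e , pos<len e , e , ev-self e , pe)
                       (Finₚ.any? λ p → anyUpTo? (λ x → at (ev p x)) (len p))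
    where
    at : ∀ m → Dec (Σ E λ e → m ≡ just e × P e)
    at nothing  = no λ ()
    at (just e) = map′ (λ pe → e , refl , pe) (λ { (e , refl , pe) → pe }) (P? e)

  IsLast : (Fin n → Maybe E) → Set
  IsLast last = ∀ p → maybe′ (λ e → site e ≡ p × suc (pos e) ≡ len p) (len p ≡ 0) (last p)

  onSite : Fin n → Maybe E → Maybe E
  onSite s nothing = nothing
  onSite s (just h) = if does (site h Finₚ.≟ s) then just h else nothing

  onSite-just : ∀ {s m h} → onSite s m ≡ just h → m ≡ just h × site h ≡ s
  onSite-just {s} {just h} p with site h Finₚ.≟ s
  onSite-just {s} {just h} refl | yes q = refl , q

  onSite-yes : ∀ {s h} → site h ≡ s → onSite s (just h) ≡ just h
  onSite-yes {s} {h} q with site h Finₚ.≟ s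
  ... | yes _ = refl
  ... | no ¬q = ⊥-elim (¬q q)

  fromSite : Fin n → E → Maybe E
  fromSite s e = onSite s (sender e)

  -- It yields the sending event `g`, not the receiver. The views of a channel from its two ends
  -- thus have values of the same kind and can be equated.
  toSite : Fin n → E → Maybe E
  toSite r g = maybe′ (λ _ → just g) nothing (onSite r (receiver g))

  toSite-just : ∀ {r g h} → toSite r g ≡ just h → h ≡ g × Σ E λ f → receiver g ≡ just f × site f ≡ r
  toSite-just {r} {g} p with onSite r (receiver g) in q
  toSite-just {r} {g} refl | just f = refl , f , onSite-just {m = receiver g} q

  find : (E → Maybe E) → Fin n → ℕ → Maybe E
  find sel p zero    = nothing
  find sel p (suc x) = (ev p x >>= sel) <∣> find sel p x

  Latest : (E → Maybe E) → Fin n → ℕ → Maybe E → Set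
  Latest sel p x nothing  = ∀ g → site g ≡ p → pos g < x → sel g ≡ nothing
  Latest sel p x (just a) = Σ E λ g → site g ≡ p × pos g < x × sel g ≡ just a ×
                              (∀ g′ → site g′ ≡ p → pos g < pos g′ → pos g′ < x → sel g′ ≡ nothing)

  latest-suc : ∀ sel p x → Latest sel p x (find sel p x) → Latest sel p (suc x) (find sel p (suc x))
  latest-suc sel p x ih₀ with ev p x in evx
  ... | nothing with find sel p x | ih₀
  ...   | nothing | ih = λ g q lt → ih g q (lem g q lt)
    where
    lem : ∀ g → site g ≡ p → pos g < suc x → pos g < x
    lem g refl (s≤s leq) = <-≤-trans (pos<len g) (ev-nothing evx)
  ...   | just a | g , q , lt , s , f = g , q , m<n⇒m<1+n lt , s ,
            λ g′ q′ l lt′ → f g′ q′ l (<-≤-trans (subst (λ z → pos g′ < len z) q′ (pos<len g′)) (ev-nothing evx))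
  latest-suc sel p x ih₀ | just e with ev-just evx
  ... | refl , refl with sel e in se
  ...   | just a = e , refl , ≤-refl , se , λ g′ _ l lt → ⊥-elim (<-irrefl refl (<-≤-trans l (≤-pred lt)))
  ...   | nothing with find sel p x | ih₀
  ...     | nothing | ih = lem
    where
    lem : ∀ g → site g ≡ site e → pos g < suc (pos e) → sel g ≡ nothing
    lem g q lt with m≤n⇒m<n∨m≡n (≤-pred lt)
    ... | inj₁ l = ih g q l
    ... | inj₂ r = subst (λ z → sel z ≡ nothing) (sym (uniq q r)) se
  ...     | just a | g , q , lt , s , f = g , q , m<n⇒m<1+n lt , s , lem
    where
    lem : ∀ g′ → site g′ ≡ site e → pos g < pos g′ → pos g′ < suc (pos e) → sel g′ ≡ nothing
    lem g′ q′ l lt′ with m≤n⇒m<n∨m≡n (≤-pred lt′)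
    ... | inj₁ l′ = f g′ q′ l l′
    ... | inj₂ r = subst (λ z → sel z ≡ nothing) (sym (uniq q′ r)) se

  find-latest : ∀ sel p x → Latest sel p x (find sel p x)
  find-latest sel p zero g _ ()
  find-latest sel p (suc x) = latest-suc sel p x (find-latest sel p x)

  -- FIFO: if the boundaries x on r and y on s cut the channel from s to r at the same message, then the
  -- latest message received before x is the latest message sent before y.
  find-match : ∀ r s x y →
    (∀ h e → sender e ≡ just h → site h ≡ s → site e ≡ r → (pos e < x → pos h < y) × (pos h < y → pos e < x)) →
    find (fromSite s) r x ≡ find (toSite r) s y
  find-match r s x y cut
    with find (fromSite s) r x | find-latest (fromSite s) r x | find (toSite r) s y | find-latest (toSite r) s y
  ... | nothing | _ | nothing | _ = refl
  ... | nothing | none | just h | g , q , lt , sel , _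
    with toSite-just {g = g} sel
  ... | refl , f , rec , sf with none f sf (proj₂ (cut g f (receiver-sender rec) q sf) lt)
  ... | c rewrite receiver-sender rec | onSite-yes q with () ← c
  find-match r s x y cut | just h | e , q , lt , sel , _ | nothing | none
    with onSite-just {m = sender e} sel
  ... | se , sh with none h sh (proj₁ (cut h e se sh q) lt)
  ... | c rewrite sender-receiver se | onSite-yes q with () ← c
  find-match r s x y cut | just h | e , q , lt , sel , lst | just h′ | g , q′ , lt′ , sel′ , lst′
    with onSite-just {m = sender e} sel | toSite-just {g = g} sel′
  ... | se , sh | refl , f , rec , sf with <-cmp (pos h) (pos g)
  ... | tri≈ _ p _ = cong just (uniq (trans sh (sym q′)) p)
  ... | tri< l _ _ with lst f sf (fifo se (receiver-sender rec) (trans sh (sym q′)) (trans q (sym sf)) l)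
                             (proj₂ (cut g f (receiver-sender rec) q′ sf) lt′)
  ...   | c rewrite receiver-sender rec | onSite-yes q′ with () ← c
  find-match r s x y cut | just h | e , q , lt , sel , lst | just h′ | g , q′ , lt′ , sel′ , lst′
    | se , sh | refl , f , rec , sf | tri> _ _ l
    with lst′ h sh l (proj₁ (cut h e se sh q) lt)
  ... | c rewrite sender-receiver se | onSite-yes q with () ← c

  -- This is the cut just before a message. Messages sent before `h` arrive before `e` by FIFO;
  -- conversely, one that arrives before `e` without having been sent before `h` would violate FIFO
  -- or be the message from `h` itself.
  find-match-msg : ∀ {h e} → sender e ≡ just h →
    find (fromSite (site h)) (site e) (pos e) ≡ find (toSite (site e)) (site h) (pos h)
  find-match-msg {h} {e} se = find-match _ _ _ _ λ h′ e′ se′ q q′ →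
    (λ lt → ≰⇒> λ leq → case≤ h′ e′ se′ q q′ lt (m≤n⇒m<n∨m≡n leq)) , fifo se′ se q q′
    where
    case≤ : ∀ h′ e′ → sender e′ ≡ just h′ → site h′ ≡ site h → site e′ ≡ site e → pos e′ < pos e →
            pos h < pos h′ ⊎ pos h ≡ pos h′ → ⊥
    case≤ h′ e′ se′ q q′ lt (inj₁ l) = <-asym lt (fifo se se′ (sym q) (sym q′) l)
    case≤ h′ e′ se′ q q′ lt (inj₂ p) with uniq (sym q) p
    ... | refl with sender-inj se se′
    ...   | refl = <-irrefl refl lt

  find-match-end : ∀ r s → find (fromSite s) r (len r) ≡ find (toSite r) s (len s)
  find-match-end r s = find-match _ _ _ _ λ h e _ q q′ →
    (λ _ → subst (λ z → pos h < len z) q (pos<len h)) , (λ _ → subst (λ z → pos e < len z) q′ (pos<len e))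

-- Reversal of time

dual : ∀ {n} → Chart n → Chart n
dual G = record
  { E = E ; site = site ; len = len ; pos = copos ; copos = pos
  ; pos+copos = λ e → trans (+-suc (copos e) (pos e)) (trans (+-comm (suc (copos e)) (pos e)) (pos+copos e))
  ; ev = coev ; coev = ev
  ; ev-just = coev-just ; ev-self = coev-self ; ev-nothing = coev-nothing
  ; coev-just = ev-just ; coev-self = ev-self ; coev-nothing = ev-nothing
  ; prev = next ; next = prev ; sender = receiver ; receiver = sender
  ; prev-just = next-just ; prev-nothing = next-nothing
  ; next-just = prev-just ; next-nothing = prev-nothing
  ; sender-receiver = receiver-sender ; receiver-sender = sender-receiver
  ; msg-site = λ r q → msg-site (receiver-sender r) (sym q)
  ; one-msg = λ r s → one-msg s r
  ; fifo = cofifo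
  ; wf = cowf ; cowf = wf }
  where
  open ChartBasics G
  -- FIFO can be reversed because each process is totally ordered: sends in the wrong order would
  -- put their receives in the wrong order, and equal sends have equal receives.
  cofifo : ∀ {e f e′ f′} → receiver f ≡ just e → receiver f′ ≡ just e′ →
           site e ≡ site e′ → site f ≡ site f′ → copos e < copos e′ → copos f < copos f′
  cofifo {e} {f} {e′} {f′} r r′ p q lt with <-cmp (copos f) (copos f′)
  ... | tri< l _ _ = l
  ... | tri≈ _ c _ with copos-uniq q c
  ...   | refl with just-injective (trans (sym r) r′)
  ...     | refl = ⊥-elim (<-irrefl refl lt)
  cofifo {e} {f} {e′} {f′} r r′ p q lt | tri> _ _ g =
    ⊥-elim (<-asym (copos<⇒pos> p lt)
      (fifo (receiver-sender r) (receiver-sender r′) q p (copos<⇒pos> (sym q) g)))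

module Duality {n : ℕ} (G : Chart n) where
  open ChartBasics G
  open ChartBasics (dual G) using () renaming (_⊑_ to _⊑ᵈ_)

  ⊑ᵈ⇒⊒ : ∀ {e f} → f ⊑ᵈ e → e ⊑ f
  ⊑ᵈ⇒⊒ = reverse λ { (inj₁ x) → inj₁ (next⇒prev x) ; (inj₂ x) → inj₂ (receiver-sender x) }

  ⊒⇒⊑ᵈ : ∀ {e f} → e ⊑ f → f ⊑ᵈ e
  ⊒⇒⊑ᵈ = reverse λ { (inj₁ x) → inj₁ (prev⇒next x) ; (inj₂ x) → inj₂ (sender-receiver x) }

-- Knowledge along paths of processes

x∉p-x : ∀ {n} (p : Subset n) x → ¬ x ∈ p - x
x∉p-x (true ∷ p)  (Fin.suc x) (there i) = x∉p-x p x i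
x∉p-x (false ∷ p) (Fin.suc x) (there i) = x∉p-x p x i
x∉p-x (true ∷ p)  Fin.zero ()
x∉p-x (false ∷ p) Fin.zero ()

-- A path lists processes, the current one first; repeating a process means staying there.
Path : ℕ → ℕ → Set
Path n m = Vec (Fin n) (suc m)

origin : ∀ {n m} → Path n m → Fin n
origin (q ∷ [])        = q
origin (_ ∷ ρ@(_ ∷ _)) = origin ρ

origin-constant : ∀ {n} m (p : Fin n) → origin (replicate (suc m) p) ≡ p
origin-constant zero    p = refl
origin-constant (suc m) p = origin-constant m p

somePath : ∀ {n} (p q : Fin n) → Σ (Path n n) λ ρ → head ρ ≡ p × origin ρ ≡ q
somePath {suc n} p q = p ∷ replicate (suc n) q , refl , origin-constant n q

module Knowledge {n : ℕ} (G : Chart n) where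
  open ChartBasics G

  -- The number of events of origin ρ that are known, via messages along ρ, after the first x events of
  -- head ρ.
  L : ∀ {m} → Path n m → ℕ → ℕ
  L (q ∷ [])        x = x
  L (r ∷ ρ@(s ∷ _)) x = if does (r Finₚ.≟ s) then L ρ x else maybe′ (λ h → L ρ (suc (pos h))) 0 (find (fromSite s) r x)

  L-zero : ∀ {m} (ρ : Path n m) → L ρ 0 ≡ 0
  L-zero (q ∷ []) = refl
  L-zero (r ∷ s ∷ ρ) with r Finₚ.≟ s
  ... | yes _ = L-zero (s ∷ ρ)
  ... | no _  = refl

  -- At a receive from `h`, the old value stems from the previous message on the same channel. By
  -- FIFO that message was sent before `h`, so monotonicity along the rest of the path applies;
  -- hence the mutual recursion with `L-mono`.
  L-step : ∀ {m} (ρ : Path n m) x → L ρ x ≤ L ρ (suc x)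
  L-mono : ∀ {m} (ρ : Path n m) {x y} → x ≤ y → L ρ x ≤ L ρ y

  L-step (q ∷ []) x = n≤1+n x
  L-step (r ∷ s ∷ ρ) x with r Finₚ.≟ s
  ... | yes _ = L-step (s ∷ ρ) x
  ... | no _ with ev r x in evx
  ...   | nothing = ≤-refl
  ...   | just e with fromSite s e in se
  ...     | nothing = ≤-refl
  ...     | just h with ev-just evx | onSite-just {m = sender e} se
  ...       | refl , refl | sh , refl
    rewrite find-match-msg sh
    with find (toSite (site e)) (site h) (pos h) | find-latest (toSite (site e)) (site h) (pos h)
  ...         | nothing | _ = z≤n
  ...         | just h′ | g , _ , lt , sel , _ with toSite-just {g = g} sel
  ...           | refl , _ = L-mono (s ∷ ρ) (<⇒≤ (s≤s lt))

  L-mono ρ {x} {zero} z≤n = ≤-refl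
  L-mono ρ {x} {suc y} leq with m≤n⇒m<n∨m≡n leq
  ... | inj₁ lt   = ≤-trans (L-mono ρ (≤-pred lt)) (L-step ρ y)
  ... | inj₂ refl = ≤-refl

  L-bound : ∀ {m} (ρ : Path n m) {x} → x ≤ len (head ρ) → L ρ x ≤ len (origin ρ)
  L-bound (q ∷ []) leq = leq
  L-bound (r ∷ s ∷ ρ) {x} leq with r Finₚ.≟ s
  ... | yes refl = L-bound (s ∷ ρ) leq
  ... | no _ with find (fromSite s) r x | find-latest (fromSite s) r x
  ...   | nothing | _ = z≤n
  ...   | just h  | e , _ , _ , sel , _ with onSite-just {m = sender e} sel
  ...     | _ , refl = L-bound (s ∷ ρ) (pos<len h)

  L-sound : ∀ {m} (ρ : Path n m) {x f} → site f ≡ origin ρ → pos f < L ρ x →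
            Σ E λ e → site e ≡ head ρ × pos e < x × f ⊑ e
  L-sound (q ∷ []) {f = f} p lt = f , p , lt , ε
  L-sound (r ∷ s ∷ ρ) {x} p lt with r Finₚ.≟ s
  ... | yes refl = L-sound (s ∷ ρ) p lt
  ... | no _ with find (fromSite s) r x | find-latest (fromSite s) r x
  ...   | just h | g , q , l , sel , _ with onSite-just {m = sender g} sel
  ...     | sh , refl with L-sound (s ∷ ρ) p lt
  ...       | e , q′ , l′ , r′ = g , q , l , r′ ◅◅ ⊑-process q′ (≤-pred l′) ◅◅ ⊑-sender sh

  L-sound⊑ : ∀ {m} (ρ : Path n m) {e f} → site f ≡ origin ρ → site e ≡ head ρ →
             pos f < L ρ (suc (pos e)) → f ⊑ e
  L-sound⊑ ρ p q lt with L-sound ρ p lt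
  ... | g , q′ , l , r = r ◅◅ ⊑-process (trans q′ (sym q)) (≤-pred l)

  L-hop : ∀ {m} (ρ : Path n m) {h e} → sender e ≡ just h → site h ≡ head ρ →
          L (site e ∷ ρ) (suc (pos e)) ≡ L ρ (suc (pos h))
  L-hop ρ@(s ∷ _) {h} {e} se q with site e Finₚ.≟ s
  ... | yes p = ⊥-elim (msg-site se (trans q (sym p)))
  ... | no _ rewrite ev-self e | se | onSite-yes q = refl

  L-next : ∀ {m} r s (ρ : Vec (Fin n) m) e → site e ≡ r → let old = L (r ∷ s ∷ ρ) (pos e) in
    L (r ∷ s ∷ ρ) (suc (pos e)) ≡
    (if does (r Finₚ.≟ s) then L (s ∷ ρ) (suc (pos e))
     else maybe′ (λ h → if does (site h Finₚ.≟ s) then L (s ∷ ρ) (suc (pos h)) else old) old (sender e))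
  L-next r s ρ e refl with r Finₚ.≟ s
  ... | yes _ = refl
  ... | no _ rewrite ev-self e with sender e
  ...   | nothing = refl
  ...   | just h with site h Finₚ.≟ s
  ...     | yes _ = refl
  ...     | no _  = refl

  L-constant : ∀ m p x → L {m} (replicate (suc m) p) x ≡ x
  L-constant zero    p x = refl
  L-constant (suc m) p x with p Finₚ.≟ p
  ... | yes _ = L-constant m p x
  ... | no ¬q = ⊥-elim (¬q refl)

  data Walk (A : Subset n) (f : E) : E → Set where
    start : site f ∈ A → Walk A f f
    step  : ∀ {g e} → Walk A f g → Edge prev sender g e → site e ∈ A → Walk A f e

  walk-end : ∀ {A f e} → Walk A f e → site e ∈ A
  walk-end (start a)    = a
  walk-end (step _ _ a) = a

  walk-⊑ : ∀ {A f e} → Walk A f e → f ⊑ e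
  walk-⊑ (start _)    = ε
  walk-⊑ (step w x _) = walk-⊑ w ◅◅ (x ◅ ε)

  ⊑-walk : ∀ {f e g} → Walk full f g → g ⊑ e → Walk full f e
  ⊑-walk w ε       = w
  ⊑-walk w (x ◅ r) = ⊑-walk (step w x ∈⊤) r

  -- The first visit of process p by a walk: up to the message that enters p, the walk avoids p.
  Entry : Subset n → Fin n → E → E → Set
  Entry A p f e = Σ E λ g → site g ≡ p × g ⊑ e ×
                    (f ≡ g ⊎ Σ E λ h → sender g ≡ just h × Walk (A - p) f h)

  enter : ∀ {A f e} p → Walk A f e → Walk (A - p) f e ⊎ Entry A p f e
  enter {f = f} p (start a) with site f Finₚ.≟ p
  ... | yes q = inj₂ (f , q , ε , inj₁ refl)
  ... | no ¬q = inj₁ (start (x∈p∧x≢y⇒x∈p-y a ¬q))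
  enter {e = e} p (step w x a) with enter p w
  ... | inj₂ (g , q , r , o) = inj₂ (g , q , r ◅◅ (x ◅ ε) , o)
  ... | inj₁ w′ with site e Finₚ.≟ p
  ...   | no ¬q = inj₁ (step w′ x (x∈p∧x≢y⇒x∈p-y a ¬q))
  enter {A} {e = e} p (step w (inj₂ x) a) | inj₁ w′ | yes q = inj₂ (e , q , ε , inj₂ (_ , x , w′))
  -- A process edge cannot be the first to reach `p`, as its source lies on `p` too. Hence `p` is
  -- entered by a message.
  enter {A} {e = e} p (step {g} w (inj₁ x) a) | inj₁ w′ | yes refl =
    ⊥-elim (x∉p-x A p (subst (_∈ A - p) (proj₁ (prev-just x)) (walk-end w′)))

  -- Cut the walk at its first visit of `site e`. The part before avoids this process and is handled
  -- by induction on the size of `A`, the entering message adds one hop, and from there the process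
  -- order leads to `e`. So no process has to be visited twice, and paths of bounded length suffice.
  walk-path : ∀ m A {f e} → ∣ A ∣ ≤ m → Walk A f e →
    Σ (Path n m) λ ρ → head ρ ≡ site e × origin ρ ≡ site f × pos f < L ρ (suc (pos e))
  walk-path zero A leq w = ⊥-elim (n≮0 (<-≤-trans (x∈p⇒∣p-x∣<∣p∣ (walk-end w)) leq))
  walk-path (suc m) A {f} {e} leq w with enter (site e) w
  ... | inj₁ w′ = ⊥-elim (x∉p-x A (site e) (walk-end w′))
  ... | inj₂ (g , q , r , inj₁ refl) =
    -- The walk starts on the process of `e` and needs no hop; staying there pads the path to the
    -- prescribed length.
    replicate (suc (suc m)) (site e) , refl , trans (origin-constant (suc m) (site e)) (sym q) ,
    subst (pos f <_) (sym (L-constant (suc m) (site e) _)) (s≤s (⊑-pos q r))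
  ... | inj₂ (g , q , r , inj₂ (h , sg , w′))
    with walk-path m (A - site e) (≤-pred (<-≤-trans (x∈p⇒∣p-x∣<∣p∣ (walk-end w)) leq)) w′
  ...   | ρ@(s ∷ _) , hd , og , lt = site e ∷ ρ , refl , og ,
    <-≤-trans (subst (pos f <_) (sym (trans (cong (λ z → L (z ∷ ρ) (suc (pos g))) (sym q)) (L-hop ρ sg (sym hd)))) lt)
              (L-mono (site e ∷ ρ) (s≤s (⊑-pos q r)))

  L-complete : ∀ {f e} → f ⊑ e →
    Σ (Path n n) λ ρ → head ρ ≡ site e × origin ρ ≡ site f × pos f < L ρ (suc (pos e))
  L-complete r = walk-path n full (≤-reflexive (∣⊤∣≡n n)) (⊑-walk (start ∈⊤) r)

-- Bounded counters along paths

-- Exact values up to 3 suffice for the greedy marking: a window holds at most two marked events,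
-- and the upper boundary passes at most one more from an event to its successor. `many` is
-- absorbing, so no later summand can hide an overflow.
data Cap : Set where
  c0 c1 c2 c3 many : Cap

sucC : Cap → Cap
sucC c0   = c1
sucC c1   = c2
sucC c2   = c3
sucC c3   = many
sucC many = many

infixl 6 _⊕_
_⊕_ : Cap → Cap → Cap
c0   ⊕ y = y
c1   ⊕ y = sucC y
c2   ⊕ y = sucC (sucC y)
c3   ⊕ y = sucC (sucC (sucC y))
many ⊕ y = many

cap : ℕ → Cap
cap zero    = c0
cap (suc m) = sucC (cap m)

sucC-⊕ : ∀ x y → sucC x ⊕ y ≡ sucC (x ⊕ y)
sucC-⊕ c0   y    = refl
sucC-⊕ c1   y    = refl
sucC-⊕ c2   y    = refl
sucC-⊕ c3   c0   = refl
sucC-⊕ c3   c1   = refl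
sucC-⊕ c3   c2   = refl
sucC-⊕ c3   c3   = refl
sucC-⊕ c3   many = refl
sucC-⊕ many y    = refl

cap-+ : ∀ m k → cap (m + k) ≡ cap m ⊕ cap k
cap-+ zero    k = refl
cap-+ (suc m) k = trans (cong sucC (cap-+ m k)) (sym (sucC-⊕ (cap m) (cap k)))

sucC≢c0 : ∀ x → c0 ≢ sucC x
sucC≢c0 c0   ()
sucC≢c0 c1   ()
sucC≢c0 c2   ()
sucC≢c0 c3   ()
sucC≢c0 many ()

sucC-inj : ∀ x y → sucC x ≡ sucC y → sucC x ≢ many → x ≡ y
sucC-inj c0 c0 _ _ = refl
sucC-inj c0 c1 ()
sucC-inj c0 c2 ()
sucC-inj c0 c3 ()
sucC-inj c0 many ()
sucC-inj c1 c0 ()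
sucC-inj c1 c1 _ _ = refl
sucC-inj c1 c2 ()
sucC-inj c1 c3 ()
sucC-inj c1 many ()
sucC-inj c2 c0 ()
sucC-inj c2 c1 ()
sucC-inj c2 c2 _ _ = refl
sucC-inj c2 c3 ()
sucC-inj c2 many ()
sucC-inj c3 _ _ h = ⊥-elim (h refl)
sucC-inj many _ _ h = ⊥-elim (h refl)

cap-inj : ∀ m k → cap m ≡ cap k → cap m ≢ many → m ≡ k
cap-inj zero    zero    _ _ = refl
cap-inj zero    (suc k) p _ = ⊥-elim (sucC≢c0 (cap k) p)
cap-inj (suc m) zero    p _ = ⊥-elim (sucC≢c0 (cap m) (sym p))
cap-inj (suc m) (suc k) p h =
  cong suc (cap-inj m k (sucC-inj (cap m) (cap k) p h) (λ q → h (cong sucC q)))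

uncap : ∀ c → c ≢ many → Σ ℕ λ m → c ≡ cap m
uncap c0   _ = 0 , refl
uncap c1   _ = 1 , refl
uncap c2   _ = 2 , refl
uncap c3   _ = 3 , refl
uncap many h = ⊥-elim (h refl)

many-⊕ˡ : ∀ x y → x ⊕ y ≢ many → x ≢ many
many-⊕ˡ many y h refl = h refl

cap≤3 : ∀ m → m ≤ 3 → cap m ≢ many
cap≤3 0 _ ()
cap≤3 1 _ ()
cap≤3 2 _ ()
cap≤3 3 _ ()
cap≤3 (suc (suc (suc (suc m)))) (s≤s (s≤s (s≤s ())))

codeCap : Code Cap 3
codeCap = codeMap from to from-to (code× codeBool (code× codeBool codeBool))
  where
  from : Bool × Bool × Bool → Cap
  from (false , false , false) = c0
  from (false , false , true)  = c1
  from (false , true , false)  = c2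
  from (false , true , true)   = c3
  from (true , _ , _)          = many
  to : Cap → Bool × Bool × Bool
  to c0   = false , false , false
  to c1   = false , false , true
  to c2   = false , true , false
  to c3   = false , true , true
  to many = true , false , false
  from-to : ∀ c → from (to c) ≡ c
  from-to c0   = refl
  from-to c1   = refl
  from-to c2   = refl
  from-to c3   = refl
  from-to many = refl

_≟C_ : (x y : Cap) → Dec (x ≡ y)
_≟C_ = codeEq codeCap

bit : Bool → ℕ
bit true  = 1
bit false = 0

cnt : (ℕ → Bool) → ℕ → ℕ
cnt f zero    = 0
cnt f (suc x) = bit (f x) + cnt f x

cnt-mono : ∀ f {x y} → x ≤ y → cnt f x ≤ cnt f y
cnt-mono f {x} {zero} z≤n = z≤n
cnt-mono f {x} {suc y} leq with m≤n⇒m<n∨m≡n leq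
... | inj₁ lt   = ≤-trans (cnt-mono f (≤-pred lt)) (m≤n+m _ (bit (f y)))
... | inj₂ refl = ≤-refl

-- There is one entry per hop, from a process `s` to a process `r`. The first component is meant for
-- events of `r`: how many marked events become known there. The second is meant for events of `s`:
-- how many became known since the previous message from `s` to `r`. Elsewhere they are
-- unconstrained.
Entries : ℕ → Set
Entries m = Vec (Cap × Cap) m

incE accE : ∀ {m} → Entries (suc m) → Cap
incE v = proj₁ (head v)
accE v = proj₂ (head v)

incAt : ∀ {n m} → Path n m → Entries m → Bool → Cap
incAt (_ ∷ [])    []      w = cap (bit w)
incAt (_ ∷ _ ∷ _) (i ∷ _) w = proj₁ i

-- Everything a tile has to satisfy is stated for an arbitrary type X of "events with tiles": X is
-- instantiated by the events of an MSC, and by the pairs (process , tile) a CFM sees.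
module LocalTab {n : ℕ} {X : Set} (site : X → Fin n) (to : X → Maybe (Fin n)) where

  sendsTo : X → Fin n → Bool
  sendsTo g r = does (Maybeₚ.≡-dec Finₚ._≟_ (to g) (just r))

  module _ (W : X → Bool) where

    -- A message from `h` delivers `accE (tab h)`, which includes the growth at `h` itself. The
    -- accumulator is therefore reset one event late, at the successor of an event that sends to
    -- `r`.
    TabOK : ∀ {m} → Path n m → (X → Entries m) → (x : X) (prev sender : Maybe X) → Set
    TabOK (_ ∷ [])          tab x pv sd = ⊤
    TabOK (r ∷ ρ@(s ∷ _)) tab x pv sd =
      (site x ≡ r → incE (tab x) ≡
        (if does (r Finₚ.≟ s) then incAt ρ (tail (tab x)) (W x)
         else maybe′ (λ h → if does (site h Finₚ.≟ s) then accE (tab h) else c0) c0 sd)) ×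
      (r ≢ s → site x ≡ s → accE (tab x) ≡
        incAt ρ (tail (tab x)) (W x) ⊕ maybe′ (λ g → if sendsTo g r then c0 else accE (tab g)) c0 pv) ×
      TabOK ρ (λ y → tail (tab y)) x pv sd

    TabOK? : ∀ {m} (ρ : Path n m) tab x pv sd → Dec (TabOK ρ tab x pv sd)
    TabOK? (_ ∷ [])          tab x pv sd = yes tt
    TabOK? (r ∷ ρ@(s ∷ _)) tab x pv sd =
      ((site x Finₚ.≟ r) →-dec (_ ≟C _)) ×-dec
      (¬? (r Finₚ.≟ s) →-dec ((site x Finₚ.≟ s) →-dec (_ ≟C _))) ×-dec
      TabOK? ρ (λ y → tail (tab y)) x pv sd

  -- A marked event that never becomes known at the head of the path is stuck at some hop: it became
  -- known on `s` only after the last message from `s` to `r`. The sum over all hops counts these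
  -- events.
  resid : ∀ {m} → Path n m → (X → Entries m) → (Fin n → Maybe X) → Cap
  resid (_ ∷ [])        tab last = c0
  resid (r ∷ ρ@(s ∷ _)) tab last =
    (if does (r Finₚ.≟ s) then c0
     else maybe′ (λ g → if sendsTo g r then c0 else accE (tab g)) c0 (last s)) ⊕
    resid ρ (λ y → tail (tab y)) last

  -- A table that transports a Boolean along a path.
  FlagOK : (base : X → Bool) → ∀ {m} → Path n m → (X → Vec Bool (suc m)) → (x : X) (prev sender : Maybe X) → Set
  FlagOK base (q ∷ [])        tab x pv sd = site x ≡ q → head (tab x) ≡ base x
  FlagOK base (r ∷ ρ@(s ∷ _)) tab x pv sd =
    (site x ≡ r → head (tab x) ≡
      (if does (r Finₚ.≟ s) then head (tail (tab x))
       else (let old = maybe′ (λ g → head (tab g)) true pv in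
             maybe′ (λ h → if does (site h Finₚ.≟ s) then head (tail (tab h)) else old) old sd))) ×
    FlagOK base ρ (λ y → tail (tab y)) x pv sd

  FlagOK? : ∀ base {m} (ρ : Path n m) tab x pv sd → Dec (FlagOK base ρ tab x pv sd)
  FlagOK? base (q ∷ [])        tab x pv sd = (site x Finₚ.≟ q) →-dec (_ Boolₚ.≟ _)
  FlagOK? base (r ∷ ρ@(s ∷ _)) tab x pv sd =
    ((site x Finₚ.≟ r) →-dec (_ Boolₚ.≟ _)) ×-dec FlagOK? base ρ (λ y → tail (tab y)) x pv sd

-- Correctness of the counters

module Counting {n : ℕ} (G : Chart n) (W : Chart.E G → Bool) where
  open ChartBasics G
  open Knowledge G

  mark : Fin n → ℕ → Bool
  mark p x = maybe′ W false (ev p x)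

  Cnt : Fin n → ℕ → ℕ
  Cnt p = cnt (mark p)

  after : ∀ {m} → Path n m → Maybe E → ℕ
  after ρ = maybe′ (λ h → L ρ (suc (pos h))) 0

  after-find≤ : ∀ {m} (ρ : Path n m) r x → after ρ (find (toSite r) (head ρ) x) ≤ L ρ x
  after-find≤ ρ r x with find (toSite r) (head ρ) x | find-latest (toSite r) (head ρ) x
  ... | nothing | _ = z≤n
  ... | just h | g , _ , lt , sel , _ with toSite-just {g = g} sel
  ...   | refl , _ = L-mono ρ lt

  inc : ∀ {m} → Path n m → ℕ → ℕ
  inc ρ x = Cnt (origin ρ) (L ρ (suc x)) ∸ Cnt (origin ρ) (L ρ x)

  accTo : ∀ {m} → Fin n → Path n m → E → ℕ
  accTo r ρ h = Cnt (origin ρ) (L ρ (suc (pos h))) ∸ Cnt (origin ρ) (after ρ (find (toSite r) (head ρ) (pos h)))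

  accBefore : ∀ {m} → Fin n → Path n m → ℕ → ℕ
  accBefore r ρ x = Cnt (origin ρ) (L ρ x) ∸ Cnt (origin ρ) (after ρ (find (toSite r) (head ρ) x))

  inc-eq : ∀ {m} r s (ρ : Vec (Fin n) m) e → site e ≡ r →
    inc (r ∷ s ∷ ρ) (pos e) ≡
    (if does (r Finₚ.≟ s) then inc (s ∷ ρ) (pos e)
     else maybe′ (λ h → if does (site h Finₚ.≟ s) then accTo r (s ∷ ρ) h else 0) 0 (sender e))
  inc-eq r s ρ e refl with r Finₚ.≟ s
  ... | yes _ = refl
  ... | no _ rewrite ev-self e with sender e in se
  ...   | nothing = n∸n≡0 (Cnt (origin (s ∷ ρ)) (after (s ∷ ρ) (find (fromSite s) (site e) (pos e))))
  ...   | just h with site h Finₚ.≟ s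
  ...     | no _ = n∸n≡0 (Cnt (origin (s ∷ ρ)) (after (s ∷ ρ) (find (fromSite s) (site e) (pos e))))
  ...     | yes refl rewrite find-match-msg se = refl

  telescope : ∀ {a b c} → a ≤ b → b ≤ c → c ∸ a ≡ (c ∸ b) + (b ∸ a)
  telescope {a} {b} {c} p q = begin
    c ∸ a                 ≡⟨ cong (_∸ a) (sym (m∸n+n≡m q)) ⟩
    (c ∸ b) + b ∸ a       ≡⟨ +-∸-assoc (c ∸ b) p ⟩
    (c ∸ b) + (b ∸ a)     ∎
    where open ≡-Reasoning

  acc-eq : ∀ {m} r (ρ : Path n m) e → accTo r ρ e ≡ inc ρ (pos e) + accBefore r ρ (pos e)
  acc-eq r ρ e = telescope (cnt-mono (mark (origin ρ)) (after-find≤ ρ r (pos e))) (cnt-mono (mark (origin ρ)) (L-step ρ (pos e)))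

  module _ (to : E → Maybe (Fin n)) (to-ok : ∀ e → to e ≡ Maybe.map site (receiver e)) where
    open LocalTab site to

    toSite-if : ∀ r g → toSite r g ≡ (if sendsTo g r then just g else nothing)
    toSite-if r g rewrite to-ok g with receiver g
    ... | nothing = refl
    ... | just f with site f Finₚ.≟ r
    ...   | yes _ = refl
    ...   | no _ = refl

    accBefore-suc : ∀ {m} r (ρ : Path n m) g → site g ≡ head ρ →
      accBefore r ρ (suc (pos g)) ≡ (if sendsTo g r then 0 else accTo r ρ g)
    accBefore-suc r ρ g p rewrite sym p | ev-self g | toSite-if r g with sendsTo g r
    ... | true  = n∸n≡0 (Cnt (origin ρ) (L ρ (suc (pos g))))
    ... | false = refl

    accBefore-zero : ∀ {m} r (ρ : Path n m) → accBefore r ρ 0 ≡ 0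
    accBefore-zero r ρ rewrite L-zero ρ = refl

    accBefore-eq : ∀ {m} r (ρ : Path n m) e → site e ≡ head ρ →
      accBefore r ρ (pos e) ≡ maybe′ (λ g → if sendsTo g r then 0 else accTo r ρ g) 0 (prev e)
    accBefore-eq r ρ e p with prev e in pe
    ... | nothing rewrite prev-nothing pe = accBefore-zero r ρ
    ... | just g rewrite sym (proj₂ (prev-just pe)) = accBefore-suc r ρ g (trans (proj₁ (prev-just pe)) p)

    hop-cong : ∀ r s (sd : Maybe E) {i j} (a : E → Cap) (b : E → ℕ) →
      (r ≡ s → i ≡ cap j) → (r ≢ s → ∀ h → site h ≡ s → a h ≡ cap (b h)) →
      (if does (r Finₚ.≟ s) then i else maybe′ (λ h → if does (site h Finₚ.≟ s) then a h else c0) c0 sd) ≡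
      cap (if does (r Finₚ.≟ s) then j else maybe′ (λ h → if does (site h Finₚ.≟ s) then b h else 0) 0 sd)
    hop-cong r s sd a b f g with r Finₚ.≟ s
    ... | yes q = f q
    hop-cong r s nothing  a b f g | no ne = refl
    hop-cong r s (just h) a b f g | no ne with site h Finₚ.≟ s
    ... | yes q = g ne h q
    ... | no _  = refl

    reset-cong : ∀ r (pv : Maybe E) (a : E → Cap) (b : E → ℕ) → (∀ g → pv ≡ just g → a g ≡ cap (b g)) →
      maybe′ (λ g → if sendsTo g r then c0 else a g) c0 pv ≡ cap (maybe′ (λ g → if sendsTo g r then 0 else b g) 0 pv)
    reset-cong r nothing  a b f = refl
    reset-cong r (just g) a b f with sendsTo g r
    ... | true  = refl
    ... | false = f g refl

    trueTab : ∀ {m} → Path n m → E → Entries m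
    trueTab (_ ∷ [])            e = []
    trueTab (r ∷ ρ@(_ ∷ _)) e = (cap (inc (r ∷ ρ) (pos e)) , cap (accTo r ρ e)) ∷ trueTab ρ e

    inc-base : ∀ q e → site e ≡ q → inc (q ∷ []) (pos e) ≡ bit (W e)
    inc-base q e refl rewrite ev-self e = m+n∸n≡m (bit (W e)) (Cnt (site e) (pos e))

    trueTab-inc : ∀ {m} (ρ : Path n m) e → site e ≡ head ρ → incAt ρ (trueTab ρ e) (W e) ≡ cap (inc ρ (pos e))
    trueTab-inc (q ∷ [])          e p = cong cap (sym (inc-base q e p))
    trueTab-inc (r ∷ (s ∷ ρ)) e p = refl

    trueTab-ok : ∀ {m} (ρ : Path n m) e → TabOK W ρ (trueTab ρ) e (prev e) (sender e)
    trueTab-ok (_ ∷ []) e = tt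
    trueTab-ok (r ∷ ρ@(s ∷ ρ′)) e =
      (λ p → trans (cong cap (inc-eq r s ρ′ e p))
        (sym (hop-cong r s (sender e) _ (accTo r ρ) (λ q → trueTab-inc ρ e (trans p q)) (λ _ _ _ → refl)))) ,
      (λ _ p → trans (cong cap (trans (acc-eq r ρ e) (cong (inc ρ (pos e) +_) (accBefore-eq r ρ e p))))
        (trans (cap-+ (inc ρ (pos e)) _)
          (cong₂ _⊕_ (sym (trueTab-inc ρ e p)) (sym (reset-cong r (prev e) _ (accTo r ρ) λ _ _ → refl))))) ,
      trueTab-ok ρ e

    acc-sound : ∀ {m} r (ρ : Path n m) (tab : E → Entries (suc m)) → r ≢ head ρ →
      (∀ e → TabOK W (r ∷ ρ) tab e (prev e) (sender e)) →
      (∀ e → site e ≡ head ρ → incAt ρ (tail (tab e)) (W e) ≡ cap (inc ρ (pos e))) →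
      ∀ e → site e ≡ head ρ → accE (tab e) ≡ cap (accTo r ρ e)
    acc-sound r ρ@(s ∷ _) tab ne ok ih e p = go (pos e) e refl p
      where
      go : ∀ x e → pos e ≡ x → site e ≡ head ρ → accE (tab e) ≡ cap (accTo r ρ e)
      go x e px p = trans (proj₁ (proj₂ (ok e)) ne p)
        (trans (cong₂ _⊕_ (ih e p) (trans (reset-cong r (prev e) _ (accTo r ρ) (before x px))
                                          (cong cap (sym (accBefore-eq r ρ e p)))))
          (trans (sym (cap-+ (inc ρ (pos e)) _)) (cong cap (sym (acc-eq r ρ e)))))
        where
        before : ∀ x → pos e ≡ x → ∀ g → prev e ≡ just g → accE (tab g) ≡ cap (accTo r ρ g)
        before zero    px g pg with () ← trans (proj₂ (prev-just pg)) px
        before (suc x) px g pg =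
          go x g (suc-injective (trans (proj₂ (prev-just pg)) px)) (trans (proj₁ (prev-just pg)) p)

    -- The local equations have one solution. The recursion follows the path; at each hop,
    -- `acc-sound` adds an induction along the sending process.
    tab-sound : ∀ {m} (ρ : Path n m) (tab : E → Entries m) →
      (∀ e → TabOK W ρ tab e (prev e) (sender e)) →
      ∀ e → site e ≡ head ρ → incAt ρ (tab e) (W e) ≡ cap (inc ρ (pos e))
    tab-sound (q ∷ []) tab ok e p with tab e
    ... | [] = cong cap (sym (inc-base q e p))
    tab-sound (r ∷ ρ@(s ∷ ρ′)) tab ok e p = trans (hd (tab e)) (trans (proj₁ (ok e) p)
        (trans (hop-cong r s (sender e) _ (accTo r ρ) (λ q → ih e (trans p q)) (λ ne → acc-sound r ρ tab ne ok ih))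
               (cong cap (sym (inc-eq r s ρ′ e p)))))
      where
      hd : ∀ v → incAt (r ∷ ρ) v (W e) ≡ incE v
      hd (_ ∷ _) = refl
      ih : ∀ e → site e ≡ s → incAt ρ (tail (tab e)) (W e) ≡ cap (inc ρ (pos e))
      ih = tab-sound ρ (λ y → tail (tab y)) (λ e → proj₂ (proj₂ (ok e)))

    residN : ∀ {m} → Path n m → ℕ
    residN ρ = Cnt (origin ρ) (len (origin ρ)) ∸ Cnt (origin ρ) (L ρ (len (head ρ)))

    -- What `r` never learns splits at the final knowledge of `s`: either `s` never learns it, or
    -- `s` learns it after its last message to `r`. By `find-match-end`, this message is also the
    -- last one that `r` receives from `s`.
    residN-eq : ∀ {m} r s (ρ : Vec (Fin n) m) →
      (if does (r Finₚ.≟ s) then 0 else accBefore r (s ∷ ρ) (len s)) + residN (s ∷ ρ) ≡ residN (r ∷ s ∷ ρ)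
    residN-eq r s ρ with r Finₚ.≟ s
    ... | yes refl = refl
    ... | no _ rewrite find-match-end r s =
      trans (+-comm _ (residN (s ∷ ρ)))
            (sym (telescope (cnt-mono (mark o) (after-find≤ (s ∷ ρ) r (len s))) (cnt-mono (mark o) (L-bound (s ∷ ρ) ≤-refl))))
      where o = origin (s ∷ ρ)

    resid-sound : ∀ {m} (ρ : Path n m) (tab : E → Entries m) last → IsLast last →
      (∀ e → TabOK W ρ tab e (prev e) (sender e)) → resid ρ tab last ≡ cap (residN ρ)
    resid-sound (q ∷ []) tab last il ok = cong cap (sym (n∸n≡0 (Cnt q (len q))))
    resid-sound (r ∷ ρ@(s ∷ ρ′)) tab last il ok =
      trans (cong₂ _⊕_ now (resid-sound ρ (λ y → tail (tab y)) last il (λ e → proj₂ (proj₂ (ok e)))))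
        (trans (sym (cap-+ (if does (r Finₚ.≟ s) then 0 else accBefore r ρ (len s)) (residN ρ)))
               (cong cap total))
      where
      accs : r ≢ s → ∀ e → site e ≡ s → accE (tab e) ≡ cap (accTo r ρ e)
      accs ne = acc-sound r ρ tab ne ok (tab-sound ρ (λ y → tail (tab y)) (λ e → proj₂ (proj₂ (ok e))))
      end : ∀ m → maybe′ (λ e → site e ≡ s × suc (pos e) ≡ len s) (len s ≡ 0) m →
            (∀ e → site e ≡ s → accE (tab e) ≡ cap (accTo r ρ e)) →
            maybe′ (λ g → if sendsTo g r then c0 else accE (tab g)) c0 m ≡ cap (accBefore r ρ (len s))
      end nothing  z       _ rewrite z = cong cap (sym (accBefore-zero r ρ))
      end (just g) (p , z) a rewrite sym z | accBefore-suc r ρ g p with sendsTo g r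
      ... | true  = refl
      ... | false = a g p
      now : (if does (r Finₚ.≟ s) then c0
             else maybe′ (λ g → if sendsTo g r then c0 else accE (tab g)) c0 (last s)) ≡
            cap (if does (r Finₚ.≟ s) then 0 else accBefore r ρ (len s))
      now = by (r Finₚ.≟ s)
        where
        by : (d : Dec (r ≡ s)) →
          (if does d then c0 else maybe′ (λ g → if sendsTo g r then c0 else accE (tab g)) c0 (last s)) ≡
          cap (if does d then 0 else accBefore r ρ (len s))
        by (yes _) = refl
        by (no ne) = end (last s) (il s) (accs ne)
      total : (if does (r Finₚ.≟ s) then 0 else accBefore r ρ (len s)) + residN ρ ≡ residN (r ∷ ρ)
      total = residN-eq r s ρ′

-- Booleans transported along paths

module Flags {n : ℕ} (G : Chart n) (F : ℕ → Bool) (F0 : F 0 ≡ true) where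
  open ChartBasics G
  open Knowledge G

  flag-cong : ∀ r s (sd : Maybe E) {i j o x} (a : E → Bool) (b : E → ℕ) →
    (r ≡ s → i ≡ F j) → (∀ h → site h ≡ s → a h ≡ F (b h)) → o ≡ F x →
    (if does (r Finₚ.≟ s) then i else maybe′ (λ h → if does (site h Finₚ.≟ s) then a h else o) o sd) ≡
    F (if does (r Finₚ.≟ s) then j else maybe′ (λ h → if does (site h Finₚ.≟ s) then b h else x) x sd)
  flag-cong r s sd a b f g p with r Finₚ.≟ s
  ... | yes q = f q
  flag-cong r s nothing  a b f g p | no _ = p
  flag-cong r s (just h) a b f g p | no _ with site h Finₚ.≟ s
  ... | yes q = g h q
  ... | no _  = p

  -- Before the first event of a process the known prefix is empty, and `F0` makes the default
  -- `true` the right value for it.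
  old-cong : ∀ {m} (ρ : Path n m) e (a : E → Bool) →
    (∀ g → prev e ≡ just g → a g ≡ F (L ρ (suc (pos g)))) →
    maybe′ a true (prev e) ≡ F (L ρ (pos e))
  old-cong ρ e a f with prev e in pe
  ... | nothing = trans (sym F0) (cong F (sym (trans (cong (L ρ) (prev-nothing pe)) (L-zero ρ))))
  ... | just g  = trans (f g refl) (cong (λ z → F (L ρ z)) (proj₂ (prev-just pe)))

  flag-sound : ∀ (to : E → Maybe (Fin n)) base {m} (ρ : Path n m) (tab : E → Vec Bool (suc m)) →
    (∀ e → site e ≡ origin ρ → base e ≡ F (suc (pos e))) →
    (∀ e → LocalTab.FlagOK site to base ρ tab e (prev e) (sender e)) →
    ∀ e → site e ≡ head ρ → head (tab e) ≡ F (L ρ (suc (pos e)))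
  flag-sound to base (q ∷ []) tab bok ok e p = trans (ok e p) (bok e p)
  flag-sound to base (r ∷ ρ@(s ∷ ρ′)) tab bok ok e p = go (pos e) e refl p
    where
    ih : ∀ e → site e ≡ s → head (tail (tab e)) ≡ F (L ρ (suc (pos e)))
    ih = flag-sound to base ρ (λ y → tail (tab y)) bok (λ e → proj₂ (ok e))
    go : ∀ x e → pos e ≡ x → site e ≡ r → head (tab e) ≡ F (L (r ∷ ρ) (suc (pos e)))
    go x e px p = trans (proj₁ (ok e) p)
      (trans (flag-cong r s (sender e) _ (λ h → L ρ (suc (pos h))) (λ q → ih e (trans p q)) ih
               (old-cong (r ∷ ρ) e _ (before x px)))
             (cong F (sym (L-next r s ρ′ e p))))
      where
      before : ∀ x → pos e ≡ x → ∀ g → prev e ≡ just g → head (tab g) ≡ F (L (r ∷ ρ) (suc (pos g)))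
      before zero    px g pg with () ← trans (proj₂ (prev-just pg)) px
      before (suc x) px g pg =
        go x g (suc-injective (trans (proj₂ (prev-just pg)) px)) (trans (proj₁ (prev-just pg)) p)

  flagTab : ∀ {m} → Path n m → E → Vec Bool (suc m)
  flagTab ρ@(_ ∷ [])         e = F (L ρ (suc (pos e))) ∷ []
  flagTab ρ@(_ ∷ ρ′@(_ ∷ _)) e = F (L ρ (suc (pos e))) ∷ flagTab ρ′ e

  flagTab-head : ∀ {m} (ρ : Path n m) e → head (flagTab ρ e) ≡ F (L ρ (suc (pos e)))
  flagTab-head (_ ∷ [])    e = refl
  flagTab-head (_ ∷ _ ∷ _) e = refl

  flagTab-ok : ∀ (to : E → Maybe (Fin n)) base {m} (ρ : Path n m) →
    (∀ e → site e ≡ origin ρ → base e ≡ F (suc (pos e))) →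
    ∀ e → LocalTab.FlagOK site to base ρ (flagTab ρ) e (prev e) (sender e)
  flagTab-ok to base (q ∷ []) bok e p = sym (bok e p)
  flagTab-ok to base (r ∷ ρ@(s ∷ ρ′)) bok e =
    (λ p → trans (cong F (L-next r s ρ′ e p))
      (sym (flag-cong r s (sender e) _ (λ h → L ρ (suc (pos h))) (λ _ → flagTab-head ρ e) (λ h _ → flagTab-head ρ h)
             (old-cong (r ∷ ρ) e _ (λ _ _ → refl))))) ,
    flagTab-ok to base ρ bok e

-- Greedy marking

true-of : ∀ {A : Set} (d : Dec A) → does d ≡ true → A
true-of (yes a) _ = a

of-true : ∀ {A : Set} (d : Dec A) → A → does d ≡ true
of-true d a = dec-true d a

cnt-none : ∀ f {a c} → a ≤ c → (∀ y → a ≤ y → y < c → f y ≡ true → ⊥) → cnt f c ≡ cnt f a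
cnt-none f {a} {zero} z≤n none = refl
cnt-none f {a} {suc c} leq none with m≤n⇒m<n∨m≡n leq
... | inj₂ refl = refl
... | inj₁ (s≤s lt) with f c in fc
...   | true  = ⊥-elim (none c lt ≤-refl fc)
...   | false = cnt-none f lt (λ y p q → none y p (m<n⇒m<1+n q))

cnt-one : ∀ f m {a c} → a ≤ c → (∀ y → a ≤ y → y < c → f y ≡ true → m ≡ just y) → cnt f c ≤ 1 + cnt f a
cnt-one f m {a} {zero} z≤n one = z≤n
cnt-one f m {a} {suc c} leq one with m≤n⇒m<n∨m≡n leq
... | inj₂ refl = n≤1+n _
... | inj₁ (s≤s lt) with f c in fc
...   | false = cnt-one f m lt (λ y p q → one y p (m<n⇒m<1+n q))
...   | true  = s≤s (≤-reflexive (cnt-none f lt λ y p q t → <-irrefl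
                  (Maybeₚ.just-injective (trans (sym (one y p (m<n⇒m<1+n q) t)) (one c lt ≤-refl fc))) q))

cnt-two : ∀ f m k {a c} → a ≤ c → (∀ y → a ≤ y → y < c → f y ≡ true → m ≡ just y ⊎ k ≡ just y) →
          cnt f c ≤ 2 + cnt f a
cnt-two f m k {a} {zero} z≤n two = z≤n
cnt-two f m k {a} {suc c} leq two with m≤n⇒m<n∨m≡n leq
... | inj₂ refl = m≤n+m _ 2
... | inj₁ (s≤s lt) with f c in fc
...   | false = cnt-two f m k lt (λ y p q → two y p (m<n⇒m<1+n q))
...   | true with two c lt ≤-refl fc
...     | inj₁ mc = s≤s (cnt-one f k lt λ y p q t → other y q (two y p (m<n⇒m<1+n q) t))
  where
  other : ∀ y → y < c → m ≡ just y ⊎ k ≡ just y → k ≡ just y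
  other y q (inj₁ my) = ⊥-elim (<-irrefl (Maybeₚ.just-injective (trans (sym my) mc)) q)
  other y q (inj₂ ky) = ky
...     | inj₂ kc = s≤s (cnt-one f m lt λ y p q t → other y q (two y p (m<n⇒m<1+n q) t))
  where
  other : ∀ y → y < c → m ≡ just y ⊎ k ≡ just y → m ≡ just y
  other y q (inj₂ ky) = ⊥-elim (<-irrefl (Maybeₚ.just-injective (trans (sym ky) kc)) q)
  other y q (inj₁ my) = my

cnt-some : ∀ f {a c y} → a ≤ y → y < c → f y ≡ true → cnt f a < cnt f c
cnt-some f {a} {suc c} {y} p (s≤s q) t with m≤n⇒m<n∨m≡n q
... | inj₁ lt   = <-≤-trans (cnt-some f p lt t) (m≤n+m _ (bit (f c)))
... | inj₂ refl rewrite t = s≤s (cnt-mono f p)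

module _ (γ : ℕ → Bool) where

  lastOf : ℕ → Maybe ℕ
  lastOf zero    = nothing
  lastOf (suc y) = if γ y then just y else lastOf y

  lastOf-just : ∀ c {y} → lastOf c ≡ just y → y < c × γ y ≡ true
  lastOf-just (suc c) p with γ c in g
  lastOf-just (suc c) refl | true  = ≤-refl , g
  lastOf-just (suc c) p    | false = let l , t = lastOf-just c p in m<n⇒m<1+n l , t

  lastOf-≥ : ∀ {y} c → y < c → γ y ≡ true → Σ ℕ λ y′ → lastOf c ≡ just y′ × y ≤ y′
  lastOf-≥ (suc c) (s≤s leq) t with γ c in g
  ... | true = c , refl , leq
  ... | false with m≤n⇒m<n∨m≡n leq
  ...   | inj₁ lt = lastOf-≥ c lt t
  ...   | inj₂ refl with () ← trans (sym g) t

  lastOf-down : ∀ {c′ y} c → c′ ≤ c → lastOf c ≡ just y → y < c′ → lastOf c′ ≡ just y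
  lastOf-down zero z≤n p lt = p
  lastOf-down {c′} (suc c) leq p lt with m≤n⇒m<n∨m≡n leq
  ... | inj₂ refl = p
  ... | inj₁ (s≤s leq′) with γ c
  ...   | false = lastOf-down c leq′ p lt
  lastOf-down {c′} (suc c) leq refl lt | inj₁ (s≤s leq′) | true = ⊥-elim (<-irrefl refl (<-≤-trans lt leq′))

-- A greedy choice of positions of γ that hits each of the intervals [ lo x , hi x ) containing an element
-- of γ, at least once and at most twice. Each chosen position is the last element of γ below some b x;
-- b moves on to hi x as soon as it offers no element of γ in [ lo x , hi x ).
module Greedy (γ : ℕ → Bool) (N P : ℕ) (lo hi : ℕ → ℕ)
  (lo-mono : ∀ x → lo x ≤ lo (suc x)) (hi-mono : ∀ x → hi x ≤ hi (suc x))
  (lo≤hi : ∀ x → lo x ≤ hi x) (hi≤N : ∀ x → hi x ≤ N) (lo-end : lo P ≡ N) where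

  Offers : ℕ → ℕ → Set
  Offers a c = Σ ℕ λ y → lastOf γ c ≡ just y × a ≤ y

  offers? : ∀ a c → Dec (Offers a c)
  offers? a c with lastOf γ c
  ... | nothing = no λ ()
  ... | just y  = map′ (λ leq → y , refl , leq) (λ { (_ , refl , leq) → leq }) (a ≤? y)

  b : ℕ → ℕ
  b zero    = hi 0
  b (suc x) = if does (offers? (lo (suc x)) (b x)) then b x else hi (suc x)

  b≤hi : ∀ x → b x ≤ hi x
  b≤hi zero = ≤-refl
  b≤hi (suc x) with does (offers? (lo (suc x)) (b x))
  ... | true  = ≤-trans (b≤hi x) (hi-mono x)
  ... | false = ≤-refl

  b-step : ∀ x → b x ≤ b (suc x)
  b-step x with does (offers? (lo (suc x)) (b x))
  ... | true  = ≤-refl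
  ... | false = ≤-trans (b≤hi x) (hi-mono x)

  step⇒mono : ∀ {h : ℕ → ℕ} → (∀ x → h x ≤ h (suc x)) → ∀ {x y} → x ≤ y → h x ≤ h y
  step⇒mono s {x} {zero} z≤n = ≤-refl
  step⇒mono s {x} {suc y} leq with m≤n⇒m<n∨m≡n leq
  ... | inj₁ lt   = ≤-trans (step⇒mono s (≤-pred lt)) (s y)
  ... | inj₂ refl = ≤-refl

  b-hit : ∀ x {y} → lo x ≤ y → y < hi x → γ y ≡ true → Offers (lo x) (b x)
  b-hit zero l u t = let y′ , p , leq = lastOf-≥ γ (hi 0) u t in y′ , p , ≤-trans l leq
  b-hit (suc x) l u t with offers? (lo (suc x)) (b x)
  ... | yes o = o
  ... | no _  = let y′ , p , leq = lastOf-≥ γ (hi (suc x)) u t in y′ , p , ≤-trans l leq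

  -- `b` moves only when it has nothing to offer above the lower boundary, so an earlier choice that
  -- is still above it has never been given up.
  b-past : ∀ {x′ y} x → x′ ≤ x → lastOf γ (b x′) ≡ just y → lo x ≤ y → lastOf γ (b x) ≡ just y
  b-past zero z≤n p leq = p
  b-past (suc x) l p leq with m≤n⇒m<n∨m≡n l
  ... | inj₂ refl = p
  ... | inj₁ (s≤s l′) with b-past x l′ p (≤-trans (lo-mono x) leq)
  ...   | q with offers? (lo (suc x)) (b x)
  ...     | yes _ = q
  ...     | no ¬o = ⊥-elim (¬o (_ , q , leq))

  -- A move of `b` goes to the current value of `hi`. As `hi` is monotone, the first move after `x`
  -- already reaches `hi (suc x)`.
  b-future : ∀ {x} x′ → x < x′ → b x′ ≡ b x ⊎ hi (suc x) ≤ b x′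
  b-future {x} (suc x′) (s≤s l) with m≤n⇒m<n∨m≡n l
  ... | inj₁ lt with b-future x′ lt
  ...   | inj₂ q = inj₂ (≤-trans q (b-step x′))
  ...   | inj₁ q with does (offers? (lo (suc x′)) (b x′))
  ...     | true  = inj₁ q
  ...     | false = inj₂ (step⇒mono hi-mono {suc x} {suc x′} (s≤s l))
  b-future {x} (suc x) (s≤s l) | inj₂ refl with does (offers? (lo (suc x)) (b x))
  ... | true  = inj₁ refl
  ... | false = inj₂ ≤-refl

  chosen? : ∀ y → Dec (Σ ℕ λ x → x < suc P × lastOf γ (b x) ≡ just y)
  chosen? y = anyUpTo? (λ x → Maybeₚ.≡-dec _≟_ (lastOf γ (b x)) (just y)) (suc P)

  chosen : ℕ → Bool
  chosen y = does (chosen? y)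

  chosen-γ : ∀ {y} → chosen y ≡ true → γ y ≡ true
  chosen-γ {y} t with true-of (chosen? y) t
  ... | x , _ , p = proj₂ (lastOf-just γ (b x) p)

  chosen-hits : ∀ {x y} → x ≤ P → lo x ≤ y → y < hi x → γ y ≡ true →
                Σ ℕ λ y′ → lo x ≤ y′ × y′ < hi x × chosen y′ ≡ true
  chosen-hits {x} leq l u t with b-hit x l u t
  ... | y′ , p , l′ = y′ , l′ , <-≤-trans (proj₁ (lastOf-just γ (b x) p)) (b≤hi x) ,
                      of-true (chosen? y′) (x , s≤s leq , p)

  -- A choice made at some `x′ ≤ x` and still in the window is the last element below `b x`, by
  -- `b-past`. A choice made later, after `b` has moved, is last below some bound beyond `hi x`; if
  -- it lies below `hi x`, it is last there as well. This leaves two candidates.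
  chosen≤2 : ∀ x → cnt chosen (hi x) ≤ 2 + cnt chosen (lo x)
  chosen≤2 x = cnt-two chosen (lastOf γ (b x)) (lastOf γ (hi x)) (lo≤hi x) two
    where
    two : ∀ y → lo x ≤ y → y < hi x → chosen y ≡ true → lastOf γ (b x) ≡ just y ⊎ lastOf γ (hi x) ≡ just y
    two y l u t with true-of (chosen? y) t
    ... | x′ , _ , p with ≤-<-connex x′ x
    ...   | inj₁ leq = inj₁ (b-past x leq p l)
    ...   | inj₂ lt with b-future x′ lt
    ...     | inj₁ q rewrite q = inj₁ p
    ...     | inj₂ q = inj₂ (lastOf-down γ (b x′) (≤-trans (hi-mono x) q) p u)

  -- Choices up to `x` lie below `b x`, hence below `hi x`. New ones are made with `b` at
  -- `hi (suc x)` or beyond, so that only the last element below `hi (suc x)` qualifies.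
  chosen≤1 : ∀ x → cnt chosen (hi (suc x)) ≤ 1 + cnt chosen (hi x)
  chosen≤1 x = cnt-one chosen (lastOf γ (hi (suc x))) (hi-mono x) one
    where
    one : ∀ y → hi x ≤ y → y < hi (suc x) → chosen y ≡ true → lastOf γ (hi (suc x)) ≡ just y
    one y l u t with true-of (chosen? y) t
    ... | x′ , _ , p with <-≤-trans (s≤s l) (proj₁ (lastOf-just γ (b x′) p))
    ...   | above with ≤-<-connex x′ x
    ...     | inj₁ leq = ⊥-elim (<-irrefl refl (<-≤-trans above (≤-trans (step⇒mono b-step leq) (b≤hi x))))
    ...     | inj₂ lt with b-future x′ lt
    ...       | inj₁ q rewrite q = ⊥-elim (<-irrefl refl (<-≤-trans above (b≤hi x)))
    ...       | inj₂ q = lastOf-down γ (b x′) q p u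

  LastChosen : ℕ → Bool
  LastChosen c = maybe′ chosen true (lastOf γ c)

  -- An empty window offers nothing, so `b` stands at `hi x`, and the last element below `hi x` is
  -- the one chosen at `x`.
  lastChosen : ∀ x → x ≤ P → (∀ y → lo x ≤ y → y < hi x → γ y ≡ true → ⊥) → LastChosen (hi x) ≡ true
  lastChosen x leq none with lastOf γ (hi x) in q
  ... | nothing = refl
  ... | just y = of-true (chosen? y) (x , s≤s leq , trans (b≡hi x none) q)
    where
    b≡hi : ∀ x → (∀ y → lo x ≤ y → y < hi x → γ y ≡ true → ⊥) → lastOf γ (b x) ≡ lastOf γ (hi x)
    b≡hi zero    _ = refl
    b≡hi (suc x) none with offers? (lo (suc x)) (b x)
    ... | no _ = refl
    ... | yes (y , p , l) = let u , t = lastOf-just γ (b x) p in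
      ⊥-elim (none y l (<-≤-trans u (≤-trans (b≤hi x) (hi-mono x))) t)

  hi-end : hi P ≡ N
  hi-end = ≤-antisym (hi≤N P) (subst (_≤ hi P) lo-end (lo≤hi P))

  -- The assumption `lo-end` adds an empty window at `N`, which forces the last element of all to be
  -- chosen. In reversed time the flags start from this `true`.
  lastChosen-end : LastChosen N ≡ true
  lastChosen-end = subst (λ z → LastChosen z ≡ true) hi-end
    (lastChosen P ≤-refl λ y l u _ → <-irrefl refl (<-≤-trans u (≤-trans (hi≤N P) (≤-trans (≤-reflexive (sym lo-end)) l))))

-- Certificates for the events between two knowledge boundaries

-- The certificate for one type of events on process q = origin π and for the paths π, π′ from q to p and
-- from p to q (π′ is listed backwards). diff counts the marked events between the last event of q known
-- to e via π and the first event of q that knows e via π′.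
record Certificate (n : ℕ) : Set where
  constructor cert
  field
    marked : Bool
    lastMk : Bool
    diff   : Cap
    fwd    : Entries n
    bwd    : Entries n
    flags  : Vec Bool (suc n)
open Certificate

codeCertificate : ∀ n → Code (Certificate n) (1 + (1 + (3 + (n * (3 + 3) + (n * (3 + 3) + suc n * 1)))))
codeCertificate n = codeMap
  (λ (a , b , c , d , e , f) → cert a b c d e f)
  (λ (cert a b c d e f) → a , b , c , d , e , f)
  (λ _ → refl)
  (code× codeBool (code× codeBool (code× codeCap (code× (codeVec n (code× codeCap codeCap))
    (code× (codeVec n (code× codeCap codeCap)) (codeVec (suc n) codeBool))))))

module LocalCert {n : ℕ} {X : Set} (site : X → Fin n) (to fr : X → Maybe (Fin n))
                 (γ : X → Bool) (t : X → Certificate n) (π π′ : Path n n) where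
  module F = LocalTab site to
  module B = LocalTab site fr

  W : X → Bool
  W x = marked (t x)

  upTo : X → Bool
  upTo x = if γ x then W x else lastMk (t x)

  incF incB : X → Cap
  incF x = incAt π (fwd (t x)) (W x)
  incB x = incAt π′ (bwd (t x)) (W x)

  -- `few` excludes saturation, so that `balance` is an equation between numbers. `last-ok` requires
  -- the last γ-event of `origin π`, if there is one, to be marked; this justifies the value `true`
  -- with which the flags start at the far end.
  record CertOK (x : X) (pv nx sd rc : Maybe X) : Set where
    constructor certOK
    field
      mark-γ    : site x ≡ origin π → W x ≡ true → γ x ≡ true
      lastMk-ok : site x ≡ origin π → lastMk (t x) ≡ maybe′ upTo true pv
      last-ok   : site x ≡ origin π → maybe′ (λ _ → ⊤) (upTo x ≡ true) nx
      fwd-ok    : F.TabOK W π (λ y → fwd (t y)) x pv sd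
      bwd-ok    : B.TabOK W π′ (λ y → bwd (t y)) x nx rc
      flags-ok  : B.FlagOK (λ y → lastMk (t y)) π′ (λ y → flags (t y)) x nx rc
      few       : site x ≡ head π → diff (t x) ⊕ incB x ≢ many
      balance   : site x ≡ head π → maybe′ (λ y → diff (t x) ⊕ incF x ≡ diff (t y) ⊕ incB y) ⊤ pv
      zero-flag : site x ≡ head π → diff (t x) ≡ c0 → head (flags (t x)) ≡ true

  maybe? : {A : Set} {P : A → Set} {Q : Set} (∀P : ∀ a → Dec (P a)) → Dec Q → ∀ m → Dec (maybe′ P Q m)
  maybe? P? Q? (just a) = P? a
  maybe? P? Q? nothing  = Q?

  -- The same conditions as a plain product: two products with equal factors are equal sets, which
  -- is what `cert-natural` needs.
  CertParts : (x : X) (pv nx sd rc : Maybe X) → Set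
  CertParts x pv nx sd rc =
    (site x ≡ origin π → W x ≡ true → γ x ≡ true) ×
    (site x ≡ origin π → lastMk (t x) ≡ maybe′ upTo true pv) ×
    (site x ≡ origin π → maybe′ (λ _ → ⊤) (upTo x ≡ true) nx) ×
    F.TabOK W π (λ y → fwd (t y)) x pv sd ×
    B.TabOK W π′ (λ y → bwd (t y)) x nx rc ×
    B.FlagOK (λ y → lastMk (t y)) π′ (λ y → flags (t y)) x nx rc ×
    (site x ≡ head π → diff (t x) ⊕ incB x ≢ many) ×
    (site x ≡ head π → maybe′ (λ y → diff (t x) ⊕ incF x ≡ diff (t y) ⊕ incB y) ⊤ pv) ×
    (site x ≡ head π → diff (t x) ≡ c0 → head (flags (t x)) ≡ true)

  fromParts : ∀ {x pv nx sd rc} → CertParts x pv nx sd rc → CertOK x pv nx sd rc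
  fromParts (a , b , c , d , e , f , g , h , i) = certOK a b c d e f g h i

  toParts : ∀ {x pv nx sd rc} → CertOK x pv nx sd rc → CertParts x pv nx sd rc
  toParts (certOK a b c d e f g h i) = a , b , c , d , e , f , g , h , i

  CertOK? : ∀ x pv nx sd rc → Dec (CertOK x pv nx sd rc)
  CertOK? x pv nx sd rc = map′ fromParts toParts
    ( ((site x Finₚ.≟ origin π) →-dec ((_ Boolₚ.≟ _) →-dec (_ Boolₚ.≟ _)))
    ×-dec ((site x Finₚ.≟ origin π) →-dec (_ Boolₚ.≟ _))
    ×-dec ((site x Finₚ.≟ origin π) →-dec maybe? (λ _ → yes tt) (_ Boolₚ.≟ _) nx)
    ×-dec F.TabOK? W π _ x pv sd
    ×-dec B.TabOK? W π′ _ x nx rc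
    ×-dec B.FlagOK? _ π′ _ x nx rc
    ×-dec ((site x Finₚ.≟ head π) →-dec ¬? (_ ≟C _))
    ×-dec ((site x Finₚ.≟ head π) →-dec maybe? (λ _ → _ ≟C _) (yes tt) pv)
    ×-dec ((site x Finₚ.≟ head π) →-dec ((_ ≟C _) →-dec (_ Boolₚ.≟ _))))

  -- After the last event of `head π` the upper boundary moves to the end of `origin π`. Hence
  -- `diff` plus this last increment counts all marked events that remain unknown via `π`, and these
  -- are the residue of the path.
  CertEnd : (Fin n → Maybe X) → Set
  CertEnd last = maybe′ (λ x → diff (t x) ⊕ incB x ≡ F.resid π (λ y → fwd (t y)) last) ⊤ (last (head π))

  CertEnd? : ∀ last → Dec (CertEnd last)
  CertEnd? last = maybe? (λ _ → _ ≟C _) (yes tt) (last (head π))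

cap-zero : ∀ m → cap m ≡ c0 → m ≡ 0
cap-zero zero    _ = refl
cap-zero (suc m) p = ⊥-elim (sucC≢c0 (cap m) (sym p))

cnt-find : ∀ f {a c} → cnt f a < cnt f c → Σ ℕ λ y → a ≤ y × y < c × f y ≡ true
cnt-find f {a} {zero} lt = ⊥-elim (n≮0 lt)
cnt-find f {a} {suc c} lt with a ≤? c
... | no a≰c = ⊥-elim (<-irrefl refl (<-≤-trans lt (cnt-mono f (≰⇒> a≰c))))
... | yes a≤c with f c in fc
...   | true  = c , a≤c , ≤-refl , fc
...   | false = let y , p , q , t = cnt-find f lt in y , p , m<n⇒m<1+n q , t

cnt-cong : ∀ {f g} → (∀ x → f x ≡ g x) → ∀ x → cnt f x ≡ cnt g x
cnt-cong eqn zero    = refl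
cnt-cong eqn (suc x) = cong₂ (λ a b → bit a + b) (eqn x) (cnt-cong eqn x)

-- The balance equation of two consecutive events, without truncated differences.
rebalance : ∀ {m m′ l l′ h h′} → l ≤ l′ → h ≤ h′ → m′ + (l′ ∸ l) ≡ m + (h′ ∸ h) → m′ + l′ ≡ h′ → m + l ≡ h
rebalance {m} {m′} {l} {l′} {h} {h′} l≤ h≤ eqn top =
  +-cancelʳ-≡ (h′ ∸ h) (m + l) h (begin
    m + l + (h′ ∸ h)     ≡⟨ solve 3 (λ a b c → a :+ b :+ c := (a :+ c) :+ b) refl m l (h′ ∸ h) ⟩
    m + (h′ ∸ h) + l     ≡⟨ cong (_+ l) (sym eqn) ⟩
    m′ + (l′ ∸ l) + l    ≡⟨ +-assoc m′ _ l ⟩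
    m′ + ((l′ ∸ l) + l)  ≡⟨ cong (m′ +_) (m∸n+n≡m l≤) ⟩
    m′ + l′              ≡⟨ top ⟩
    h′                   ≡⟨ sym (m+[n∸m]≡n h≤) ⟩
    h + (h′ ∸ h)         ∎)
  where
  open ≡-Reasoning
  open +-*-Solver

rebalance⁻ : ∀ {m m′ l l′ h h′} → l ≤ l′ → h ≤ h′ → m + l ≡ h → m′ + l′ ≡ h′ → m′ + (l′ ∸ l) ≡ m + (h′ ∸ h)
rebalance⁻ {m} {m′} {l} {l′} {h} {h′} l≤ h≤ bot top =
  +-cancelʳ-≡ l _ _ (begin
    m′ + (l′ ∸ l) + l    ≡⟨ +-assoc m′ _ l ⟩
    m′ + ((l′ ∸ l) + l)  ≡⟨ cong (m′ +_) (m∸n+n≡m l≤) ⟩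
    m′ + l′              ≡⟨ top ⟩
    h′                   ≡⟨ sym (m+[n∸m]≡n h≤) ⟩
    h + (h′ ∸ h)         ≡⟨ cong (_+ (h′ ∸ h)) (sym bot) ⟩
    m + l + (h′ ∸ h)     ≡⟨ solve 3 (λ a b c → a :+ b :+ c := (a :+ c) :+ b) refl m l (h′ ∸ h) ⟩
    m + (h′ ∸ h) + l     ∎)
  where
  open ≡-Reasoning
  open +-*-Solver

module Window {n : ℕ} (G : Chart n) (π π′ : Path n n)
              (heads : head π ≡ head π′) (origins : origin π ≡ origin π′) (apart : head π ≢ origin π) where
  open ChartBasics G
  open Knowledge G
  open Duality G public
  module Dᴮ = ChartBasics (dual G)
  module Dᴷ = Knowledge (dual G)
  module Fᵈ = Flags (dual G)

  p q : Fin n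
  p = head π
  q = origin π

  N : ℕ
  N = len q

  Lo Hi : E → ℕ
  Lo e = L π (suc (pos e))
  Hi e = N ∸ Dᴷ.L π′ (suc (copos e))

  Lᵈ≤N : ∀ {x} → x ≤ len p → Dᴷ.L π′ x ≤ N
  Lᵈ≤N leq = subst (Dᴷ.L π′ _ ≤_) (cong len (sym origins)) (Dᴷ.L-bound π′ (subst (λ z → _ ≤ len z) heads leq))

  pos-N : ∀ {f} → site f ≡ q → pos f + suc (copos f) ≡ N
  pos-N {f} r = trans (pos+copos f) (cong len r)

  <Hi⇒copos : ∀ {x f} → site f ≡ q → x ≤ N → copos f < x → N ∸ x ≤ pos f
  <Hi⇒copos {x} {f} r leq lt = begin
    N ∸ x                               ≡⟨ cong (_∸ x) (sym (pos-N r)) ⟩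
    pos f + suc (copos f) ∸ x           ≤⟨ ∸-monoʳ-≤ (pos f + suc (copos f)) lt ⟩
    pos f + suc (copos f) ∸ suc (copos f) ≡⟨ m+n∸n≡m (pos f) (suc (copos f)) ⟩
    pos f                               ∎
    where open ≤-Reasoning

  ≥Hi⇒copos : ∀ {x f} → site f ≡ q → N ∸ x ≤ pos f → copos f < x
  ≥Hi⇒copos {x} {f} r leq = +-cancelˡ-≤ (pos f) _ _ (begin
    pos f + suc (copos f)  ≡⟨ pos-N r ⟩
    N                      ≤⟨ m≤n+m∸n N x ⟩
    x + (N ∸ x)            ≤⟨ +-monoʳ-≤ x leq ⟩
    x + pos f              ≡⟨ +-comm x (pos f) ⟩
    pos f + x              ∎)
    where open ≤-Reasoning

  below-Lo : ∀ {e f} → site e ≡ p → site f ≡ q → pos f < Lo e → f ⊑ e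
  below-Lo pe qf lt = L-sound⊑ π qf pe lt

  above-Hi : ∀ {e f} → site e ≡ p → site f ≡ q → Hi e ≤ pos f → e ⊑ f
  above-Hi {e} {f} pe qf leq = ⊑ᵈ⇒⊒ (Dᴷ.L-sound⊑ π′ (trans qf origins) (trans pe heads) (≥Hi⇒copos qf leq))

  -- Otherwise the event of `q` at position `Hi e` would be both above and below `e`, hence equal to
  -- it, although `apart` puts the two on different processes.
  Lo≤Hi : ∀ {e} → site e ≡ p → Lo e ≤ Hi e
  Lo≤Hi {e} pe with Lo e ≤? Hi e
  ... | yes leq = leq
  ... | no ¬le with ev q (Hi e) in evq
  ...   | nothing = ⊥-elim (<-irrefl refl (<-≤-trans (≰⇒> ¬le)
                      (≤-trans (L-bound π (subst (λ z → suc (pos e) ≤ len z) pe (pos<len e))) (ev-nothing evq))))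
  ...   | just f = ⊥-elim (apart (trans (sym pe) (trans (cong site e≡f) (proj₁ (ev-just evq)))))
    where
    e≡f : e ≡ f
    e≡f = ⊑-antisym (above-Hi pe (proj₁ (ev-just evq)) (≤-reflexive (sym (proj₂ (ev-just evq)))))
                    (below-Lo pe (proj₁ (ev-just evq)) (subst (_< Lo e) (sym (proj₂ (ev-just evq))) (≰⇒> ¬le)))

module CertProofs {n : ℕ} (G : Chart n) (π π′ : Path n n)
              (heads : head π ≡ head π′) (origins : origin π ≡ origin π′) (apart : head π ≢ origin π)
              (to fr : Chart.E G → Maybe (Fin n))
              (to-ok : ∀ e → to e ≡ Maybe.map (Chart.site G) (Chart.receiver G e))
              (fr-ok : ∀ e → fr e ≡ Maybe.map (Chart.site G) (Chart.sender G e))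
              (γ : Chart.E G → Bool) (last : Fin n → Maybe (Chart.E G)) (il : ChartBasics.IsLast G last) where
  open ChartBasics G
  open Knowledge G
  open Window G π π′ heads origins apart public

  γAt : ℕ → Bool
  γAt x = maybe′ γ false (ev q x)

  γAt-event : ∀ {x} → γAt x ≡ true → Σ E λ f → site f ≡ q × pos f ≡ x × γ f ≡ true
  γAt-event {x} t with ev q x in evx
  ... | just f = f , proj₁ (ev-just evx) , proj₂ (ev-just evx) , t

  ev-γAt : ∀ {f} → site f ≡ q → γAt (pos f) ≡ γ f
  ev-γAt {f} r rewrite sym r | ev-self f = refl

  module Counts (W : E → Bool) where
    open Counting G W public
    module Cᵈ = Counting (dual G) W

    C : ℕ → ℕ
    C = Cnt q

    coev-ev : ∀ {r x y} → x + suc y ≡ len r → coev r y ≡ ev r x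
    coev-ev {r} {x} {y} eqn with ev r x in evx
    ... | nothing = ⊥-elim (<-irrefl refl (<-≤-trans (m<m+n x (s≤s z≤n)) (subst (_≤ x) (sym eqn) (ev-nothing evx))))
    ... | just e with ev-just evx
    ...   | refl , refl = subst (λ z → coev (site e) z ≡ just e)
            (suc-injective (+-cancelˡ-≡ (pos e) _ _ (trans (pos+copos e) (sym eqn)))) (coev-self e)

    Cᵈ-C : ∀ {x y} → x + y ≡ N → Cᵈ.Cnt q y + C x ≡ C N
    Cᵈ-C {x} {zero} eqn = cong C (trans (sym (+-identityʳ x)) eqn)
    Cᵈ-C {x} {suc y} eqn = begin
      bit (Cᵈ.mark q y) + Cᵈ.Cnt q y + C x ≡⟨ cong (λ z → bit (maybe′ W false z) + Cᵈ.Cnt q y + C x) (coev-ev eqn) ⟩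
      bit (mark q x) + Cᵈ.Cnt q y + C x    ≡⟨ cong (_+ C x) (+-comm (bit (mark q x)) _) ⟩
      Cᵈ.Cnt q y + bit (mark q x) + C x    ≡⟨ +-assoc (Cᵈ.Cnt q y) _ _ ⟩
      Cᵈ.Cnt q y + C (suc x)               ≡⟨ Cᵈ-C {suc x} {y} (trans (sym (+-suc x y)) eqn) ⟩
      C N                                  ∎
      where open ≡-Reasoning

    -- Reversed counting starts from the end, so taking complements to `C N` turns its increments
    -- into differences of `C`. For `x = copos e` the value is the growth of the upper boundary from
    -- `e` to the next event.
    incᵈ : ∀ {x} → suc x ≤ len p → Cᵈ.inc π′ x ≡ C (N ∸ Dᴷ.L π′ x) ∸ C (N ∸ Dᴷ.L π′ (suc x))
    incᵈ {x} leq rewrite sym origins = begin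
      Cᵈ.Cnt q b ∸ Cᵈ.Cnt q a                     ≡⟨ cong₂ _∸_ (val {b} (Lᵈ≤N leq)) (val {a} (Lᵈ≤N (<⇒≤ leq))) ⟩
      (C N ∸ C (N ∸ b)) ∸ (C N ∸ C (N ∸ a))       ≡⟨ m+n∸n≡m′ ⟩
      C (N ∸ a) ∸ C (N ∸ b)                       ∎
      where
      open ≡-Reasoning
      a = Dᴷ.L π′ x
      b = Dᴷ.L π′ (suc x)
      val : ∀ {y} → y ≤ N → Cᵈ.Cnt q y ≡ C N ∸ C (N ∸ y)
      val {y} leq = trans (sym (m+n∸n≡m _ (C (N ∸ y)))) (cong (_∸ C (N ∸ y)) (Cᵈ-C {N ∸ y} {y} (m∸n+n≡m leq)))
      m+n∸n≡m′ : (C N ∸ C (N ∸ b)) ∸ (C N ∸ C (N ∸ a)) ≡ C (N ∸ a) ∸ C (N ∸ b)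
      m+n∸n≡m′ = trans (cong (_∸ (C N ∸ C (N ∸ a)))
          (telescope (cnt-mono (mark q) (∸-monoʳ-≤ N (Dᴷ.L-step π′ x))) (cnt-mono (mark q) (m∸n≤m N a))))
        (m+n∸m≡n (C N ∸ C (N ∸ a)) _)

    LastMarked : ℕ → Bool
    LastMarked c = maybe′ (mark q) true (lastOf γAt c)

    LastMarked-suc : ∀ {e} → site e ≡ q → (if γ e then W e else LastMarked (pos e)) ≡ LastMarked (suc (pos e))
    LastMarked-suc {e} r rewrite ev-γAt r with γ e
    ... | true rewrite sym r | ev-self e = refl
    ... | false = refl

    -- The window ends strictly before the first event that knows, so the transported flag has to
    -- speak of the events strictly before its source: the boundary is `pos e`, not `suc (pos e)`.
    flag-base : ∀ {e} → site e ≡ origin π′ → LastMarked (pos e) ≡ LastMarked (N ∸ suc (copos e))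
    flag-base {e} r = cong LastMarked (sym
      (trans (cong (_∸ suc (copos e)) (sym (pos-N (trans r (sym origins))))) (m+n∸n≡m (pos e) (suc (copos e)))))

    C-Hi : ∀ e → C (Hi e) ≤ C (N ∸ Dᴷ.L π′ (copos e))
    C-Hi e = cnt-mono (mark q) (∸-monoʳ-≤ N (Dᴷ.L-step π′ (copos e)))

    C-Lo : ∀ {x} → C (L π x) ≤ C (L π (suc x))
    C-Lo {x} = cnt-mono (mark q) (L-step π x)

  module Sound (t : E → Certificate n)
    (ok : ∀ e → LocalCert.CertOK site to fr γ t π π′ e (prev e) (next e) (sender e) (receiver e))
    (end : LocalCert.CertEnd site to fr γ t π π′ last) where
    open LocalCert site to fr γ t π π′
    open Counts W
    open CertOK

    incF-ok : ∀ {e} → site e ≡ p → incF e ≡ cap (inc π (pos e))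
    incF-ok = tab-sound to to-ok π (λ e → fwd (t e)) (λ e → fwd-ok (ok e)) _

    incB-ok : ∀ {e} → site e ≡ p → incB e ≡ cap (C (N ∸ Dᴷ.L π′ (copos e)) ∸ C (Hi e))
    incB-ok {e} pe = trans (Cᵈ.tab-sound fr fr-ok π′ (λ e → bwd (t e)) (λ e → bwd-ok (ok e)) e (trans pe heads))
      (cong cap (incᵈ (subst (λ z → suc (copos e) ≤ len z) pe (Dᴮ.pos<len e))))

    upTo-ok : ∀ {e} → site e ≡ q → lastMk (t e) ≡ LastMarked (pos e) → upTo e ≡ LastMarked (suc (pos e))
    upTo-ok {e} r ih = trans (cong (λ z → if γ e then W e else z) ih) (LastMarked-suc r)

    lastMk-sound : ∀ x {e} → pos e ≡ x → site e ≡ q → lastMk (t e) ≡ LastMarked (pos e)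
    lastMk-sound x {e} px r = trans (lastMk-ok (ok e) r) (lem x px (prev e) refl)
      where
      lem : ∀ x → pos e ≡ x → ∀ m → prev e ≡ m → maybe′ upTo true m ≡ LastMarked (pos e)
      lem x px nothing pe rewrite prev-nothing pe = refl
      lem zero px (just g) pe with () ← trans (proj₂ (prev-just pe)) px
      lem (suc x) px (just g) pe =
        trans (upTo-ok sg (lastMk-sound x (suc-injective (trans (proj₂ (prev-just pe)) px)) sg))
              (cong LastMarked (proj₂ (prev-just pe)))
        where
        sg : site g ≡ q
        sg = trans (proj₁ (prev-just pe)) r

    lastMarked-end : LastMarked N ≡ true
    lastMarked-end with last q | il q
    ... | nothing | z = cong LastMarked z
    ... | just e | r , z = trans (cong LastMarked (sym z))
        (trans (sym (upTo-ok r (lastMk-sound _ refl r))) (lem (next e) refl))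
      where
      lem : ∀ m → next e ≡ m → upTo e ≡ true
      lem nothing ne = subst (maybe′ (λ _ → ⊤) (upTo e ≡ true)) ne (last-ok (ok e) r)
      lem (just f) ne = ⊥-elim (<-irrefl refl (<-≤-trans (pos<len f)
        (≤-reflexive (trans (cong len (trans (proj₁ (next-just ne)) r)) (trans (sym z) (proj₂ (prev-just (next⇒prev ne))))))))

    flag-ok : ∀ {e} → site e ≡ p → head (flags (t e)) ≡ LastMarked (Hi e)
    flag-ok {e} pe = Fᵈ.flag-sound (λ y → LastMarked (N ∸ y)) lastMarked-end fr (λ e → lastMk (t e)) π′ (λ e → flags (t e))
      base (λ e → flags-ok (ok e)) e (trans pe heads)
      where
      base : ∀ e → site e ≡ origin π′ → lastMk (t e) ≡ LastMarked (N ∸ suc (copos e))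
      base e r = trans (lastMk-sound _ refl (trans r (sym origins))) (flag-base r)

    Balanced : E → Set
    Balanced e = Σ ℕ λ m → diff (t e) ≡ cap m × m + C (Lo e) ≡ C (Hi e)

    rebalanceC : ∀ {e} → site e ≡ p → ∀ m′ l′ → C (Lo e) ≤ l′ →
      cap (m′ + (l′ ∸ C (Lo e))) ≡ diff (t e) ⊕ incB e → m′ + l′ ≡ C (N ∸ Dᴷ.L π′ (copos e)) → Balanced e
    rebalanceC {e} pe m′ l′ leq eqn top with uncap (diff (t e)) (many-⊕ˡ _ (incB e) (few (ok e) pe))
    ... | m , dm = m , dm , rebalance leq (C-Hi e)
      (cap-inj _ _ (trans eqn sum) (λ z → few (ok e) pe (trans (sym eqn) z))) top
      where
      sum : diff (t e) ⊕ incB e ≡ cap (m + (C (N ∸ Dᴷ.L π′ (copos e)) ∸ C (Hi e)))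
      sum = trans (cong₂ _⊕_ dm (incB-ok pe)) (sym (cap-+ m _))

    -- `balance` passes exactness from one window to its neighbour but cannot start it. The start is
    -- the last event of `p`, by `CertEnd`; hence the induction on `copos`.
    balanced : ∀ x {e} → copos e ≡ x → site e ≡ p → Balanced e
    balanced x {e} cx pe = by x cx (next e) refl
      where
      by : ∀ x → copos e ≡ x → ∀ m → next e ≡ m → Balanced e
      -- A fictitious event after the last one: no marked event in its window, and both boundaries
      -- at `N`.
      by x cx nothing ne = rebalanceC pe 0 (C N) (cnt-mono (mark q) (≤-trans (Lo≤Hi pe) (m∸n≤m N (Dᴷ.L π′ (suc (copos e))))))
          (atEnd (last p) refl (il p)) (cong C (sym lem))
        where
        lem : N ∸ Dᴷ.L π′ (copos e) ≡ N
        lem = cong (N ∸_) (trans (cong (Dᴷ.L π′) (next-nothing ne)) (Dᴷ.L-zero π′))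
        len-p : suc (pos e) ≡ len p
        len-p = trans (sym (+-comm (pos e) 1)) (trans (cong (λ z → pos e + suc z) (sym (next-nothing ne)))
                  (trans (pos+copos e) (cong len pe)))
        atEnd : ∀ m → last p ≡ m → maybe′ (λ e → site e ≡ p × suc (pos e) ≡ len p) (len p ≡ 0) m →
                cap (C N ∸ C (Lo e)) ≡ diff (t e) ⊕ incB e
        atEnd nothing  _  z with () ← trans len-p z
        atEnd (just f) lp (sf , z) with uniq (trans sf (sym pe)) (suc-injective (trans z (sym len-p)))
        ... | refl = sym (trans (subst (maybe′ (λ x → diff (t x) ⊕ incB x ≡ F.resid π (λ y → fwd (t y)) last) ⊤) lp end)
                (trans (resid-sound to to-ok π (λ e → fwd (t e)) last il (λ e → fwd-ok (ok e)))
                  (cong (λ z → cap (C N ∸ C (L π z))) (sym len-p))))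
      by zero cx (just f) ne with () ← trans (proj₂ (next-just ne)) cx
      by (suc x) cx (just f) ne with balanced x {f} (suc-injective (trans (proj₂ (next-just ne)) cx)) (trans (proj₁ (next-just ne)) pe)
      ... | m′ , df , eqn = rebalanceC pe m′ (C (Lo f)) (subst (λ z → C (L π z) ≤ C (Lo f)) (sym posf) C-Lo)
          (trans (cap-+ m′ _) (trans (cong₂ _⊕_ (sym df)
              (trans (cong (λ z → cap (C (Lo f) ∸ C (L π z))) posf) (sym (incF-ok sf))))
            (subst (maybe′ (λ y → diff (t f) ⊕ incF f ≡ diff (t y) ⊕ incB y) ⊤) pf (balance (ok f) sf))))
          (trans eqn (cong (λ z → C (N ∸ Dᴷ.L π′ z)) (proj₂ (next-just ne))))
        where
        pf = next⇒prev ne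
        sf : site f ≡ p
        sf = trans (proj₁ (next-just ne)) pe
        posf : suc (pos e) ≡ pos f
        posf = proj₂ (prev-just pf)

    -- If γ occurs in the window, the last γ-event before `Hi e` lies in it as well. The flag says
    -- that this event is marked, so the count would be positive.
    zero-sound : ∀ {e} → site e ≡ p → diff (t e) ≡ c0 →
      ∀ {f} → site f ≡ q → γ f ≡ true → Lo e ≤ pos f → pos f < Hi e → ⊥
    zero-sound {e} pe d0 {f} qf gf lo hi with balanced _ refl pe
    ... | m , dm , eqn with cap-zero m (trans (sym dm) d0) | lastOf-≥ γAt (Hi e) hi (trans (ev-γAt qf) gf)
    ...   | refl | y , ly , leq = <-irrefl eqn (cnt-some (mark q) (≤-trans lo leq) (proj₁ (lastOf-just γAt (Hi e) ly))
              (trans (cong (maybe′ (mark q) true) (sym ly)) (trans (sym (flag-ok pe)) (zero-flag (ok e) pe d0))))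

    mark-event : ∀ {y} → mark q y ≡ true → Σ E λ f → site f ≡ q × pos f ≡ y × W f ≡ true
    mark-event {y} m with ev q y in evy
    ... | just f = f , proj₁ (ev-just evy) , proj₂ (ev-just evy) , m

    positive-sound : ∀ {e} → site e ≡ p → diff (t e) ≢ c0 →
      Σ E λ f → site f ≡ q × γ f ≡ true × Lo e ≤ pos f × pos f < Hi e
    positive-sound {e} pe d≢ with balanced _ refl pe
    ... | zero , dm , eqn = ⊥-elim (d≢ dm)
    ... | suc m , dm , eqn with cnt-find (mark q) {Lo e} {Hi e} (subst (C (Lo e) <_) eqn (s≤s (m≤n+m _ m)))
    ...   | y , lo , hi , my with mark-event my
    ...     | f , qf , refl , wf = f , qf , mark-γ (ok f) qf wf , lo , hi

  module Complete where

    P : ℕ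
    P = len p

    lo hi : ℕ → ℕ
    -- The index `P` belongs to no event. There the lower boundary is put at `N`, where `hi P` lies
    -- anyway because `L π′ 0` vanishes; this is the empty final window of the greedy choice.
    lo x = if does (x <? P) then L π (suc x) else N
    hi x = N ∸ Dᴷ.L π′ (P ∸ x)

    event-at : ∀ {x} → x < P → Σ E λ e → site e ≡ p × pos e ≡ x
    event-at {x} lt with ev p x in evx
    ... | nothing = ⊥-elim (<-irrefl refl (<-≤-trans lt (ev-nothing evx)))
    ... | just e  = e , ev-just evx

    pos<P : ∀ {e} → site e ≡ p → pos e < P
    pos<P {e} pe = subst (λ z → pos e < len z) pe (pos<len e)

    P∸pos : ∀ {e} → site e ≡ p → P ∸ pos e ≡ suc (copos e)
    P∸pos {e} pe = trans (cong (_∸ pos e) (trans (cong len (sym pe)) (sym (pos+copos e)))) (m+n∸m≡n (pos e) _)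

    P∸suc : ∀ {e} → site e ≡ p → P ∸ suc (pos e) ≡ copos e
    P∸suc {e} pe = trans (cong (_∸ suc (pos e)) (trans (cong len (sym pe))
      (trans (sym (pos+copos e)) (+-suc (pos e) (copos e))))) (m+n∸m≡n (suc (pos e)) _)

    lo-< : ∀ {x} → x < P → lo x ≡ L π (suc x)
    lo-< {x} lt rewrite dec-true (x <? P) lt = refl

    lo-≥ : ∀ {x} → ¬ x < P → lo x ≡ N
    lo-≥ {x} ge rewrite dec-false (x <? P) ge = refl

    lo-at : ∀ {e} → site e ≡ p → lo (pos e) ≡ Lo e
    lo-at pe = lo-< (pos<P pe)

    hi-at : ∀ {e} → site e ≡ p → hi (pos e) ≡ Hi e
    hi-at pe = cong (λ z → N ∸ Dᴷ.L π′ z) (P∸pos pe)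

    hi-suc : ∀ {e} → site e ≡ p → hi (suc (pos e)) ≡ N ∸ Dᴷ.L π′ (copos e)
    hi-suc pe = cong (λ z → N ∸ Dᴷ.L π′ z) (P∸suc pe)

    lo-mono : ∀ x → lo x ≤ lo (suc x)
    lo-mono x with x <? P | suc x <? P
    ... | yes lt | yes lt′ rewrite lo-< lt | lo-< lt′ = L-step π (suc x)
    ... | yes lt | no ge   rewrite lo-< lt | lo-≥ ge = L-bound π lt
    ... | no ge  | yes lt  = ⊥-elim (ge (<⇒≤ lt))
    ... | no ge  | no ge′  rewrite lo-≥ ge | lo-≥ ge′ = ≤-refl

    hi-mono : ∀ x → hi x ≤ hi (suc x)
    hi-mono x = ∸-monoʳ-≤ N (Dᴷ.L-mono π′ (∸-monoʳ-≤ P (n≤1+n x)))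

    lo≤hi : ∀ x → lo x ≤ hi x
    lo≤hi x with x <? P
    ... | no ge rewrite lo-≥ ge | m≤n⇒m∸n≡0 (≮⇒≥ ge) | Dᴷ.L-zero π′ = ≤-refl
    ... | yes lt with event-at lt
    ...   | e , pe , refl = ≤-trans (≤-reflexive (lo-at pe)) (≤-trans (Lo≤Hi pe) (≤-reflexive (sym (hi-at pe))))

    lo-end : lo P ≡ N
    lo-end = lo-≥ (<-irrefl refl)

    open Greedy γAt N P lo hi lo-mono hi-mono lo≤hi (λ x → m∸n≤m N (Dᴷ.L π′ (P ∸ x))) lo-end

    W : E → Bool
    W e = chosen (pos e)

    open Counts W

    mark-chosen : ∀ x → mark q x ≡ chosen x
    mark-chosen x with ev q x in evx
    ... | just e = cong chosen (proj₂ (ev-just evx))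
    ... | nothing with chosen x in c
    ...   | false = refl
    ...   | true with γAt-event (chosen-γ c)
    ...     | f , qf , refl , _ with () ← trans (sym (trans (cong (λ z → ev z (pos f)) (sym qf)) (ev-self f))) evx

    C-chosen : ∀ x → C x ≡ cnt chosen x
    C-chosen = cnt-cong mark-chosen

    LastMarked-chosen : ∀ x → LastMarked x ≡ LastChosen x
    LastMarked-chosen x with lastOf γAt x
    ... | nothing = refl
    ... | just y  = mark-chosen y

    end-marked : LastMarked N ≡ true
    end-marked = trans (LastMarked-chosen N) lastChosen-end

    D : E → ℕ
    D e = C (Hi e) ∸ C (Lo e)

    t : E → Certificate n
    t e = cert (W e) (LastMarked (pos e)) (cap (D e)) (trueTab to to-ok π e) (Cᵈ.trueTab fr fr-ok π′ e)
            (Fᵈ.flagTab (λ y → LastMarked (N ∸ y)) end-marked π′ e)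

    open LocalCert site to fr γ t π π′

    incF-eq : ∀ {e} → site e ≡ p → incF e ≡ cap (C (Lo e) ∸ C (L π (pos e)))
    incF-eq pe = trueTab-inc to to-ok π _ pe

    incB-eq : ∀ {e} → site e ≡ p → incB e ≡ cap (C (N ∸ Dᴷ.L π′ (copos e)) ∸ C (Hi e))
    incB-eq {e} pe = trans (Cᵈ.trueTab-inc fr fr-ok π′ e (trans pe heads))
      (cong cap (incᵈ (subst (λ z → suc (copos e) ≤ len z) pe (Dᴮ.pos<len e))))

    D-eq : ∀ {e} → site e ≡ p → D e + C (Lo e) ≡ C (Hi e)
    D-eq pe = m∸n+n≡m (cnt-mono (mark q) (Lo≤Hi pe))

    diff-sum : ∀ {e} → site e ≡ p →
      cap (D e) ⊕ incB e ≡ cap (D e + (C (N ∸ Dᴷ.L π′ (copos e)) ∸ C (Hi e)))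
    diff-sum {e} pe = trans (cong (cap (D e) ⊕_) (incB-eq pe)) (sym (cap-+ (D e) _))

    D≤2 : ∀ {e} → site e ≡ p → D e ≤ 2
    D≤2 {e} pe = subst (C (Hi e) ∸ C (Lo e) ≤_) (m+n∸n≡m 2 (C (Lo e))) (∸-monoˡ-≤ (C (Lo e))
      (subst₂ (λ a b → C a ≤ 2 + C b) (hi-at pe) (lo-at pe)
        (subst₂ (λ a b → a ≤ 2 + b) (sym (C-chosen (hi (pos e)))) (sym (C-chosen (lo (pos e)))) (chosen≤2 (pos e)))))

    incB≤1 : ∀ {e} → site e ≡ p → C (N ∸ Dᴷ.L π′ (copos e)) ∸ C (Hi e) ≤ 1
    incB≤1 {e} pe = subst (C (N ∸ Dᴷ.L π′ (copos e)) ∸ C (Hi e) ≤_) (m+n∸n≡m 1 (C (Hi e))) (∸-monoˡ-≤ (C (Hi e))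
      (subst₂ (λ a b → C a ≤ 1 + C b) (hi-suc pe) (hi-at pe)
        (subst₂ (λ a b → a ≤ 1 + b) (sym (C-chosen (hi (suc (pos e))))) (sym (C-chosen (hi (pos e)))) (chosen≤1 (pos e)))))

    few-ok : ∀ {e} → site e ≡ p → cap (D e) ⊕ incB e ≢ many
    few-ok pe z = cap≤3 _ (+-mono-≤ (D≤2 pe) (incB≤1 pe)) (trans (sym (diff-sum pe)) z)

    balance-ok : ∀ {e} m → prev e ≡ m → site e ≡ p →
      maybe′ (λ y → cap (D e) ⊕ incF e ≡ cap (D y) ⊕ incB y) ⊤ m
    balance-ok nothing  _  _  = tt
    balance-ok {e} (just g) pg pe = trans (trans (cong (cap (D e) ⊕_) (incF-eq pe)) (sym (cap-+ (D e) _)))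
      (trans (cong cap (trans (cong (λ z → D e + (C (Lo e) ∸ C (L π z))) (sym posg))
          (rebalance⁻ (subst (λ z → C (L π z) ≤ C (Lo e)) (sym posg) C-Lo) (C-Hi g) (D-eq sg)
            (trans (D-eq pe) (cong (λ z → C (N ∸ Dᴷ.L π′ z)) (proj₂ (next-just (prev⇒next pg))))))))
        (sym (diff-sum sg)))
      where
      sg : site g ≡ p
      sg = trans (proj₁ (prev-just pg)) pe
      posg : suc (pos g) ≡ pos e
      posg = proj₂ (prev-just pg)

    flags-head : ∀ e → head (Fᵈ.flagTab (λ y → LastMarked (N ∸ y)) end-marked π′ e) ≡ LastMarked (Hi e)
    flags-head e = Fᵈ.flagTab-head _ end-marked π′ e

    zero-ok : ∀ {e} → site e ≡ p → cap (D e) ≡ c0 → LastMarked (Hi e) ≡ true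
    zero-ok {e} pe z = trans (cong LastMarked (sym (hi-at pe))) (trans (LastMarked-chosen (hi (pos e)))
      (lastChosen (pos e) (<⇒≤ (pos<P pe)) λ y l u g → none (chosen-hits (<⇒≤ (pos<P pe)) l u g)))
      where
      none : Σ ℕ (λ y → lo (pos e) ≤ y × y < hi (pos e) × chosen y ≡ true) → ⊥
      none (y , l , u , c) = <-irrefl refl (≤-trans
        (cnt-some (mark q) (subst (_≤ y) (lo-at pe) l) (subst (y <_) (hi-at pe) u) (trans (mark-chosen y) c))
        (m∸n≡0⇒m≤n (cap-zero (D e) z)))

    lastMk-true : ∀ {e} m → prev e ≡ m → site e ≡ q → LastMarked (pos e) ≡ maybe′ upTo true m
    lastMk-true nothing  pe r = cong LastMarked (prev-nothing pe)
    lastMk-true (just g) pe r = trans (cong LastMarked (sym (proj₂ (prev-just pe))))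
                                      (sym (LastMarked-suc (trans (proj₁ (prev-just pe)) r)))

    last-true : ∀ {e} m → next e ≡ m → site e ≡ q → maybe′ (λ _ → ⊤) (upTo e ≡ true) m
    last-true (just _) _ _ = tt
    last-true {e} nothing ne r = trans (LastMarked-suc r) (trans (cong LastMarked lem) end-marked)
      where
      lem : suc (pos e) ≡ N
      lem = trans (sym (+-comm (pos e) 1)) (trans (cong (λ z → pos e + suc z) (sym (next-nothing ne))) (pos-N r))

    t-ok : ∀ e → CertOK e (prev e) (next e) (sender e) (receiver e)
    t-ok e = certOK
      (λ r w → trans (sym (ev-γAt r)) (chosen-γ w))
      (lastMk-true (prev e) refl)
      (last-true (next e) refl)
      (trueTab-ok to to-ok π e)
      (Cᵈ.trueTab-ok fr fr-ok π′ e)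
      (Fᵈ.flagTab-ok (λ y → LastMarked (N ∸ y)) end-marked fr _ π′ (λ _ → flag-base) e)
      few-ok
      (balance-ok (prev e) refl)
      (λ pe z → trans (flags-head e) (zero-ok pe z))

    t-end : CertEnd last
    t-end with last p | il p
    ... | nothing | _ = tt
    ... | just e | pe , z = trans (diff-sum pe) (trans (cong cap lem)
            (sym (resid-sound to to-ok π (trueTab to to-ok π) last il (trueTab-ok to to-ok π))))
      where
      cop : copos e ≡ 0
      cop = suc-injective (+-cancelˡ-≡ (pos e) _ _ (trans (pos+copos e)
              (trans (cong len pe) (trans (sym z) (sym (+-comm (pos e) 1))))))
      top : C (N ∸ Dᴷ.L π′ (copos e)) ≡ C N
      top = cong C (cong (N ∸_) (trans (cong (Dᴷ.L π′) cop) (Dᴷ.L-zero π′)))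
      lem : D e + (C (N ∸ Dᴷ.L π′ (copos e)) ∸ C (Hi e)) ≡ C N ∸ C (L π (len p))
      -- Again the fictitious window after the last event: count 0 and both boundaries at `N`.
      lem = trans (sym (rebalance⁻ {m′ = 0} (≤-trans (cnt-mono (mark q) (Lo≤Hi pe)) (C-Hi e)) (C-Hi e) (D-eq pe) refl))
                  (cong₂ (λ a b → a ∸ C (L π b)) top z)

-- Past, future and concurrency

-- seen x c q b tells whether a strictly smaller event of type c on process q exists that is (b = true) or
-- is not (b = false) the first of its type on q. This suffices to discount one adjacent event.
module LocalPast {n : ℕ} {Γ X : Set} (site : X → Fin n) (T : X → Γ) (seen : X → Γ → Fin n → Bool → Bool) where

  isFirst : X → Bool
  isFirst x = not (seen x (T x) (site x) true)

  Through : Maybe X → Γ → Fin n → Bool → Set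
  Through m c q b = maybe′ (λ g → seen g c q b ≡ true ⊎ (T g ≡ c × site g ≡ q × isFirst g ≡ b)) ⊥ m

  PastOK : (x : X) (pv sd : Maybe X) → Γ → Fin n → Bool → Set
  PastOK x pv sd c q b = (seen x c q b ≡ true → Through pv c q b ⊎ Through sd c q b) ×
                         (Through pv c q b ⊎ Through sd c q b → seen x c q b ≡ true)

  Adjacent : Maybe X → Γ → Fin n → Set
  Adjacent m c q = maybe′ (λ g → T g ≡ c × site g ≡ q) ⊥ m

  -- A seen event that is not the first of its type on `q` brings the first one along, and at most
  -- one of the two is adjacent to `x`. If only the first is seen, it counts unless some adjacent
  -- event has this type and process, for that event would then be the first itself.
  SeenOther : (x : X) (pv sd : Maybe X) → Γ → Fin n → Set
  SeenOther x pv sd c q =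
    seen x c q false ≡ true ⊎ (seen x c q true ≡ true × ¬ (Adjacent pv c q ⊎ Adjacent sd c q))

  module _ (_≟Γ_ : (c d : Γ) → Dec (c ≡ d)) where

    Through? : ∀ m c q b → Dec (Through m c q b)
    Through? nothing  c q b = no λ ()
    Through? (just g) c q b = (_ Boolₚ.≟ _) ⊎-dec ((T g ≟Γ c) ×-dec (site g Finₚ.≟ q) ×-dec (_ Boolₚ.≟ b))

    PastOK? : ∀ x pv sd c q b → Dec (PastOK x pv sd c q b)
    PastOK? x pv sd c q b =
      ((_ Boolₚ.≟ _) →-dec (Through? pv c q b ⊎-dec Through? sd c q b)) ×-dec
      ((Through? pv c q b ⊎-dec Through? sd c q b) →-dec (_ Boolₚ.≟ _))

    Adjacent? : ∀ m c q → Dec (Adjacent m c q)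
    Adjacent? nothing  c q = no λ ()
    Adjacent? (just g) c q = (T g ≟Γ c) ×-dec (site g Finₚ.≟ q)

    SeenOther? : ∀ x pv sd c q → Dec (SeenOther x pv sd c q)
    SeenOther? x pv sd c q =
      (_ Boolₚ.≟ _) ⊎-dec ((_ Boolₚ.≟ _) ×-dec ¬? (Adjacent? pv c q ⊎-dec Adjacent? sd c q))

module PastProofs {n : ℕ} (G : Chart n) {Γ : Set} (T : Chart.E G → Γ) where
  open ChartBasics G

  infix 4 _⊏_
  _⊏_ : E → E → Set
  f ⊏ e = Σ E λ g → f ⊑ g × Edge prev sender g e

  ⊏-irrefl : ∀ {e} → e ⊏ e → ⊥
  ⊏-irrefl (g , r , x) = no-cycle r x

  ⊏⇒⊑ : ∀ {f e} → f ⊏ e → f ⊑ e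
  ⊏⇒⊑ (g , r , x) = r ◅◅ (x ◅ ε)

  ⊑⇒⊏ : ∀ {f e} → f ⊑ e → f ≢ e → f ⊏ e
  ⊑⇒⊏ r ne with ⊑-last r
  ... | inj₁ p = ⊥-elim (ne p)
  ... | inj₂ s = s

  OtherBelow : E → E → Set
  OtherBelow e f = f ⊑ e × f ≢ e × prev e ≢ just f × sender e ≢ just f

  module _ (seen : E → Γ → Fin n → Bool → Bool) where
    open LocalPast site T seen

    Seen : E → Γ → Fin n → Bool → Set
    Seen e c q b = Σ E λ f → f ⊏ e × T f ≡ c × site f ≡ q × isFirst f ≡ b

    module _ (ok : ∀ e c q b → PastOK e (prev e) (sender e) c q b) where

      -- `PastOK` is an equation along well-founded edges, so an entry `true` cannot justify itself
      -- in a circle: following it back ends at an actual event.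
      seen-sound : ∀ {e c q b} → seen e c q b ≡ true → Seen e c q b
      seen-sound {e} = go (wf e)
        where
        go : ∀ {e c q b} → Acc (Edge prev sender) e → seen e c q b ≡ true → Seen e c q b
        go {e} {c} {q} {b} (acc rs) s = by (proj₁ (ok e c q b) s)
          where
          thru : ∀ m → (∀ {g} → m ≡ just g → Edge prev sender g e) → Through m c q b → Seen e c q b
          thru (just g) x (inj₂ (tg , sg , fg)) = g , (g , ε , x refl) , tg , sg , fg
          thru (just g) x (inj₁ sg) with go (rs (x refl)) sg
          ... | f , (h , r , y) , z = f , (g , r ◅◅ (y ◅ ε) , x refl) , z
          by : _ → Seen e c q b
          by (inj₁ t) = thru (prev e) inj₁ t
          by (inj₂ t) = thru (sender e) inj₂ t

      seen-complete : ∀ {e c q b} → Seen e c q b → seen e c q b ≡ true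
      seen-complete {e} = go (wf e)
        where
        go : ∀ {e c q b} → Acc (Edge prev sender) e → Seen e c q b → seen e c q b ≡ true
        go {e} {c} {q} {b} (acc rs) (f , (g , r , x) , z) = proj₂ (ok e c q b) (by x)
          where
          at : Edge prev sender g e → seen g c q b ≡ true ⊎ (T g ≡ c × site g ≡ q × isFirst g ≡ b)
          at x with ⊑-last r
          ... | inj₁ refl = inj₂ z
          ... | inj₂ s    = inj₁ (go (rs x) (f , s , z))
          by : Edge prev sender g e → Through (prev e) c q b ⊎ Through (sender e) c q b
          by (inj₁ p) = inj₁ (subst (λ m → Through m c q b) (sym p) (at (inj₁ p)))
          by (inj₂ p) = inj₂ (subst (λ m → Through m c q b) (sym p) (at (inj₂ p)))

      not-true : ∀ {b} → not b ≡ false → b ≡ true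
      not-true {true} _ = refl

      later : ∀ {g f} → g ⊏ f → T g ≡ T f → site g ≡ site f → isFirst f ≡ false
      later {g} {f} r tg sg with isFirst g in fg
      ... | true  = cong not (seen-complete (g , r , tg , sg , fg))
      ... | false with seen-sound {g} (not-true fg)
      ...   | h , s , th , sh , fh =
        cong not (seen-complete (h , (proj₁ r , ⊏⇒⊑ s ◅◅ proj₁ (proj₂ r) , proj₂ (proj₂ r)) , trans th tg , trans sh sg , fh))

      -- The predecessor of `e` lies on the process of `e`, its sender on another one; one process
      -- cannot provide both.
      at-most-one : ∀ {e f g} → f ≢ g → site f ≡ site g → prev e ≡ just f ⊎ sender e ≡ just f →
                    prev e ≡ just g ⊎ sender e ≡ just g → ⊥
      at-most-one ne s (inj₁ p) (inj₁ p′) = ne (just-injective (trans (sym p) p′))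
      at-most-one ne s (inj₂ p) (inj₂ p′) = ne (just-injective (trans (sym p) p′))
      at-most-one ne s (inj₁ p) (inj₂ p′) = msg-site p′ (trans (sym s) (proj₁ (prev-just p)))
      at-most-one ne s (inj₂ p) (inj₁ p′) = msg-site p (trans s (proj₁ (prev-just p′)))

      adjacent? : ∀ e f → Dec (prev e ≡ just f ⊎ sender e ≡ just f)
      adjacent? e f = Maybeₚ.≡-dec _≟E_ (prev e) (just f) ⊎-dec Maybeₚ.≡-dec _≟E_ (sender e) (just f)

      other : ∀ {e f} → f ⊏ e → ¬ (prev e ≡ just f ⊎ sender e ≡ just f) → OtherBelow e f
      other r na = ⊏⇒⊑ r , (λ { refl → ⊏-irrefl r }) , (λ p → na (inj₁ p)) , (λ p → na (inj₂ p))

      seenOther-sound : ∀ {e c q} → SeenOther e (prev e) (sender e) c q →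
                        Σ E λ f → T f ≡ c × site f ≡ q × OtherBelow e f
      seenOther-sound {e} (inj₁ s) with seen-sound s
      ... | f , r , refl , refl , ff with adjacent? e f
      ...   | no na = f , refl , refl , other r na
      ...   | yes a with seen-sound {f} (not-true ff)
      ...     | g , s′ , tg , sg , _ = g , tg , sg ,
        other (proj₁ r , ⊏⇒⊑ s′ ◅◅ proj₁ (proj₂ r) , proj₂ (proj₂ r))
              (λ b → at-most-one {e} {f} {g} (λ { refl → ⊏-irrefl s′ }) (sym sg) a b)
      seenOther-sound {e} {c} {q} (inj₂ (s , na)) with seen-sound s
      ... | f , r , tf , sf , _ = f , tf , sf , other r λ
        { (inj₁ p) → na (inj₁ (subst (λ m → Adjacent m c q) (sym p) (tf , sf)))
        ; (inj₂ p) → na (inj₂ (subst (λ m → Adjacent m c q) (sym p) (tf , sf))) }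

      seenOther-complete : ∀ {e f} → OtherBelow e f → SeenOther e (prev e) (sender e) (T f) (site f)
      seenOther-complete {e} {f} (r , ne , np , ns) with isFirst f in ff
      ... | false = inj₁ (seen-complete (f , ⊑⇒⊏ r ne , refl , refl , ff))
      ... | true with seen e (T f) (site f) false in se
      ...   | true = inj₁ refl
      ...   | false = inj₂ (seen-complete (f , ⊑⇒⊏ r ne , refl , refl , ff) , λ
        { (inj₁ a) → clash (prev e) inj₁ np a ; (inj₂ a) → clash (sender e) inj₂ ns a })
        where
        clash : ∀ m → (∀ {g} → m ≡ just g → Edge prev sender g e) → m ≢ just f → Adjacent m (T f) (site f) → ⊥
        clash (just a) x ne′ (ta , sa) with isFirst a in fa
        ... | false with () ← trans (sym se) (seen-complete (a , (a , ε , x refl) , ta , sa , fa))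
        ... | true with <-cmp (pos a) (pos f)
        ...   | tri≈ _ p _ = ne′ (cong just (uniq sa p))
        ...   | tri< l _ _ with () ← trans (sym ff) (later (⊑⇒⊏ (⊑-process sa (<⇒≤ l)) λ { refl → <-irrefl refl l }) ta sa)
        ...   | tri> _ _ l with () ← trans (sym fa) (later (⊑⇒⊏ (⊑-process (sym sa) (<⇒≤ l)) λ { refl → <-irrefl refl l }) (sym ta) (sym sa))

  module _ (_≟Γ_ : (c d : Γ) → Dec (c ≡ d)) where

    firstOf? : ∀ e → Dec (Σ E λ g → g ⊑ e × g ≢ e × T g ≡ T e × site g ≡ site e)
    firstOf? e = someE? λ g → (g ⊑? e) ×-dec ¬? (g ≟E e) ×-dec (T g ≟Γ T e) ×-dec (site g Finₚ.≟ site e)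

    -- `isFirst` reads the table `seen`, whose entries speak of `isFirst`. A definition by causality
    -- alone breaks this circle, and `trueFirst-ok` then shows that both notions agree.
    trueFirst : E → Bool
    trueFirst e = not (does (firstOf? e))

    trueSeen? : ∀ e c q b → Dec (Σ E λ f → (f ⊑ e × f ≢ e) × T f ≡ c × site f ≡ q × trueFirst f ≡ b)
    trueSeen? e c q b = someE? λ f →
      ((f ⊑? e) ×-dec ¬? (f ≟E e)) ×-dec (T f ≟Γ c) ×-dec (site f Finₚ.≟ q) ×-dec (_ Boolₚ.≟ b)

    trueSeen : E → Γ → Fin n → Bool → Bool
    trueSeen e c q b = does (trueSeen? e c q b)

    open LocalPast site T trueSeen

    ⊏⇒≢ : ∀ {f e} → f ⊏ e → f ≢ e
    ⊏⇒≢ r refl = ⊏-irrefl r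

    first-first : ∀ e → Σ E (λ g → g ⊑ e × g ≢ e × T g ≡ T e × site g ≡ site e) →
                  Σ E λ g → (g ⊑ e × g ≢ e) × T g ≡ T e × site g ≡ site e × trueFirst g ≡ true
    first-first e (g , r , ne , tg , sg) = go (suc (pos g)) g ≤-refl r ne tg sg
      where
      go : ∀ x g → pos g < x → g ⊑ e → g ≢ e → T g ≡ T e → site g ≡ site e →
           Σ E λ g → (g ⊑ e × g ≢ e) × T g ≡ T e × site g ≡ site e × trueFirst g ≡ true
      go (suc x) g (s≤s leq) r ne tg sg with firstOf? g in eqn
      ... | no _ = g , (r , ne) , tg , sg , cong (λ d → not (does d)) eqn
      ... | yes (h , s , ne′ , th , sh) =
        go x h (<-≤-trans (≤∧≢⇒< (⊑-pos sh s) (λ p → ne′ (uniq sh p))) leq) (s ◅◅ r)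
           (λ { refl → ne′ (⊑-antisym s r) }) (trans th tg) (trans sh sg)

    does-cong : ∀ {A B : Set} (d : Dec A) (d′ : Dec B) → (A → B) → (B → A) → does d ≡ does d′
    does-cong (yes a) d′ f g = sym (of-true d′ (f a))
    does-cong (no na) (yes b) f g = ⊥-elim (na (g b))
    does-cong (no _)  (no _)  f g = refl

    trueFirst-ok : ∀ e → trueFirst e ≡ isFirst e
    trueFirst-ok e = cong not (does-cong (firstOf? e) (trueSeen? e (T e) (site e) true) (first-first e)
      λ (g , (r , ne) , tg , sg , _) → g , r , ne , tg , sg)

    trueSeen-ok : ∀ e c q b → PastOK e (prev e) (sender e) c q b
    trueSeen-ok e c q b = (λ s → forth (true-of (trueSeen? e c q b) s)) , (λ t → of-true (trueSeen? e c q b) (back t))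
      where
      True : E → Set
      True e = Σ E λ f → (f ⊑ e × f ≢ e) × T f ≡ c × site f ≡ q × trueFirst f ≡ b
      forth : True e → Through (prev e) c q b ⊎ Through (sender e) c q b
      forth (f , (r , ne) , tf , sf , ff) = by (⊑⇒⊏ r ne)
        where
        at : ∀ g → f ⊑ g → trueSeen g c q b ≡ true ⊎ (T g ≡ c × site g ≡ q × isFirst g ≡ b)
        at g r with f ≟E g
        ... | yes refl = inj₂ (tf , sf , trans (sym (trueFirst-ok f)) ff)
        ... | no fg    = inj₁ (of-true (trueSeen? g c q b) (f , (r , fg) , tf , sf , ff))
        by : f ⊏ e → _
        by (g , r , inj₁ p) = inj₁ (subst (λ m → Through m c q b) (sym p) (at g r))
        by (g , r , inj₂ p) = inj₂ (subst (λ m → Through m c q b) (sym p) (at g r))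
      thru : ∀ m → (∀ {g} → m ≡ just g → Edge prev sender g e) → Through m c q b → True e
      thru (just g) x (inj₁ s) with true-of (trueSeen? g c q b) s
      ... | f , (r , _) , z = f , (⊏⇒⊑ (g , r , x refl) , ⊏⇒≢ (g , r , x refl)) , z
      thru (just g) x (inj₂ (tg , sg , fg)) =
        g , (⊏⇒⊑ (g , ε , x refl) , ⊏⇒≢ (g , ε , x refl)) , tg , sg , trans (trueFirst-ok g) fg
      back : _ → True e
      back (inj₁ t) = thru (prev e) inj₁ t
      back (inj₂ t) = thru (sender e) inj₂ t

module Best {n : ℕ} (G : Chart n) where
  open ChartBasics G
  open Knowledge G

  below : E → E → Maybe E
  below e g = if does (g ⊑? e) then just g else nothing

  below-yes : ∀ {e g} → g ⊑ e → below e g ≡ just g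
  below-yes {e} {g} r rewrite of-true (g ⊑? e) r = refl

  below-just : ∀ {e g h} → below e g ≡ just h → g ≡ h × g ⊑ e
  below-just {e} {g} p with g ⊑? e
  below-just {e} {g} refl | yes r = refl , r

  -- A path that realises the last event of `q` below `e` is optimal, since its knowledge is a
  -- prefix of `q` and so includes all earlier events.
  best : ∀ e q → Σ (Path n n) λ ρ → head ρ ≡ site e × origin ρ ≡ q ×
           (∀ {f} → site f ≡ q → f ⊑ e → pos f < L ρ (suc (pos e)))
  best e q with find (below e) q (len q) | find-latest (below e) q (len q)
  -- No event of `q` lies below `e`, so the requirement is vacuous and any path with these ends will
  -- do.
  ... | nothing | none = let ρ , h , o = somePath (site e) q in ρ , h , o , λ {f} sf r → ⊥-elim (absurd f sf r)
    where
    absurd : ∀ f → site f ≡ q → f ⊑ e → ⊥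
    absurd f sf r with () ← trans (sym (below-yes r)) (none f sf (subst (λ z → pos f < len z) sf (pos<len f)))
  ... | just _ | g , sg , lt , bg , lst with below-just {e} {g} bg
  ...   | refl , r with L-complete r
  ...     | ρ , h , o , known = ρ , h , trans o sg , λ {f} sf s → ≤-<-trans (≮⇒≥ (later f sf s)) known
    where
    later : ∀ f → site f ≡ q → f ⊑ e → ¬ pos g < pos f
    later f sf s l with () ← trans (sym (below-yes s)) (lst f sf l (subst (λ z → pos f < len z) sf (pos<len f)))

Valid : ∀ {n} → Path n n → Path n n → Set
Valid π π′ = head π ≡ head π′ × origin π ≡ origin π′ × head π ≢ origin π

valid? : ∀ {n} (π π′ : Path n n) → Dec (Valid π π′)
valid? π π′ = (_ Finₚ.≟ _) ×-dec (_ Finₚ.≟ _) ×-dec ¬? (_ Finₚ.≟ _)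

module Parallel {n : ℕ} (G : Chart n) {Γ : Set} (T : Chart.E G → Γ) (_≟Γ_ : (c d : Γ) → Dec (c ≡ d))
  (to fr : Chart.E G → Maybe (Fin n))
  (to-ok : ∀ e → to e ≡ Maybe.map (Chart.site G) (Chart.receiver G e))
  (fr-ok : ∀ e → fr e ≡ Maybe.map (Chart.site G) (Chart.sender G e))
  (last : Fin n → Maybe (Chart.E G)) (il : ChartBasics.IsLast G last) where
  open ChartBasics G
  open Best

  isType : Γ → E → Bool
  isType c e = does (T e ≟Γ c)

  Certifies : Γ → Path n n → Path n n → (E → Certificate n) → Set
  Certifies c π π′ t =
    (∀ e → LocalCert.CertOK site to fr (isType c) t π π′ e (prev e) (next e) (sender e) (receiver e)) ×
    LocalCert.CertEnd site to fr (isType c) t π π′ last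

  AllPositive : (Γ → Path n n → Path n n → E → Certificate n) → E → Γ → Fin n → Set
  AllPositive t e c q = q ≢ site e × (∀ π π′ → head π ≡ site e → head π′ ≡ site e → origin π ≡ q → origin π′ ≡ q →
                                       Certificate.diff (t c π π′ e) ≢ c0)

  module _ (t : Γ → Path n n → Path n n → E → Certificate n)
           (ok : ∀ c π π′ → Valid π π′ → Certifies c π π′ (t c π π′)) where

    -- The hypothesis holds in particular for the best paths in both directions. Their boundaries
    -- miss no causal relation between `e` and `q`, so an event of their window is incomparable to
    -- `e`.
    parallel-sound : ∀ {e c q} → AllPositive t e c q → Σ E λ f → T f ≡ c × site f ≡ q × ¬ f ⊑ e × ¬ e ⊑ f
    parallel-sound {e} {c} {q} (ne , pos≢) with best G e q | best (dual G) e q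
    ... | π , hπ , oπ , bπ | π′ , hπ′ , oπ′ , bπ′
      with CertProofs.Sound.positive-sound G π π′ (trans hπ (sym hπ′)) (trans oπ (sym oπ′))
             (λ z → ne (trans (sym oπ) (trans (sym z) hπ))) to fr to-ok fr-ok (isType c) last il (t c π π′)
             (proj₁ (ok c π π′ (trans hπ (sym hπ′) , trans oπ (sym oπ′) , λ z → ne (trans (sym oπ) (trans (sym z) hπ)))))
             (proj₂ (ok c π π′ (trans hπ (sym hπ′) , trans oπ (sym oπ′) , λ z → ne (trans (sym oπ) (trans (sym z) hπ)))))
             (sym hπ) (pos≢ π π′ hπ hπ′ oπ oπ′)
    ... | f , sf , tf , lo , hi = f , true-of (T f ≟Γ c) tf , trans sf oπ ,
      (λ r → <-irrefl refl (<-≤-trans (bπ (trans sf oπ) r) lo)) ,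
      (λ r → <-irrefl refl (<-≤-trans hi (Wd.<Hi⇒copos sf
                (Wd.Lᵈ≤N (subst (λ z → suc (copos e) ≤ len z) (sym hπ) (ChartBasics.pos<len (dual G) e)))
                (bπ′ (trans sf oπ) (Wd.⊒⇒⊑ᵈ r)))))
      where
      module Wd = Window G π π′ (trans hπ (sym hπ′)) (trans oπ (sym oπ′)) (λ z → ne (trans (sym oπ) (trans (sym z) hπ)))

    -- An event outside a window is causally related to `e`, whatever the paths. So `f` lies in all
    -- windows, and a zero count would contradict `zero-sound`.
    parallel-complete : ∀ {e f} → ¬ f ⊑ e → ¬ e ⊑ f → AllPositive t e (T f) (site f)
    parallel-complete {e} {f} nfe nef = ne , λ π π′ hπ hπ′ oπ oπ′ z →
      let v₁ = trans hπ (sym hπ′)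
          v₂ = trans oπ (sym oπ′)
          v₃ = λ z → ne (trans (sym oπ) (trans (sym z) hπ))
          open Window G π π′ v₁ v₂ v₃
      in CertProofs.Sound.zero-sound G π π′ v₁ v₂ v₃ to fr to-ok fr-ok (isType (T f)) last il (t (T f) π π′)
           (proj₁ (ok (T f) π π′ (v₁ , v₂ , v₃))) (proj₂ (ok (T f) π π′ (v₁ , v₂ , v₃)))
           (sym hπ) z {f} (sym oπ) (of-true (T f ≟Γ T f) refl)
           (≮⇒≥ λ lt → nfe (below-Lo (sym hπ) (sym oπ) lt))
           (≰⇒> λ leq → nef (above-Hi (sym hπ) (sym oπ) leq))
      where
      ne : site f ≢ site e
      ne s with ≤-total (pos f) (pos e)
      ... | inj₁ leq = nfe (⊑-process s leq)
      ... | inj₂ ge = nef (⊑-process (sym s) ge)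

  certifiable : Σ (Γ → Path n n → Path n n → E → Certificate n) λ t → ∀ c π π′ → Valid π π′ → Certifies c π π′ (t c π π′)
  certifiable = t′ , t′-ok
    where
    by : ∀ c π π′ → Dec (Valid π π′) → E → Certificate n
    by c π π′ (yes (a , b , d)) = CertProofs.Complete.t G π π′ a b d to fr to-ok fr-ok (isType c) last il
    -- A filler: the conditions are imposed on valid pairs only, and the pairs that decide about
    -- concurrency are valid because `q` is not the process of `e`.
    by c π π′ (no _) _ = cert false false c0 (replicate n (c0 , c0)) (replicate n (c0 , c0)) (replicate (suc n) false)
    t′ : Γ → Path n n → Path n n → E → Certificate n
    t′ c π π′ = by c π π′ (valid? π π′)
    t′-ok : ∀ c π π′ → Valid π π′ → Certifies c π π′ (t′ c π π′)
    t′-ok c π π′ v with valid? π π′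
    ... | no nv = ⊥-elim (nv v)
    ... | yes (a , b , d) = CertProofs.Complete.t-ok G π π′ a b d to fr to-ok fr-ok (isType c) last il ,
                            CertProofs.Complete.t-end G π π′ a b d to fr to-ok fr-ok (isType c) last il

-- The chart of an MSC

upper : ∀ {n} (f : Fin n → ℕ) → Σ ℕ λ m → ∀ p → f p ≤ m
upper {zero}  f = 0 , λ ()
upper {suc n} f = let m , b = upper (λ p → f (Fin.suc p)) in f Fin.zero ⊔ m , λ
  { Fin.zero → m≤m⊔n (f Fin.zero) m ; (Fin.suc p) → ≤-trans (b p) (m≤n⊔m (f Fin.zero) m) }

module FromMSC {n k : ℕ} (M : MSC n k) where
  open MSC M using (w; msg; msg-diff; acyclic; one-pair) renaming (fifo to fifoᴹ)

  size-of : Fin n → ℕ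
  size-of p = length (w p)

  position coposition : Ev w → ℕ
  position   e = toℕ (proj₂ e)
  coposition e = toℕ (opposite (proj₂ e))

  ev-eq : ∀ {e f : Ev w} → proj₁ e ≡ proj₁ f → position e ≡ position f → e ≡ f
  ev-eq {p , i} {_ , j} refl q = cong (p ,_) (Finₚ.toℕ-injective q)

  event coevent : Fin n → ℕ → Maybe (Ev w)
  event p x with x <? size-of p
  ... | yes lt = just (p , fromℕ< lt)
  ... | no _   = nothing
  coevent p x with x <? size-of p
  ... | yes lt = just (p , opposite (fromℕ< lt))
  ... | no _   = nothing

  event-just : ∀ {p x e} → event p x ≡ just e → proj₁ e ≡ p × position e ≡ x
  event-just {p} {x} q with x <? size-of p
  event-just refl | yes lt = refl , Finₚ.toℕ-fromℕ< lt

  coevent-just : ∀ {p x e} → coevent p x ≡ just e → proj₁ e ≡ p × coposition e ≡ x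
  coevent-just {p} {x} q with x <? size-of p
  coevent-just refl | yes lt =
    refl , trans (cong toℕ (Finₚ.opposite-involutive (fromℕ< lt))) (Finₚ.toℕ-fromℕ< lt)

  event-nothing : ∀ {p x} → event p x ≡ nothing → size-of p ≤ x
  event-nothing {p} {x} q with x <? size-of p
  ... | no ge = ≮⇒≥ ge

  coevent-nothing : ∀ {p x} → coevent p x ≡ nothing → size-of p ≤ x
  coevent-nothing {p} {x} q with x <? size-of p
  ... | no ge = ≮⇒≥ ge

  event-self : ∀ e → event (proj₁ e) (position e) ≡ just e
  event-self (p , i) with toℕ i <? size-of p
  ... | yes lt = cong (λ j → just (p , j)) (Finₚ.fromℕ<-toℕ i lt)
  ... | no ge  = ⊥-elim (ge (Finₚ.toℕ<n i))

  coevent-self : ∀ e → coevent (proj₁ e) (coposition e) ≡ just e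
  coevent-self (p , i) with toℕ (opposite i) <? size-of p
  ... | yes lt = cong (λ j → just (p , j))
                   (trans (cong opposite (Finₚ.fromℕ<-toℕ (opposite i) lt)) (Finₚ.opposite-involutive i))
  ... | no ge  = ⊥-elim (ge (Finₚ.toℕ<n (opposite i)))

  before after : Fin n → ℕ → Maybe (Ev w)
  before p zero    = nothing
  before p (suc x) = event p x
  after p zero     = nothing
  after p (suc x)  = coevent p x

  before-just : ∀ {p x g} → before p x ≡ just g → proj₁ g ≡ p × suc (position g) ≡ x
  before-just {x = suc x} q = let a , b = event-just q in a , cong suc b

  after-just : ∀ {p x g} → after p x ≡ just g → proj₁ g ≡ p × suc (coposition g) ≡ x
  after-just {x = suc x} q = let a , b = coevent-just q in a , cong suc b

  before-nothing : ∀ {p x} → x < size-of p → before p x ≡ nothing → x ≡ 0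
  before-nothing {x = zero}  _  _ = refl
  before-nothing {x = suc x} lt q = ⊥-elim (<-irrefl refl (<-≤-trans (<⇒≤ lt) (event-nothing q)))

  after-nothing : ∀ {p x} → x < size-of p → after p x ≡ nothing → x ≡ 0
  after-nothing {x = zero}  _  _ = refl
  after-nothing {x = suc x} lt q = ⊥-elim (<-irrefl refl (<-≤-trans (<⇒≤ lt) (coevent-nothing q)))

  someEv? : {P : Ev w → Set} → (∀ e → Dec (P e)) → Dec (Σ (Ev w) P)
  someEv? P? = map′ (λ (p , i , x) → (p , i) , x) (λ ((p , i) , x) → p , i , x)
                 (Finₚ.any? λ p → Finₚ.any? λ i → P? (p , i))

  pick : {P : Ev w → Set} → Dec (Σ (Ev w) P) → Maybe (Ev w)
  pick (yes (e , _)) = just e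
  pick (no _)        = nothing

  pick-just : {P : Ev w → Set} (d : Dec (Σ (Ev w) P)) → ∀ {e} → pick d ≡ just e → P e
  pick-just (yes (e , p)) refl = p

  pick-yes : {P : Ev w → Set} (d : Dec (Σ (Ev w) P)) → (∀ {e f} → P e → P f → e ≡ f) → ∀ {e} → P e → pick d ≡ just e
  pick-yes (yes (f , p)) u pe = cong just (u p pe)
  pick-yes (no np)       u pe = ⊥-elim (np (_ , pe))

  sent? : ∀ f → Dec (Σ (Ev w) λ e → msg e f ≡ true)
  sent? f = someEv? λ e → msg e f Boolₚ.≟ true

  received? : ∀ e → Dec (Σ (Ev w) λ f → msg e f ≡ true)
  received? e = someEv? λ f → msg e f Boolₚ.≟ true

  senderᴹ receiverᴹ prevᴹ nextᴹ : Ev w → Maybe (Ev w)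
  senderᴹ f   = pick (sent? f)
  receiverᴹ e = pick (received? e)
  prevᴹ e     = before (proj₁ e) (position e)
  nextᴹ e     = after (proj₁ e) (coposition e)

  sender⇒msg : ∀ {e f} → senderᴹ f ≡ just e → msg e f ≡ true
  sender⇒msg {f = f} = pick-just (sent? f)

  msg⇒sender : ∀ {e f} → msg e f ≡ true → senderᴹ f ≡ just e
  msg⇒sender {f = f} = pick-yes (sent? f) λ m m′ → proj₁ (one-pair _ _ _ _ m m′ (inj₂ (inj₂ (inj₂ refl))))

  receiver⇒msg : ∀ {e f} → receiverᴹ e ≡ just f → msg e f ≡ true
  receiver⇒msg {e} = pick-just (received? e)

  msg⇒receiver : ∀ {e f} → msg e f ≡ true → receiverᴹ e ≡ just f
  msg⇒receiver {e} = pick-yes (received? e) λ m m′ → proj₂ (one-pair _ _ _ _ m m′ (inj₁ refl))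

  opposite-suc : ∀ {m} (i j : Fin m) → suc (toℕ i) ≡ toℕ j → suc (toℕ (opposite j)) ≡ toℕ (opposite i)
  opposite-suc {m} i j p rewrite Finₚ.opposite-prop i | Finₚ.opposite-prop j | sym p =
    sym (+-∸-assoc 1 (subst (_< m) (sym p) (Finₚ.toℕ<n j)))

  psucc⇒next : ∀ {e f} → PSucc w e f → nextᴹ e ≡ just f
  psucc⇒next {p , i} {_ , j} (refl , q) rewrite sym (opposite-suc i j q) = coevent-self (p , j)

  psucc⇒prev : ∀ {e f} → PSucc w e f → prevᴹ f ≡ just e
  psucc⇒prev {p , i} {_ , j} (refl , q) rewrite sym q = event-self (p , i)

  prev⇒psucc : ∀ {e f} → prevᴹ f ≡ just e → PSucc w e f
  prev⇒psucc {e} {f} = before-just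

  opposite-suc⁻ : ∀ {m} (i j : Fin m) → suc (toℕ (opposite j)) ≡ toℕ (opposite i) → suc (toℕ i) ≡ toℕ j
  opposite-suc⁻ i j p = trans (cong (λ z → suc (toℕ z)) (sym (Finₚ.opposite-involutive i)))
    (trans (opposite-suc (opposite j) (opposite i) p) (cong toℕ (Finₚ.opposite-involutive j)))

  next⇒psucc : ∀ {e f} → nextᴹ e ≡ just f → PSucc w e f
  next⇒psucc {p , i} {s , j} q with after-just {p} {toℕ (opposite i)} q
  ... | refl , r = refl , opposite-suc⁻ i j r

  infix 4 _<⁺_
  _<⁺_ : Ev w → Ev w → Set
  e <⁺ f = Σ (Ev w) λ g → Star (Step w msg) e g × Step w msg g f

  longest : Σ ℕ λ m → ∀ p → size-of p ≤ m
  longest = upper size-of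

  number : Ev w → Fin (n * proj₁ longest)
  number (p , i) = combine p (inject≤ i (proj₂ longest p))

  number-inj : ∀ {e f} → number e ≡ number f → e ≡ f
  number-inj {p , i} {q , j} eqn with Finₚ.combine-injective p _ q _ eqn
  ... | refl , r = cong (p ,_) (Finₚ.inject≤-injective _ _ i j r)

  -- A strict partial order on a finite set is well-founded in both directions. Causality is carried
  -- over to an initial segment of the numbers to use this; processes are padded to a common length
  -- for the numbering.
  _≺_ : Fin (n * proj₁ longest) → Fin (n * proj₁ longest) → Set
  i ≺ j = Σ (Ev w) λ e → Σ (Ev w) λ f → number e ≡ i × number f ≡ j × e <⁺ f

  ≺-order : IsStrictPartialOrder _≡_ _≺_
  ≺-order = record
    { isEquivalence = isEquivalence
    ; irrefl = λ { refl (e , f , p , q , g , r , s) → irr (number-inj (trans q (sym p))) r s }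
    ; trans = λ { (e , f , p , q , g , r , s) (e′ , f′ , p′ , q′ , g′ , r′ , s′) →
        e , f′ , p , q′ , g′ , r ◅◅ (s ◅ ε) ◅◅ subst (λ z → Star (Step w msg) z g′) (number-inj (trans p′ (sym q))) r′ , s′ }
    ; <-resp-≈ = (λ { refl x → x }) , (λ { refl x → x }) }
    where
    irr : ∀ {e f g} → f ≡ e → Star (Step w msg) e g → Step w msg g f → ⊥
    irr refl r s = acyclic _ _ s r

  edge⇒step : ∀ {e f} → Edge prevᴹ senderᴹ e f → Step w msg e f
  edge⇒step (inj₁ p) = inj₁ (prev⇒psucc p)
  edge⇒step (inj₂ s) = inj₂ (sender⇒msg s)

  step⇒edge : ∀ {e f} → Step w msg e f → Edge prevᴹ senderᴹ e f
  step⇒edge (inj₁ p) = inj₁ (psucc⇒prev p)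
  step⇒edge (inj₂ s) = inj₂ (msg⇒sender s)

  coedge⇒step : ∀ {e f} → Edge nextᴹ receiverᴹ e f → Step w msg f e
  coedge⇒step (inj₁ p) = inj₁ (next⇒psucc p)
  coedge⇒step (inj₂ s) = inj₂ (receiver⇒msg s)

  wfᴹ : WellFounded (Edge prevᴹ senderᴹ)
  wfᴹ e = go e (spo-wellFounded ≺-order (number e))
    where
    go : ∀ e → Acc _≺_ (number e) → Acc (Edge prevᴹ senderᴹ) e
    go e (acc rs) = acc λ {f} x → go f (rs (f , e , refl , refl , f , ε , edge⇒step x))

  cowfᴹ : WellFounded (Edge nextᴹ receiverᴹ)
  cowfᴹ e = go e (spo-noetherian ≺-order (number e))
    where
    go : ∀ e → Acc (flip _≺_) (number e) → Acc (Edge nextᴹ receiverᴹ) e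
    go e (acc rs) = acc λ {f} x → go f (rs (e , f , refl , refl , e , ε , coedge⇒step x))

  process-pos : ∀ {e f} → Star (PSucc w) e f → position e ≤ position f
  process-pos ε = ≤-refl
  process-pos ((_ , q) ◅ r) = ≤-trans (≤-trans (n≤1+n _) (≤-reflexive q)) (process-pos r)

  pos-process : ∀ {e f} → proj₁ e ≡ proj₁ f → position e ≤ position f → Star (PSucc w) e f
  pos-process {e} {f} p leq = go (position f) f refl p leq
    where
    go : ∀ x f → position f ≡ x → proj₁ e ≡ proj₁ f → position e ≤ x → Star (PSucc w) e f
    go x f q p leq with m≤n⇒m<n∨m≡n leq
    ... | inj₂ r = subst (Star (PSucc w) e) (ev-eq p (trans r (sym q))) ε
    go (suc x) f q p leq | inj₁ (s≤s lt) with prevᴹ f in pf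
    ... | nothing with () ← trans (sym q) (before-nothing (Finₚ.toℕ<n (proj₂ f)) pf)
    ... | just g = let sg , pg = before-just pf in
      go x g (suc-injective (trans pg q)) (trans p (sym sg)) lt ◅◅ ((sg , pg) ◅ ε)

  chart : Chart n
  chart = record
    { E = Ev w ; site = proj₁ ; len = size-of ; pos = position ; copos = coposition
    ; pos+copos = λ { (p , i) → trans (cong (λ z → toℕ i + suc z) (Finₚ.opposite-prop i))
        (trans (+-suc (toℕ i) _) (m+[n∸m]≡n (Finₚ.toℕ<n i))) }
    ; ev = event ; coev = coevent
    ; ev-just = event-just ; ev-self = event-self ; ev-nothing = event-nothing
    ; coev-just = coevent-just ; coev-self = coevent-self ; coev-nothing = coevent-nothing
    ; prev = prevᴹ ; next = nextᴹ ; sender = senderᴹ ; receiver = receiverᴹ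
    ; prev-just = before-just ; prev-nothing = λ {e} → before-nothing (Finₚ.toℕ<n (proj₂ e))
    ; next-just = after-just ; next-nothing = λ {e} → after-nothing (Finₚ.toℕ<n (opposite (proj₂ e)))
    ; sender-receiver = λ s → msg⇒receiver (sender⇒msg s)
    ; receiver-sender = λ r → msg⇒sender (receiver⇒msg r)
    ; msg-site = λ s → msg-diff _ _ (sender⇒msg s)
    ; one-msg = λ s r → not-both (sender⇒msg s) (receiver⇒msg r)
    ; fifo = fifo
    ; wf = wfᴹ ; cowf = cowfᴹ }
    where
    not-both : ∀ {e g f} → msg g e ≡ true → msg e f ≡ true → ⊥
    not-both {e} {g} {f} m m′ with one-pair g e e f m m′ (inj₂ (inj₂ (inj₁ refl)))
    ... | refl , _ = msg-diff _ _ m refl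
    -- An MSC states FIFO for the reflexive order. It becomes strict because, by `one-pair`, equal
    -- receives have equal sends.
    fifo : ∀ {e f e′ f′} → senderᴹ f ≡ just e → senderᴹ f′ ≡ just e′ →
           proj₁ e ≡ proj₁ e′ → proj₁ f ≡ proj₁ f′ → position e < position e′ → position f < position f′
    fifo {e} {f} {e′} {f′} s s′ p q lt = ≤∧≢⇒<
      (process-pos (Equivalence.to (fifoᴹ _ _ _ _ (sender⇒msg s) (sender⇒msg s′) p q) (pos-process p (<⇒≤ lt))))
      λ r → <-irrefl (cong position (same-sender (ev-eq q r))) lt
      where
      same-sender : f ≡ f′ → e ≡ e′
      same-sender refl = proj₁ (one-pair _ _ _ _ (sender⇒msg s) (sender⇒msg s′) (inj₂ (inj₂ (inj₂ refl))))

  lastEvent : Fin n → Maybe (Ev w)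
  lastEvent p = before p (size-of p)

  lastEvent-ok : ChartBasics.IsLast chart lastEvent
  lastEvent-ok p with before p (size-of p) in q
  ... | just e = before-just q
  ... | nothing with size-of p in s
  ...   | zero  = refl
  ...   | suc x = ⊥-elim (<-irrefl refl (≤-trans (≤-reflexive (sym s)) (event-nothing q)))

  open ChartBasics chart using (_⊑_)

  ≤ₘ⇒⊑ : ∀ {e f} → _≤ₘ_ M e f → e ⊑ f
  ≤ₘ⇒⊑ = map step⇒edge

  ⊑⇒≤ₘ : ∀ {e f} → e ⊑ f → _≤ₘ_ M e f
  ⊑⇒≤ₘ = map edge⇒step

-- Two-variable formulas

infix 2 _⟺_
_⟺_ : Set → Set → Set
A ⟺ B = (A → B) × (B → A)

-- Every pair of events stands in one of these relations, and it decides all binary atoms. Adjacent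
-- events have relations of their own, so `bef` and `aft` exclude them; this is why mere sets of
-- past types are not enough.
data Rel : Set where
  same sucR preR sndR rcvR bef aft par : Rel

flipR : Rel → Rel
flipR same = same
flipR sucR = preR
flipR preR = sucR
flipR sndR = rcvR
flipR rcvR = sndR
flipR bef  = aft
flipR aft  = bef
flipR par  = par

codeRel : Code Rel 3
codeRel = codeMap from to from-to (code× codeBool (code× codeBool codeBool))
  where
  from : Bool × Bool × Bool → Rel
  from (false , false , false) = same
  from (false , false , true)  = sucR
  from (false , true , false)  = preR
  from (false , true , true)   = sndR
  from (true , false , false)  = rcvR
  from (true , false , true)   = bef
  from (true , true , false)   = aft
  from (true , true , true)    = par
  to : Rel → Bool × Bool × Bool
  to same = false , false , false
  to sucR = false , false , true
  to preR = false , true , false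
  to sndR = false , true , true
  to rcvR = true , false , false
  to bef  = true , false , true
  to aft  = true , true , false
  to par  = true , true , true
  from-to : ∀ r → from (to r) ≡ r
  from-to same = refl
  from-to sucR = refl
  from-to preR = refl
  from-to sndR = refl
  from-to rcvR = refl
  from-to bef  = refl
  from-to aft  = refl
  from-to par  = refl

isSame isSuc isSnd isLe : Rel → Bool
isSame same = true
isSame _    = false
isSuc sucR = true
isSuc _    = false
isSnd sndR = true
isSnd _    = false
isLe same = true
isLe sucR = true
isLe sndR = true
isLe aft  = true
isLe _    = false

module Relations {n : ℕ} (G : Chart n) where
  open ChartBasics G
  open Duality G

  Holds : Rel → E → E → Set
  Holds same e f = e ≡ f
  Holds sucR e f = next e ≡ just f
  Holds preR e f = prev e ≡ just f
  Holds sndR e f = receiver e ≡ just f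
  Holds rcvR e f = sender e ≡ just f
  Holds bef  e f = f ⊑ e × f ≢ e × prev e ≢ just f × sender e ≢ just f
  Holds aft  e f = e ⊑ f × f ≢ e × next e ≢ just f × receiver e ≢ just f
  Holds par  e f = ¬ f ⊑ e × ¬ e ⊑ f

  holds-flip : ∀ r {e f} → Holds r e f → Holds (flipR r) f e
  holds-flip same h = sym h
  holds-flip sucR h = next⇒prev h
  holds-flip preR h = prev⇒next h
  holds-flip sndR h = receiver-sender h
  holds-flip rcvR h = sender-receiver h
  holds-flip bef (r , ne , np , ns) =
    r , (λ q → ne (sym q)) , (λ q → np (next⇒prev q)) , (λ q → ns (receiver-sender q))
  holds-flip aft (r , ne , np , ns) =
    r , (λ q → ne (sym q)) , (λ q → np (prev⇒next q)) , (λ q → ns (sender-receiver q))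
  holds-flip par (a , b) = b , a

  holds-some : ∀ e f → Σ Rel λ r → Holds r e f
  holds-some e f with e ≟E f
  ... | yes p = same , p
  ... | no ne with Maybeₚ.≡-dec _≟E_ (next e) (just f)
  ... | yes p = sucR , p
  ... | no ns with Maybeₚ.≡-dec _≟E_ (prev e) (just f)
  ... | yes p = preR , p
  ... | no np with Maybeₚ.≡-dec _≟E_ (receiver e) (just f)
  ... | yes p = sndR , p
  ... | no nr with Maybeₚ.≡-dec _≟E_ (sender e) (just f)
  ... | yes p = rcvR , p
  ... | no nt with e ⊑? f
  ... | yes r = aft , r , (λ q → ne (sym q)) , ns , nr
  ... | no ef with f ⊑? e
  ... | yes r = bef , r , (λ q → ne (sym q)) , np , nt
  ... | no fe = par , fe , ef

  edge-≢ : ∀ {e f} → Edge prev sender e f → e ≢ f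
  edge-≢ x refl = no-cycle ε x

  next-edge : ∀ {e f} → next e ≡ just f → Edge prev sender e f
  next-edge p = inj₁ (next⇒prev p)

  receiver-edge : ∀ {e f} → receiver e ≡ just f → Edge prev sender e f
  receiver-edge p = inj₂ (receiver-sender p)

  not-back : ∀ {e f} → Edge prev sender e f → ¬ f ⊑ e
  not-back x r = no-cycle r x

  same-table : ∀ r {e f} → Holds r e f → e ≡ f ⟺ isSame r ≡ true
  same-table same h = (λ _ → refl) , (λ _ → h)
  same-table sucR h = (λ p → ⊥-elim (edge-≢ (next-edge h) p)) , λ ()
  same-table preR h = (λ p → ⊥-elim (edge-≢ (inj₁ h) (sym p))) , λ ()
  same-table sndR h = (λ p → ⊥-elim (edge-≢ (receiver-edge h) p)) , λ ()
  same-table rcvR h = (λ p → ⊥-elim (edge-≢ (inj₂ h) (sym p))) , λ ()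
  same-table bef (_ , ne , _) = (λ p → ⊥-elim (ne (sym p))) , λ ()
  same-table aft (_ , ne , _) = (λ p → ⊥-elim (ne (sym p))) , λ ()
  same-table par (a , _) = (λ { refl → ⊥-elim (a ε) }) , λ ()

  next-not-msg : ∀ {e f} → next e ≡ just f → receiver e ≡ just f → ⊥
  next-not-msg p q = msg-site (receiver-sender q) (sym (proj₁ (next-just p)))

  suc-table : ∀ r {e f} → Holds r e f → next e ≡ just f ⟺ isSuc r ≡ true
  suc-table same refl = (λ p → ⊥-elim (edge-≢ (next-edge p) refl)) , λ ()
  suc-table sucR h = (λ _ → refl) , (λ _ → h)
  suc-table preR h = (λ p → ⊥-elim (not-back (next-edge p) (⊑-prev h))) , λ ()
  suc-table sndR h = (λ p → ⊥-elim (next-not-msg p h)) , λ ()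
  suc-table rcvR h = (λ p → ⊥-elim (not-back (next-edge p) (⊑-sender h))) , λ ()
  suc-table bef (r , _) = (λ p → ⊥-elim (not-back (next-edge p) r)) , λ ()
  suc-table aft (_ , _ , ns , _) = (λ p → ⊥-elim (ns p)) , λ ()
  suc-table par (_ , b) = (λ p → ⊥-elim (b (next-edge p ◅ ε))) , λ ()

  snd-table : ∀ r {e f} → Holds r e f → receiver e ≡ just f ⟺ isSnd r ≡ true
  snd-table same refl = (λ p → ⊥-elim (edge-≢ (receiver-edge p) refl)) , λ ()
  snd-table sucR h = (λ p → ⊥-elim (next-not-msg h p)) , λ ()
  snd-table preR h = (λ p → ⊥-elim (not-back (receiver-edge p) (⊑-prev h))) , λ ()
  snd-table sndR h = (λ _ → refl) , (λ _ → h)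
  snd-table rcvR h = (λ p → ⊥-elim (not-back (receiver-edge p) (⊑-sender h))) , λ ()
  snd-table bef (r , _) = (λ p → ⊥-elim (not-back (receiver-edge p) r)) , λ ()
  snd-table aft (_ , _ , _ , ns) = (λ p → ⊥-elim (ns p)) , λ ()
  snd-table par (_ , b) = (λ p → ⊥-elim (b (receiver-edge p ◅ ε))) , λ ()

  le-table : ∀ r {e f} → Holds r e f → e ⊑ f ⟺ isLe r ≡ true
  le-table same refl = (λ _ → refl) , (λ _ → ε)
  le-table sucR h = (λ _ → refl) , (λ _ → next-edge h ◅ ε)
  le-table preR h = (λ r → ⊥-elim (not-back (inj₁ h) r)) , λ ()
  le-table sndR h = (λ _ → refl) , (λ _ → receiver-edge h ◅ ε)
  le-table rcvR h = (λ r → ⊥-elim (not-back (inj₂ h) r)) , λ ()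
  le-table bef (r , ne , _) = (λ s → ⊥-elim (ne (⊑-antisym r s))) , λ ()
  le-table aft (r , _) = (λ _ → refl) , (λ _ → r)
  le-table par (_ , b) = (λ r → ⊥-elim (b r)) , λ ()

choose : {A : Set} → Var → A → A → A
choose vx b c = b
choose vy b c = c

atom : (Rel → Bool) → Bool → Var → Var → Rel → Bool
atom f d vx vy r = f r
atom f d vy vx r = f (flipR r)
atom f d vx vx r = d
atom f d vy vy r = d

module _ {n k nX : ℕ} where

  -- One bit for each subformula whose truth depends on a single event.
  Bits : FO2 n k nX → Set
  Bits (proc _ _) = Bool
  Bits (lab _ _)  = Bool
  Bits (mem _ _)  = Bool
  Bits (eq _ _)   = ⊤
  Bits (succ _ _) = ⊤
  Bits (msgR _ _) = ⊤
  Bits (le _ _)   = ⊤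
  Bits (or φ ψ)   = Bits φ × Bits ψ
  Bits (neg φ)    = Bits φ
  Bits (ex _ φ)   = Bool × Bits φ

  #bits : FO2 n k nX → ℕ
  #bits (proc _ _) = 1
  #bits (lab _ _)  = 1
  #bits (mem _ _)  = 1
  #bits (eq _ _)   = 0
  #bits (succ _ _) = 0
  #bits (msgR _ _) = 0
  #bits (le _ _)   = 0
  #bits (or φ ψ)   = #bits φ + #bits ψ
  #bits (neg φ)    = #bits φ
  #bits (ex _ φ)   = 1 + #bits φ

  codeBits : ∀ φ → Code (Bits φ) (#bits φ)
  codeBits (proc _ _) = codeBool
  codeBits (lab _ _)  = codeBool
  codeBits (mem _ _)  = codeBool
  codeBits (eq _ _)   = codeUnit
  codeBits (succ _ _) = codeUnit
  codeBits (msgR _ _) = codeUnit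
  codeBits (le _ _)   = codeUnit
  codeBits (or φ ψ)   = code× (codeBits φ) (codeBits ψ)
  codeBits (neg φ)    = codeBits φ
  codeBits (ex _ φ)   = code× codeBool (codeBits φ)

  #bits≤fsize : ∀ φ → #bits φ ≤ fsize φ
  #bits≤fsize (proc _ _) = s≤s z≤n
  #bits≤fsize (lab _ _)  = s≤s z≤n
  #bits≤fsize (mem _ _)  = s≤s z≤n
  #bits≤fsize (eq _ _)   = z≤n
  #bits≤fsize (succ _ _) = z≤n
  #bits≤fsize (msgR _ _) = z≤n
  #bits≤fsize (le _ _)   = z≤n
  #bits≤fsize (or φ ψ)   = ≤-trans (+-mono-≤ (#bits≤fsize φ) (#bits≤fsize ψ)) (m≤n+m _ 3)
  #bits≤fsize (neg φ)    = ≤-trans (#bits≤fsize φ) (n≤1+n _)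
  #bits≤fsize (ex _ φ)   = ≤-trans (s≤s (#bits≤fsize φ)) (m≤n+m _ 2)

  -- The truth of φ at x and y, from the bits of x, the bits of y and the relation between x and y.
  holds : ∀ φ → Bits φ → Bits φ → Rel → Bool
  holds (proc _ u) b c r = choose u b c
  holds (lab _ u)  b c r = choose u b c
  holds (mem u _)  b c r = choose u b c
  holds (eq u v)   b c r = atom isSame true u v r
  holds (succ u v) b c r = atom isSuc false u v r
  holds (msgR u v) b c r = atom isSnd false u v r
  holds (le u v)   b c r = atom isLe true u v r
  holds (or φ ψ) (b , b′) (c , c′) r = holds φ b c r ∨ holds ψ b′ c′ r
  holds (neg φ)    b c r = not (holds φ b c r)
  -- Quantifying one variable leaves only the other one free, so the event of the other variable
  -- stores the answer.
  holds (ex vx φ) (b , _) (c , _) r = c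
  holds (ex vy φ) (b , _) (c , _) r = b

  -- Variable v ranges over the neighbours c of an event with bits b.
  holdsAt : Var → ∀ φ → Bits φ → Bits φ → Rel → Bool
  holdsAt vy φ b c r = holds φ b c r
  holdsAt vx φ b c r = holds φ c b (flipR r)

  module LocalBits {Φ : FO2 n k nX} (p : Fin n) (a : Fin k) (sg : Vec Bool nX) (b : Bits Φ)
                   (NB : Rel → Bits Φ → Set) (NB? : ∀ r c → Dec (NB r c)) where

    -- `pr` extracts the bits of a subformula from a full type. Neighbours are always described by
    -- full types, so one relation `NB` serves all quantifiers.
    Witness : Var → ∀ φ → (Bits Φ → Bits φ) → Set
    Witness v φ pr = Σ Rel λ r → Σ (Bits Φ) λ c → NB r c × holdsAt v φ (pr b) (pr c) r ≡ true

    BitsOK : ∀ φ → (Bits Φ → Bits φ) → Set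
    BitsOK (proc q _) pr = pr b ≡ does (p Finₚ.≟ q)
    BitsOK (lab l _)  pr = pr b ≡ does (a Finₚ.≟ l)
    BitsOK (mem _ X)  pr = pr b ≡ lookup sg X
    BitsOK (eq _ _)   pr = ⊤
    BitsOK (succ _ _) pr = ⊤
    BitsOK (msgR _ _) pr = ⊤
    BitsOK (le _ _)   pr = ⊤
    BitsOK (or φ ψ)   pr = BitsOK φ (λ c → proj₁ (pr c)) × BitsOK ψ (λ c → proj₂ (pr c))
    BitsOK (neg φ)    pr = BitsOK φ pr
    BitsOK (ex v φ)   pr = (proj₁ (pr b) ≡ true ⟺ Witness v φ (λ c → proj₂ (pr c))) × BitsOK φ (λ c → proj₂ (pr c))

    Witness? : ∀ v φ pr → Dec (Witness v φ pr)
    Witness? v φ pr = any? codeRel λ r → any? (codeBits Φ) λ c → NB? r c ×-dec (_ Boolₚ.≟ true)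

    BitsOK? : ∀ φ pr → Dec (BitsOK φ pr)
    BitsOK? (proc _ _) pr = _ Boolₚ.≟ _
    BitsOK? (lab _ _)  pr = _ Boolₚ.≟ _
    BitsOK? (mem _ _)  pr = _ Boolₚ.≟ _
    BitsOK? (eq _ _)   pr = yes tt
    BitsOK? (succ _ _) pr = yes tt
    BitsOK? (msgR _ _) pr = yes tt
    BitsOK? (le _ _)   pr = yes tt
    BitsOK? (or φ ψ)   pr = BitsOK? φ _ ×-dec BitsOK? ψ _
    BitsOK? (neg φ)    pr = BitsOK? φ pr
    BitsOK? (ex v φ)   pr =
      (((_ Boolₚ.≟ _) →-dec Witness? v φ _) ×-dec (Witness? v φ _ →-dec (_ Boolₚ.≟ _))) ×-dec BitsOK? φ _

-- Truth of subformulas at events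

module Semantics {n k : ℕ} (M : MSC n k) {nX : ℕ} (σ : Fin nX → Ev (MSC.w M) → Bool) where
  open MSC M using (w; msg)
  open FromMSC M
  open ChartBasics chart
  open Relations chart

  val : Ev w → Ev w → Var → Maybe (Ev w)
  val e f vx = just e
  val e f vy = just f

  Agree : FO2 n k nX → (Var → Maybe (Ev w)) → (Var → Maybe (Ev w)) → Set
  Agree φ ν ν′ = ∀ v → free v φ ≡ true → ν v ≡ ν′ v

  ==-refl : ∀ u → (u ==ᵥ u) ≡ true
  ==-refl vx = refl
  ==-refl vy = refl

  sat-cong : ∀ φ ν ν′ → Agree φ ν ν′ → sat M σ ν φ → sat M σ ν′ φ
  sat-cong₁ : ∀ (P : Ev w → Set) (ν ν′ : Var → Maybe (Ev w)) u → (∀ v → (v ==ᵥ u) ≡ true → ν v ≡ ν′ v) →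
              atom1 M (ν u) P → atom1 M (ν′ u) P
  sat-cong₁ P ν ν′ u ag = subst (λ m → atom1 M m P) (ag u (==-refl u))
  sat-cong₂ : ∀ (R : Ev w → Ev w → Set) (ν ν′ : Var → Maybe (Ev w)) u u′ → (∀ v → ((v ==ᵥ u) ∨ (v ==ᵥ u′)) ≡ true → ν v ≡ ν′ v) →
              atom2 M (ν u) (ν u′) R → atom2 M (ν′ u) (ν′ u′) R
  sat-cong₂ R ν ν′ u u′ ag = subst₂ (λ m m′ → atom2 M m m′ R)
    (ag u (cong (_∨ (u ==ᵥ u′)) (==-refl u)))
    (ag u′ (trans (cong ((u′ ==ᵥ u) ∨_) (==-refl u′)) (Boolₚ.∨-zeroʳ (u′ ==ᵥ u))))
  sat-cong (proc p u) ν ν′ ag = sat-cong₁ (λ e → proj₁ e ≡ p) ν ν′ u ag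
  sat-cong (lab a u)  ν ν′ ag = sat-cong₁ (λ e → label M e ≡ a) ν ν′ u ag
  sat-cong (mem u X)  ν ν′ ag = sat-cong₁ (λ e → σ X e ≡ true) ν ν′ u ag
  sat-cong (eq u v)   ν ν′ ag = sat-cong₂ _≡_ ν ν′ u v ag
  sat-cong (succ u v) ν ν′ ag = sat-cong₂ (PSucc w) ν ν′ u v ag
  sat-cong (msgR u v) ν ν′ ag = sat-cong₂ (λ e f → msg e f ≡ true) ν ν′ u v ag
  sat-cong (le u v)   ν ν′ ag = sat-cong₂ (_≤ₘ_ M) ν ν′ u v ag
  sat-cong (or φ ψ) ν ν′ ag (inj₁ s) = inj₁ (sat-cong φ ν ν′ (λ v q → ag v (cong (_∨ free v ψ) q)) s)
  sat-cong (or φ ψ) ν ν′ ag (inj₂ s) = inj₂ (sat-cong ψ ν ν′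
    (λ v q → ag v (trans (cong (free v φ ∨_) q) (Boolₚ.∨-zeroʳ (free v φ)))) s)
  sat-cong (neg φ) ν ν′ ag s t = s (sat-cong φ ν′ ν (λ v q → sym (ag v q)) t)
  sat-cong (ex u φ) ν ν′ ag (e , s) = e , sat-cong φ _ _ (ag′ u ag) s
    where
    ag′ : ∀ u → Agree (ex u φ) ν ν′ → Agree φ (upd M ν u e) (upd M ν′ u e)
    ag′ vx ag vx q = refl
    ag′ vx ag vy q = ag vy q
    ag′ vy ag vx q = ag vx q
    ag′ vy ag vy q = refl

  atom1? : ∀ m {P : Ev w → Set} → (∀ e → Dec (P e)) → Dec (atom1 M m P)
  atom1? nothing  P? = no λ ()
  atom1? (just e) P? = P? e

  atom2? : ∀ m m′ {R : Ev w → Ev w → Set} → (∀ e f → Dec (R e f)) → Dec (atom2 M m m′ R)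
  atom2? nothing  _        R? = no λ ()
  atom2? (just e) nothing  R? = no λ ()
  atom2? (just e) (just f) R? = R? e f

  sat? : ∀ ν φ → Dec (sat M σ ν φ)
  sat? ν (proc p u) = atom1? (ν u) (λ e → proj₁ e Finₚ.≟ p)
  sat? ν (lab a u)  = atom1? (ν u) (λ e → label M e Finₚ.≟ a)
  sat? ν (mem u X)  = atom1? (ν u) (λ e → σ X e Boolₚ.≟ true)
  sat? ν (eq u v)   = atom2? (ν u) (ν v) _≟E_
  sat? ν (succ u v) = atom2? (ν u) (ν v) (λ e f → (_ Finₚ.≟ _) ×-dec (_ ≟ _))
  sat? ν (msgR u v) = atom2? (ν u) (ν v) (λ e f → msg e f Boolₚ.≟ true)
  sat? ν (le u v)   = atom2? (ν u) (ν v) (λ e f → map′ ⊑⇒≤ₘ ≤ₘ⇒⊑ (e ⊑? f))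
  sat? ν (or φ ψ)   = sat? ν φ ⊎-dec sat? ν ψ
  sat? ν (neg φ)    = ¬? (sat? ν φ)
  sat? ν (ex u φ)   = someE? λ e → sat? (upd M ν u e) φ

  val-upd : ∀ v φ e f → sat M σ (upd M (val e e) v f) φ ⟺ sat M σ (choose v (val f e) (val e f)) φ
  val-upd v φ e f = sat-cong φ _ _ (λ u _ → agree v u) , sat-cong φ _ _ (λ u _ → sym (agree v u))
    where
    agree : ∀ v u → upd M (val e e) v f u ≡ choose v (val f e) (val e f) u
    agree vx vx = refl
    agree vx vy = refl
    agree vy vx = refl
    agree vy vy = refl

  module _ {Φ : FO2 n k nX} (T : Ev w → Bits Φ) where

    Correct : ∀ φ → (Bits Φ → Bits φ) → Set
    Correct (proc q _) pr = ∀ e → pr (T e) ≡ does (proj₁ e Finₚ.≟ q)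
    Correct (lab l _)  pr = ∀ e → pr (T e) ≡ does (label M e Finₚ.≟ l)
    Correct (mem _ X)  pr = ∀ e → pr (T e) ≡ σ X e
    Correct (eq _ _)   pr = ⊤
    Correct (succ _ _) pr = ⊤
    Correct (msgR _ _) pr = ⊤
    Correct (le _ _)   pr = ⊤
    Correct (or φ ψ)   pr = Correct φ (λ c → proj₁ (pr c)) × Correct ψ (λ c → proj₂ (pr c))
    Correct (neg φ)    pr = Correct φ pr
    Correct (ex v φ)   pr = (∀ e → proj₁ (pr (T e)) ≡ true ⟺ sat M σ (val e e) (ex v φ)) × Correct φ (λ c → proj₂ (pr c))

    holds-sat : ∀ φ pr → Correct φ pr → ∀ r {e f} → Holds r e f →
                sat M σ (val e f) φ ⟺ holds φ (pr (T e)) (pr (T f)) r ≡ true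
    holds-sat (proc q vx) pr ok r {e} h =
      (λ s → trans (ok e) (of-true (_ Finₚ.≟ q) s)) , (λ t → true-of (_ Finₚ.≟ q) (trans (sym (ok e)) t))
    holds-sat (proc q vy) pr ok r {e} {f} h =
      (λ s → trans (ok f) (of-true (_ Finₚ.≟ q) s)) , (λ t → true-of (_ Finₚ.≟ q) (trans (sym (ok f)) t))
    holds-sat (lab l vx) pr ok r {e} h =
      (λ s → trans (ok e) (of-true (_ Finₚ.≟ l) s)) , (λ t → true-of (_ Finₚ.≟ l) (trans (sym (ok e)) t))
    holds-sat (lab l vy) pr ok r {e} {f} h =
      (λ s → trans (ok f) (of-true (_ Finₚ.≟ l) s)) , (λ t → true-of (_ Finₚ.≟ l) (trans (sym (ok f)) t))
    holds-sat (mem vx X) pr ok r {e} h = (λ s → trans (ok e) s) , (λ t → trans (sym (ok e)) t)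
    holds-sat (mem vy X) pr ok r {e} {f} h = (λ s → trans (ok f) s) , (λ t → trans (sym (ok f)) t)
    holds-sat (eq vx vx) pr ok r h = (λ _ → refl) , (λ _ → refl)
    holds-sat (eq vy vy) pr ok r h = (λ _ → refl) , (λ _ → refl)
    holds-sat (eq vx vy) pr ok r h = same-table r h
    holds-sat (eq vy vx) pr ok r h = same-table (flipR r) (holds-flip r h)
    holds-sat (succ vx vx) pr ok r h = (λ s → ⊥-elim (<-irrefl (sym (proj₂ s)) ≤-refl)) , λ ()
    holds-sat (succ vy vy) pr ok r h = (λ s → ⊥-elim (<-irrefl (sym (proj₂ s)) ≤-refl)) , λ ()
    holds-sat (succ vx vy) pr ok r h =
      (λ s → proj₁ (suc-table r h) (psucc⇒next s)) , (λ t → next⇒psucc (proj₂ (suc-table r h) t))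
    holds-sat (succ vy vx) pr ok r h =
      (λ s → proj₁ (suc-table (flipR r) (holds-flip r h)) (psucc⇒next s)) ,
      (λ t → next⇒psucc (proj₂ (suc-table (flipR r) (holds-flip r h)) t))
    holds-sat (msgR vx vx) pr ok r h = (λ s → ⊥-elim (MSC.msg-diff M _ _ s refl)) , λ ()
    holds-sat (msgR vy vy) pr ok r h = (λ s → ⊥-elim (MSC.msg-diff M _ _ s refl)) , λ ()
    holds-sat (msgR vx vy) pr ok r h =
      (λ s → proj₁ (snd-table r h) (msg⇒receiver s)) , (λ t → receiver⇒msg (proj₂ (snd-table r h) t))
    holds-sat (msgR vy vx) pr ok r h =
      (λ s → proj₁ (snd-table (flipR r) (holds-flip r h)) (msg⇒receiver s)) ,
      (λ t → receiver⇒msg (proj₂ (snd-table (flipR r) (holds-flip r h)) t))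
    holds-sat (le vx vx) pr ok r h = (λ _ → refl) , (λ _ → ε)
    holds-sat (le vy vy) pr ok r h = (λ _ → refl) , (λ _ → ε)
    holds-sat (le vx vy) pr ok r h =
      (λ s → proj₁ (le-table r h) (≤ₘ⇒⊑ s)) , (λ t → ⊑⇒≤ₘ (proj₂ (le-table r h) t))
    holds-sat (le vy vx) pr ok r h =
      (λ s → proj₁ (le-table (flipR r) (holds-flip r h)) (≤ₘ⇒⊑ s)) ,
      (λ t → ⊑⇒≤ₘ (proj₂ (le-table (flipR r) (holds-flip r h)) t))
    holds-sat (or φ ψ) pr (okφ , okψ) r {e} {f} h = to , from
      where
      b = pr (T e)
      c = pr (T f)
      ihφ = holds-sat φ (λ z → proj₁ (pr z)) okφ r h
      ihψ = holds-sat ψ (λ z → proj₂ (pr z)) okψ r h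
      to : _ → (holds φ (proj₁ b) (proj₁ c) r ∨ holds ψ (proj₂ b) (proj₂ c) r) ≡ true
      to (inj₁ s) = cong (_∨ holds ψ (proj₂ b) (proj₂ c) r) (proj₁ ihφ s)
      to (inj₂ s) = trans (cong (holds φ (proj₁ b) (proj₁ c) r ∨_) (proj₁ ihψ s)) (Boolₚ.∨-zeroʳ _)
      from : (holds φ (proj₁ b) (proj₁ c) r ∨ holds ψ (proj₂ b) (proj₂ c) r) ≡ true → _
      from t with holds φ (proj₁ b) (proj₁ c) r in q
      ... | true  = inj₁ (proj₂ ihφ q)
      ... | false = inj₂ (proj₂ ihψ t)
    holds-sat (neg φ) pr ok r {e} {f} h = to , from
      where
      ih = holds-sat φ pr ok r h
      to : ¬ sat M σ (val e f) φ → not (holds φ (pr (T e)) (pr (T f)) r) ≡ true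
      to s with holds φ (pr (T e)) (pr (T f)) r in q
      ... | true  = ⊥-elim (s (proj₂ ih q))
      ... | false = refl
      from : not (holds φ (pr (T e)) (pr (T f)) r) ≡ true → ¬ sat M σ (val e f) φ
      from t s rewrite proj₁ ih s with () ← t
    holds-sat (ex vx φ) pr (ok , _) r {e} {f} h =
      (λ s → proj₂ (ok f) (sat-cong (ex vx φ) (val e f) (val f f) (λ { vx () ; vy _ → refl }) s)) ,
      (λ t → sat-cong (ex vx φ) (val f f) (val e f) (λ { vx () ; vy _ → refl }) (proj₁ (ok f) t))
    holds-sat (ex vy φ) pr (ok , _) r {e} {f} h =
      (λ s → proj₂ (ok e) (sat-cong (ex vy φ) (val e f) (val e e) (λ { vy () ; vx _ → refl }) s)) ,
      (λ t → sat-cong (ex vy φ) (val e e) (val e f) (λ { vy () ; vx _ → refl }) (proj₁ (ok e) t))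

    module _ (sg : Ev w → Vec Bool nX) (sg-ok : ∀ e X → lookup (sg e) X ≡ σ X e)
             (NB : Ev w → Rel → Bits Φ → Set) (NB? : ∀ e r c → Dec (NB e r c))
             (NB-ok : ∀ e r c → NB e r c ⟺ Σ (Ev w) λ f → T f ≡ c × Holds r e f) where

      open module LB e = LocalBits {Φ = Φ} (proj₁ e) (label M e) (sg e) (T e) (NB e) (NB? e) using (BitsOK; Witness)

      witness-sat : ∀ v φ pr → Correct φ pr → ∀ e → Witness e v φ pr ⟺ sat M σ (val e e) (ex v φ)
      witness-sat vy φ pr ok e = to , from
        where
        to : Witness e vy φ pr → _
        to (r , c , nb , t) with proj₁ (NB-ok e r c) nb
        ... | f , refl , h = f , proj₂ (val-upd vy φ e f) (proj₂ (holds-sat φ pr ok r h) t)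
        from : sat M σ (val e e) (ex vy φ) → Witness e vy φ pr
        from (f , s) with holds-some e f
        ... | r , h = r , T f , proj₂ (NB-ok e r (T f)) (f , refl , h) ,
                      proj₁ (holds-sat φ pr ok r h) (proj₁ (val-upd vy φ e f) s)
      witness-sat vx φ pr ok e = to , from
        where
        to : Witness e vx φ pr → _
        to (r , c , nb , t) with proj₁ (NB-ok e r c) nb
        ... | f , refl , h = f , proj₂ (val-upd vx φ e f) (proj₂ (holds-sat φ pr ok (flipR r) (holds-flip r h)) t)
        from : sat M σ (val e e) (ex vx φ) → Witness e vx φ pr
        from (f , s) with holds-some e f
        ... | r , h = r , T f , proj₂ (NB-ok e r (T f)) (f , refl , h) ,
                      proj₁ (holds-sat φ pr ok (flipR r) (holds-flip r h)) (proj₁ (val-upd vx φ e f) s)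

      -- By `NB-ok`, neighbourhoods are exact for whatever types were guessed, so there is no
      -- circularity: the bits of `φ` are correct by induction, and the test at `ex v φ` then
      -- evaluates `φ` with them.
      bits⇒correct : ∀ φ pr → (∀ e → BitsOK e φ pr) → Correct φ pr
      bits⇒correct (proc _ _) pr ok = ok
      bits⇒correct (lab _ _)  pr ok = ok
      bits⇒correct (mem _ X)  pr ok = λ e → trans (ok e) (sg-ok e X)
      bits⇒correct (eq _ _)   pr ok = tt
      bits⇒correct (succ _ _) pr ok = tt
      bits⇒correct (msgR _ _) pr ok = tt
      bits⇒correct (le _ _)   pr ok = tt
      bits⇒correct (or φ ψ)   pr ok = bits⇒correct φ _ (λ e → proj₁ (ok e)) , bits⇒correct ψ _ (λ e → proj₂ (ok e))
      bits⇒correct (neg φ)    pr ok = bits⇒correct φ pr ok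
      bits⇒correct (ex v φ)   pr ok = (λ e →
          (λ t → proj₁ (witness-sat v φ _ ih e) (proj₁ (proj₁ (ok e)) t)) ,
          (λ s → proj₂ (proj₁ (ok e)) (proj₂ (witness-sat v φ _ ih e) s))) , ih
        where
        ih = bits⇒correct φ (λ c → proj₂ (pr c)) (λ e → proj₂ (ok e))

      correct⇒bits : ∀ φ pr → Correct φ pr → ∀ e → BitsOK e φ pr
      correct⇒bits (proc _ _) pr ok e = ok e
      correct⇒bits (lab _ _)  pr ok e = ok e
      correct⇒bits (mem _ X)  pr ok e = trans (ok e) (sym (sg-ok e X))
      correct⇒bits (eq _ _)   pr ok e = tt
      correct⇒bits (succ _ _) pr ok e = tt
      correct⇒bits (msgR _ _) pr ok e = tt
      correct⇒bits (le _ _)   pr ok e = tt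
      correct⇒bits (or φ ψ)   pr (a , b) e = correct⇒bits φ _ a e , correct⇒bits ψ _ b e
      correct⇒bits (neg φ)    pr ok e = correct⇒bits φ pr ok e
      correct⇒bits (ex v φ)   pr (ok , ih) e =
        ((λ t → proj₂ (witness-sat v φ _ ih e) (proj₁ (ok e) t)) ,
         (λ x → proj₂ (ok e) (proj₁ (witness-sat v φ _ ih e) x))) , correct⇒bits φ _ ih e

  trueBits : ∀ φ → Ev w → Bits φ
  trueBits (proc q _) e = does (proj₁ e Finₚ.≟ q)
  trueBits (lab l _)  e = does (label M e Finₚ.≟ l)
  trueBits (mem _ X)  e = σ X e
  trueBits (eq _ _)   e = tt
  trueBits (succ _ _) e = tt
  trueBits (msgR _ _) e = tt
  trueBits (le _ _)   e = tt
  trueBits (or φ ψ)   e = trueBits φ e , trueBits ψ e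
  trueBits (neg φ)    e = trueBits φ e
  trueBits (ex v φ)   e = does (sat? (val e e) (ex v φ)) , trueBits φ e

  trueBits-correct : ∀ {Φ : FO2 n k nX} φ (pr : Bits Φ → Bits φ) → (∀ e → pr (trueBits Φ e) ≡ trueBits φ e) → Correct {Φ} (trueBits Φ) φ pr
  trueBits-correct (proc _ _) pr h = h
  trueBits-correct (lab _ _)  pr h = h
  trueBits-correct (mem _ _)  pr h = h
  trueBits-correct (eq _ _)   pr h = tt
  trueBits-correct (succ _ _) pr h = tt
  trueBits-correct (msgR _ _) pr h = tt
  trueBits-correct (le _ _)   pr h = tt
  trueBits-correct (or φ ψ)   pr h = trueBits-correct φ _ (λ e → cong proj₁ (h e)) , trueBits-correct ψ _ (λ e → cong proj₂ (h e))
  trueBits-correct (neg φ)    pr h = trueBits-correct φ pr h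
  trueBits-correct (ex v φ)   pr h = (λ e →
    (λ t → true-of (sat? (val e e) (ex v φ)) (trans (sym (cong proj₁ (h e))) t)) ,
    (λ s → trans (cong proj₁ (h e)) (of-true (sat? (val e e) (ex v φ)) s))) ,
    trueBits-correct φ _ (λ e → cong proj₂ (h e))

-- Tilings and automata

record Tiling (n k : ℕ) : Set₁ where
  field
    Tile  : Set
    bits  : ℕ
    code  : Code Tile bits
    local : Fin n → Fin k → Tile → (prev next : Maybe Tile) (sender receiver : Maybe (Fin n × Tile)) → Bool
    final : Vec (Maybe Tile) n → Bool

module _ {n k : ℕ} (T : Tiling n k) where
  open Tiling T

  module _ (M : MSC n k) where
    open FromMSC M
    open Chart chart using (E; prev; next; sender; receiver)

    located : (E → Tile) → E → Fin n × Tile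
    located t e = proj₁ e , t e

    LocallyOK : (E → Tile) → Set
    LocallyOK t = ∀ e → local (proj₁ e) (label M e) (t e) (Maybe.map t (prev e)) (Maybe.map t (next e))
                          (Maybe.map (located t) (sender e)) (Maybe.map (located t) (receiver e)) ≡ true

    Tiled : Set
    Tiled = Σ (E → Tile) λ t → LocallyOK t × final (tabulate λ p → Maybe.map t (lastEvent p)) ≡ true

  -- Besides the current tile, a state guesses the next tile of its process, and a message carries the
  -- tiles of both of its ends.
  State : Set
  State = Maybe (Tile × Maybe Tile)

  stateBits : ℕ
  stateBits = suc (bits + suc bits)

  codeState : Code State stateBits
  codeState = codeMaybe (code× code (codeMaybe code))

  codeMsg : Code (Tile × Tile) (bits + bits)
  codeMsg = code× code code

  encS : State → Fin (2 ^ stateBits)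
  encS s = bitsToFin (Code.enc codeState s)

  decS : Fin (2 ^ stateBits) → State
  decS i = Code.dec codeState (finToBits stateBits i)

  decS-encS : ∀ s → decS (encS s) ≡ s
  decS-encS s = trans (cong (Code.dec codeState) (finToBits-bitsToFin (Code.enc codeState s))) (Code.dec-enc codeState s)

  encM : Tile × Tile → Fin (2 ^ (bits + bits))
  encM m = bitsToFin (Code.enc codeMsg m)

  decM : Fin (2 ^ (bits + bits)) → Tile × Tile
  decM i = Code.dec codeMsg (finToBits (bits + bits) i)

  decM-encM : ∀ m → decM (encM m) ≡ m
  decM-encM m = trans (cong (Code.dec codeMsg) (finToBits-bitsToFin (Code.enc codeMsg m))) (Code.dec-enc codeMsg m)

  Action : Set
  Action = Act n k (2 ^ (bits + bits))

  Linked : State → Tile → Set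
  Linked nothing         me = ⊤
  Linked (just (_ , nx)) me = nx ≡ just me

  -- Each end of a message verifies only its own component. Both ends use the same message, so what
  -- one end merely guesses about its partner is verified by the partner.
  ActOK : Fin n → Action → Tile → Set
  ActOK p (int _)     me = ⊤
  ActOK p (snd _ m q) me = q ≢ p × proj₁ (decM m) ≡ me
  ActOK p (rcv _ m q) me = q ≢ p × proj₂ (decM m) ≡ me

  senderOf receiverOf : Action → Maybe (Fin n × Tile)
  senderOf (rcv _ m q) = just (q , proj₁ (decM m))
  senderOf (int _)     = nothing
  senderOf (snd _ _ _) = nothing
  receiverOf (snd _ m q) = just (q , proj₂ (decM m))
  receiverOf (int _)     = nothing
  receiverOf (rcv _ _ _) = nothing

  Allowed : Fin n → State → Action → State → Set
  Allowed p s a nothing          = ⊥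
  Allowed p s a (just (me , nx)) = Linked s me × ActOK p a me ×
    local p (actLabel a) me (Maybe.map proj₁ s) nx (senderOf a) (receiverOf a) ≡ true

  allowed? : ∀ p s a s′ → Dec (Allowed p s a s′)
  allowed? p s a nothing          = no λ ()
  allowed? p s a (just (me , nx)) = linked? s ×-dec actOK? a ×-dec (_ Boolₚ.≟ true)
    where
    linked? : ∀ s → Dec (Linked s me)
    linked? nothing         = yes tt
    linked? (just (_ , nx)) = Maybeₚ.≡-dec (codeEq code) nx (just me)
    actOK? : ∀ a → Dec (ActOK p a me)
    actOK? (int _)     = yes tt
    actOK? (snd _ m q) = ¬? (q Finₚ.≟ p) ×-dec codeEq code _ me
    actOK? (rcv _ m q) = ¬? (q Finₚ.≟ p) ×-dec codeEq code _ me

  Stopped : State → Set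
  Stopped nothing         = ⊤
  Stopped (just (_ , nx)) = nx ≡ nothing

  stopped? : ∀ s → Dec (Stopped s)
  stopped? nothing         = yes tt
  stopped? (just (_ , nx)) = Maybeₚ.≡-dec (codeEq code) nx nothing

  Accepting : (Fin n → Fin (2 ^ stateBits)) → Set
  Accepting fs = (∀ p → Stopped (decS (fs p))) × final (tabulate λ p → Maybe.map proj₁ (decS (fs p))) ≡ true

  accepting? : ∀ fs → Dec (Accepting fs)
  accepting? fs = Finₚ.all? (λ p → stopped? (decS (fs p))) ×-dec (_ Boolₚ.≟ true)

  automaton : CFM n k
  automaton = record
    { nMsg    = 2 ^ (bits + bits)
    ; nStates = λ _ → 2 ^ stateBits
    ; init    = λ _ → encS nothing
    ; Δ       = λ p s a s′ → does (allowed? p (decS s) a (decS s′))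
    ; Δ-wf    = λ p s a s′ t → wellFormed p (decS s) a (decS s′) (true-of (allowed? p (decS s) a (decS s′)) t)
    ; Acc     = λ fs → does (accepting? fs) }
    where
    wellFormed : ∀ p s a s′ → Allowed p s a s′ → InAct p a
    wellFormed p s (int _)     (just _) _                 = tt
    wellFormed p s (snd _ _ _) (just _) (_ , (ne , _) , _) = ne
    wellFormed p s (rcv _ _ _) (just _) (_ , (ne , _) , _) = ne

  lastState-cases : ∀ {p} ℓ (r : Fin ℓ → Trans automaton p) s →
    (ℓ ≡ 0 × lastState automaton {p} ℓ r s ≡ s) ⊎
    Σ (Fin ℓ) λ i → suc (toℕ i) ≡ ℓ × lastState automaton {p} ℓ r s ≡ tgt automaton {p} (r i)
  lastState-cases zero    r s = inj₁ (refl , refl)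
  lastState-cases (suc ℓ) r s = inj₂ (fromℕ ℓ , cong suc (Finₚ.toℕ-fromℕ ℓ) , refl)

  module _ (M : MSC n k) where
    open MSC M using (w; msg)
    open FromMSC M
    open ChartBasics chart

    lastEvent-none : ∀ {p} → size-of p ≡ 0 → lastEvent p ≡ nothing
    lastEvent-none {p} z = cong (before p) z

    lastEvent-some : ∀ {p} i → suc (toℕ i) ≡ size-of p → lastEvent p ≡ just (p , i)
    lastEvent-some {p} i z = trans (cong (before p) (sym z)) (event-self (p , i))

    next-end : ∀ {p} i → suc (toℕ i) ≡ size-of p → nextᴹ (p , i) ≡ nothing
    next-end {p} i z with nextᴹ (p , i) in q
    ... | nothing = refl
    ... | just f with next⇒psucc {p , i} {f} q
    ...   | refl , s = ⊥-elim (<-irrefl (trans (sym s) z) (Finₚ.toℕ<n (proj₂ f)))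

    module ToRun (t : Ev w → Tile) (ok : LocallyOK M t)
                 (fin : final (tabulate λ p → Maybe.map t (lastEvent p)) ≡ true) where

      stateBefore stateAfter : Ev w → State
      stateBefore e = Maybe.map (λ g → t g , just (t e)) (prevᴹ e)
      stateAfter e  = just (t e , Maybe.map t (nextᴹ e))

      action : Fin k → Tile → Maybe (Ev w) → Maybe (Ev w) → Action
      -- No event both receives and sends (`one-msg`), so the precedence of this clause decides
      -- nothing.
      action a x sd        (just f) = snd a (encM (x , t f)) (proj₁ f)
      action a x (just h)  nothing  = rcv a (encM (t h , x)) (proj₁ h)
      action a x nothing   nothing  = int a

      actionOf : Ev w → Action
      actionOf e = action (label M e) (t e) (senderᴹ e) (receiverᴹ e)

      action-label : ∀ a x sd rc → actLabel (action a x sd rc) ≡ a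
      action-label a x sd       (just f) = refl
      action-label a x (just h) nothing  = refl
      action-label a x nothing  nothing  = refl

      allowed : ∀ e → Allowed (proj₁ e) (stateBefore e) (actionOf e) (stateAfter e)
      allowed e = linked (prevᴹ e) , actOK (senderᴹ e) (receiverᴹ e) refl refl ,
        trans (cong₂ (λ a pv → local (proj₁ e) a (t e) pv (Maybe.map t (nextᴹ e)) (senderOf (actionOf e)) (receiverOf (actionOf e)))
                 (action-label (label M e) (t e) (senderᴹ e) (receiverᴹ e)) (before-tile (prevᴹ e)))
          (trans (cong₂ (local (proj₁ e) (label M e) (t e) (Maybe.map t (prevᴹ e)) (Maybe.map t (nextᴹ e)))
                   (sender-tile (senderᴹ e) (receiverᴹ e) refl refl) (receiver-tile (senderᴹ e) (receiverᴹ e)))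
            (ok e))
        where
        linked : ∀ m → Linked (Maybe.map (λ g → t g , just (t e)) m) (t e)
        linked nothing  = tt
        linked (just g) = refl
        before-tile : ∀ m → Maybe.map proj₁ (Maybe.map (λ g → t g , just (t e)) m) ≡ Maybe.map t m
        before-tile nothing  = refl
        before-tile (just g) = refl
        actOK : ∀ sd rc → senderᴹ e ≡ sd → receiverᴹ e ≡ rc → ActOK (proj₁ e) (action (label M e) (t e) sd rc) (t e)
        actOK sd (just f) _ r = (λ q → msg-site (receiver-sender r) (sym q)) , cong proj₁ (decM-encM _)
        actOK (just h) nothing s _ = msg-site s , cong proj₂ (decM-encM _)
        actOK nothing  nothing _ _ = tt
        sender-tile : ∀ sd rc → senderᴹ e ≡ sd → receiverᴹ e ≡ rc →
          senderOf (action (label M e) (t e) sd rc) ≡ Maybe.map (located M t) sd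
        sender-tile (just h) (just f) s r = ⊥-elim (one-msg s r)
        sender-tile nothing  (just f) s r = refl
        sender-tile (just h) nothing  s r = cong (λ m → just (proj₁ h , proj₁ m)) (decM-encM _)
        sender-tile nothing  nothing  s r = refl
        receiver-tile : ∀ sd rc → receiverOf (action (label M e) (t e) sd rc) ≡ Maybe.map (located M t) rc
        receiver-tile sd       (just f) = cong (λ m → just (proj₁ f , proj₂ m)) (decM-encM _)
        receiver-tile (just h) nothing  = refl
        receiver-tile nothing  nothing  = refl

      run : Run automaton M
      run = record
        { ρ        = λ p i → encS (stateBefore (p , i)) , actionOf (p , i) , encS (stateAfter (p , i))
        ; inΔ      = λ p i → of-true (allowed? _ _ _ _)
                       (subst₂ (λ s s′ → Allowed p s (actionOf (p , i)) s′) (sym (decS-encS _)) (sym (decS-encS _)) (allowed (p , i)))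
        ; lab      = λ p i → action-label (label M (p , i)) (t (p , i)) (senderᴹ (p , i)) (receiverᴹ (p , i))
        ; first    = λ p i z → cong encS (cong (Maybe.map _) (cong (before p) z))
        ; chain    = λ p i j z → cong encS (trans
                       (cong (λ m → just (t (p , i) , Maybe.map t m)) (psucc⇒next {p , i} {p , j} (refl , z)))
                       (sym (cong (Maybe.map (λ g → t g , just (t (p , j)))) (psucc⇒prev {p , i} {p , j} (refl , z)))))
        ; internal = λ e i → subst₂ (λ sd rc → IsInt (action (label M e) (t e) sd rc))
                       (sym (none-sent e i)) (sym (none-received e i)) tt
        ; message  = λ e f m → encM (t e , t f) ,
                       subst (λ rc → IsSnd (action (label M e) (t e) (senderᴹ e) rc) (encM (t e , t f)) (proj₁ f))
                         (sym (msg⇒receiver m)) (refl , refl) ,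
                       subst₂ (λ sd rc → IsRcv (action (label M f) (t f) sd rc) (encM (t e , t f)) (proj₁ e))
                         (sym (msg⇒sender m)) (sym (no-receiver (msg⇒sender m))) (refl , refl) }
        where
        none-sent : ∀ e → Internal M e → senderᴹ e ≡ nothing
        none-sent e i with senderᴹ e in q
        ... | nothing = refl
        ... | just h with () ← trans (sym (sender⇒msg q)) (proj₂ (i h))
        none-received : ∀ e → Internal M e → receiverᴹ e ≡ nothing
        none-received e i with receiverᴹ e in q
        ... | nothing = refl
        ... | just h with () ← trans (sym (receiver⇒msg q)) (proj₁ (i h))
        no-receiver : ∀ {e f} → senderᴹ f ≡ just e → receiverᴹ f ≡ nothing
        no-receiver {e} {f} s with receiverᴹ f in r
        ... | nothing = refl
        ... | just g = ⊥-elim (one-msg s r)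

      end-state : ∀ p → Stopped (decS (Run.finalStates run p)) ×
                        Maybe.map proj₁ (decS (Run.finalStates run p)) ≡ Maybe.map t (lastEvent p)
      end-state p with lastState-cases (size-of p) (Run.ρ run p) (encS nothing)
      ... | inj₁ (z , q) = subst Stopped (sym d) tt ,
                           trans (cong (Maybe.map proj₁) d) (sym (cong (Maybe.map t) (lastEvent-none z)))
        where
        d : decS (Run.finalStates run p) ≡ nothing
        d = trans (cong decS q) (decS-encS nothing)
      ... | inj₂ (i , z , q) = subst Stopped (sym d) (cong (Maybe.map t) (next-end i z)) ,
                               trans (cong (Maybe.map proj₁) d) (sym (cong (Maybe.map t) (lastEvent-some i z)))
        where
        d : decS (Run.finalStates run p) ≡ stateAfter (p , i)
        d = trans (cong decS q) (decS-encS (stateAfter (p , i)))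

      accepts : Accepts automaton M
      accepts = run , of-true (accepting? (Run.finalStates run)) ((λ p → proj₁ (end-state p)) ,
        trans (cong final (Vecₚ.tabulate-cong (λ p → proj₂ (end-state p)))) fin)

    module FromRun (r : Run automaton M) (end : CFM.Acc automaton (Run.finalStates r) ≡ true) where
      open Run r renaming (lab to run-label)

      step : ∀ e → Trans automaton (proj₁ e)
      step (p , i) = ρ p i

      source target : Ev w → State
      source e = decS (proj₁ (step e))
      target e = decS (proj₂ (proj₂ (step e)))

      actionOf : Ev w → Action
      actionOf e = proj₁ (proj₂ (step e))

      permitted : ∀ e → Allowed (proj₁ e) (source e) (actionOf e) (target e)
      permitted (p , i) = true-of (allowed? p _ _ _) (inΔ p i)

      guess : ∀ e → Σ (Tile × Maybe Tile) λ s → target e ≡ just s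
      guess e with target e | permitted e
      ... | just s | _ = s , refl

      t : Ev w → Tile
      t e = proj₁ (proj₁ (guess e))

      nx : Ev w → Maybe Tile
      nx e = proj₂ (proj₁ (guess e))

      checked : ∀ e → Linked (source e) (t e) × ActOK (proj₁ e) (actionOf e) (t e) ×
        local (proj₁ e) (actLabel (actionOf e)) (t e) (Maybe.map proj₁ (source e)) (nx e)
          (senderOf (actionOf e)) (receiverOf (actionOf e)) ≡ true
      checked e = subst (Allowed (proj₁ e) (source e) (actionOf e)) (proj₂ (guess e)) (permitted e)

      linked : ∀ {e g} → prevᴹ e ≡ just g → source e ≡ just (t g , nx g)
      linked {p , i} {g} q with prev⇒psucc {g} {p , i} q
      ... | refl , s = trans (cong decS (sym (chain p (proj₂ g) i s))) (proj₂ (guess g))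

      prev-tile : ∀ e → Maybe.map proj₁ (source e) ≡ Maybe.map t (prevᴹ e)
      prev-tile e@(p , i) with prevᴹ e in q
      ... | just g = cong (Maybe.map proj₁) (linked {e} q)
      ... | nothing = cong (Maybe.map proj₁) (trans (cong decS (first p i (prev-nothing {e} q))) (decS-encS nothing))

      accepting : Accepting finalStates
      accepting = true-of (accepting? finalStates) end

      end-state : ∀ p → maybe′ (λ e → decS (finalStates p) ≡ just (t e , nx e)) (decS (finalStates p) ≡ nothing) (lastEvent p)
      end-state p with lastState-cases (size-of p) (ρ p) (encS nothing)
      ... | inj₁ (z , q) = subst (maybe′ _ (decS (finalStates p) ≡ nothing)) (sym (lastEvent-none z))
                                 (trans (cong decS q) (decS-encS nothing))
      ... | inj₂ (i , z , q) = subst (maybe′ (λ e → decS (finalStates p) ≡ just (t e , nx e)) _) (sym (lastEvent-some i z))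
                                     (trans (cong decS q) (proj₂ (guess (p , i))))

      -- A guess is confirmed one event later by `Linked`, or by `Stopped` in the acceptance
      -- condition if there is no later event.
      next-tile : ∀ e → nx e ≡ Maybe.map t (nextᴹ e)
      next-tile e@(p , i) with nextᴹ e in q
      ... | just f = subst (λ s → Linked s (t f)) (linked {f} {e} (next⇒prev q)) (proj₁ (checked f))
      ... | nothing = subst Stopped at-end (proj₁ accepting p)
        where
        pos-last : suc (toℕ i) ≡ size-of p
        pos-last = trans (sym (+-comm (toℕ i) 1)) (trans (cong (λ z → toℕ i + suc z) (sym (next-nothing {e} q))) (pos+copos e))
        at-end : decS (finalStates p) ≡ just (t e , nx e)
        at-end = subst (maybe′ (λ e → decS (finalStates p) ≡ just (t e , nx e)) (decS (finalStates p) ≡ nothing))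
                 (lastEvent-some i pos-last) (end-state p)

      isSnd-inv : ∀ p a {m q x} → IsSnd a m q → ActOK p a x →
        senderOf a ≡ nothing × receiverOf a ≡ just (q , proj₂ (decM m)) × x ≡ proj₁ (decM m)
      isSnd-inv p (snd _ _ _) (refl , refl) (_ , z) = refl , refl , sym z

      isRcv-inv : ∀ p a {m q x} → IsRcv a m q → ActOK p a x →
        senderOf a ≡ just (q , proj₁ (decM m)) × receiverOf a ≡ nothing × x ≡ proj₂ (decM m)
      isRcv-inv p (rcv _ _ _) (refl , refl) (_ , z) = refl , refl , sym z

      isInt-inv : ∀ a → IsInt {n} {k} a → senderOf a ≡ nothing × receiverOf a ≡ nothing
      isInt-inv (int _) _ = refl , refl

      partner-tiles : ∀ e → senderOf (actionOf e) ≡ Maybe.map (located M t) (senderᴹ e) ×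
                            receiverOf (actionOf e) ≡ Maybe.map (located M t) (receiverᴹ e)
      partner-tiles e with senderᴹ e in s | receiverᴹ e in r
      ... | just h | just f = ⊥-elim (one-msg s r)
      ... | just h | nothing with message h e (sender⇒msg s)
      ...   | m , is , ir with isSnd-inv _ (actionOf h) is (proj₁ (proj₂ (checked h))) | isRcv-inv _ (actionOf e) ir (proj₁ (proj₂ (checked e)))
      ...     | _ , _ , x | a , b , _ = trans a (cong (λ z → just (proj₁ h , z)) (sym x)) , b
      partner-tiles e | nothing | just f with message e f (receiver⇒msg r)
      ...   | m , is , ir with isSnd-inv _ (actionOf e) is (proj₁ (proj₂ (checked e))) | isRcv-inv _ (actionOf f) ir (proj₁ (proj₂ (checked f)))
      ...     | a , b , _ | _ , _ , x = a , trans b (cong (λ z → just (proj₁ f , z)) (sym x))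
      partner-tiles e | nothing | nothing = isInt-inv (actionOf e) (internal e λ f → unsent f , unreceived f)
        where
        unsent : ∀ f → msg e f ≡ false
        unsent f with msg e f in q
        ... | false = refl
        ... | true with () ← trans (sym r) (msg⇒receiver q)
        unreceived : ∀ f → msg f e ≡ false
        unreceived f with msg f e in q
        ... | false = refl
        ... | true with () ← trans (sym s) (msg⇒sender q)

      locallyOK : LocallyOK M t
      locallyOK e = trans (sym (trans
          (cong₂ (λ a pv → local (proj₁ e) a (t e) pv (nx e) (senderOf (actionOf e)) (receiverOf (actionOf e)))
            (run-label (proj₁ e) (proj₂ e)) (prev-tile e))
          (trans (cong (λ z → local (proj₁ e) (label M e) (t e) (Maybe.map t (prevᴹ e)) z (senderOf (actionOf e)) (receiverOf (actionOf e))) (next-tile e))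
            (cong₂ (local (proj₁ e) (label M e) (t e) (Maybe.map t (prevᴹ e)) (Maybe.map t (nextᴹ e)))
              (proj₁ (partner-tiles e)) (proj₂ (partner-tiles e))))))
        (proj₂ (proj₂ (checked e)))

      tiled : Tiled M
      tiled = t , locallyOK , trans (cong final (Vecₚ.tabulate-cong λ p → last-tile p (lastEvent p) (end-state p))) (proj₂ accepting)
        where
        last-tile : ∀ p m → maybe′ (λ e → decS (finalStates p) ≡ just (t e , nx e)) (decS (finalStates p) ≡ nothing) m →
                    Maybe.map t m ≡ Maybe.map proj₁ (decS (finalStates p))
        last-tile p nothing  z = sym (cong (Maybe.map proj₁) z)
        last-tile p (just e) z = sym (cong (Maybe.map proj₁) z)

-- Views of events

-- The local conditions only depend on the view of an event, hence they are preserved and reflected by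
-- every map h between types of events.
module Natural {n : ℕ} {X Y : Set} (h : X → Y) (site : Y → Fin n) where

  h? : Maybe X → Maybe Y
  h? = Maybe.map h

  module _ (to : Y → Maybe (Fin n)) where
    module LX = LocalTab (λ x → site (h x)) (λ x → to (h x))
    module LY = LocalTab site to

    tab-natural : ∀ {V : X → Bool} {W : Y → Bool} → (∀ x → V x ≡ W (h x)) →
      ∀ {m} (ρ : Path n m) {tab tab′} → (∀ x → tab x ≡ tab′ (h x)) →
      ∀ x pv sd → LX.TabOK V ρ tab x pv sd ≡ LY.TabOK W ρ tab′ (h x) (h? pv) (h? sd)
    tab-natural v (_ ∷ [])        t x pv sd = refl
    tab-natural v (r ∷ ρ@(s ∷ _)) t x (just g) (just f)
      rewrite tab-natural v ρ (λ y → cong tail (t y)) x (just g) (just f) | v x | t x | t g | t f = refl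
    tab-natural v (r ∷ ρ@(s ∷ _)) t x (just g) nothing
      rewrite tab-natural v ρ (λ y → cong tail (t y)) x (just g) nothing | v x | t x | t g = refl
    tab-natural v (r ∷ ρ@(s ∷ _)) t x nothing (just f)
      rewrite tab-natural v ρ (λ y → cong tail (t y)) x nothing (just f) | v x | t x | t f = refl
    tab-natural v (r ∷ ρ@(s ∷ _)) t x nothing nothing
      rewrite tab-natural v ρ (λ y → cong tail (t y)) x nothing nothing | v x | t x = refl

    flag-natural : ∀ {base base′} → (∀ x → base x ≡ base′ (h x)) →
      ∀ {m} (ρ : Path n m) {tab tab′} → (∀ x → tab x ≡ tab′ (h x)) →
      ∀ x pv sd → LX.FlagOK base ρ tab x pv sd ≡ LY.FlagOK base′ ρ tab′ (h x) (h? pv) (h? sd)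
    flag-natural b (_ ∷ [])        t x pv sd rewrite b x | t x = refl
    flag-natural b (r ∷ ρ@(s ∷ _)) t x (just g) (just f)
      rewrite flag-natural b ρ (λ y → cong tail (t y)) x (just g) (just f) | t x | t g | t f = refl
    flag-natural b (r ∷ ρ@(s ∷ _)) t x (just g) nothing
      rewrite flag-natural b ρ (λ y → cong tail (t y)) x (just g) nothing | t x | t g = refl
    flag-natural b (r ∷ ρ@(s ∷ _)) t x nothing (just f)
      rewrite flag-natural b ρ (λ y → cong tail (t y)) x nothing (just f) | t x | t f = refl
    flag-natural b (r ∷ ρ@(s ∷ _)) t x nothing nothing
      rewrite flag-natural b ρ (λ y → cong tail (t y)) x nothing nothing | t x = refl

    resid-natural : ∀ {m} (ρ : Path n m) {tab tab′} → (∀ x → tab x ≡ tab′ (h x)) →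
      ∀ last last′ → (∀ p → last′ p ≡ h? (last p)) → LX.resid ρ tab last ≡ LY.resid ρ tab′ last′
    resid-natural (_ ∷ []) t last last′ agree = refl
    resid-natural (r ∷ ρ@(s ∷ _)) t last last′ agree
      rewrite resid-natural ρ (λ y → cong tail (t y)) last last′ agree | agree s with last s
    ... | nothing = refl
    ... | just x  rewrite t x = refl

  module _ (to fr : Y → Maybe (Fin n)) (γ : Y → Bool) (π π′ : Path n n)
           (t : X → Certificate n) (t′ : Y → Certificate n) (t≡ : ∀ x → t x ≡ t′ (h x)) where
    module CX = LocalCert (λ x → site (h x)) (λ x → to (h x)) (λ x → fr (h x)) (λ x → γ (h x)) t π π′
    module CY = LocalCert site to fr γ t′ π π′

    cert-natural : ∀ x pv nx sd rc → CX.CertParts x pv nx sd rc ≡ CY.CertParts (h x) (h? pv) (h? nx) (h? sd) (h? rc)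
    cert-natural x pv nx sd rc
      rewrite tab-natural to {CX.W} {CY.W} (λ y → cong marked (t≡ y)) π (λ y → cong fwd (t≡ y)) x pv sd
            | tab-natural fr {CX.W} {CY.W} (λ y → cong marked (t≡ y)) π′ (λ y → cong bwd (t≡ y)) x nx rc
            | flag-natural fr (λ y → cong lastMk (t≡ y)) π′ (λ y → cong flags (t≡ y)) x nx rc
            | t≡ x with pv | nx
    ... | nothing | nothing = refl
    ... | nothing | just _  = refl
    ... | just g  | nothing rewrite t≡ g = refl
    ... | just g  | just _  rewrite t≡ g = refl

    end-natural : ∀ last last′ → (∀ p → last′ p ≡ h? (last p)) → CX.CertEnd last ≡ CY.CertEnd last′
    end-natural last last′ agree
      rewrite agree (head π) | resid-natural to π (λ y → cong fwd (t≡ y)) last last′ agree with last (head π)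
    ... | nothing = refl
    ... | just x rewrite t≡ x = refl

  module _ {Γ : Set} (T : Y → Γ) (seen : X → Γ → Fin n → Bool → Bool) (seen′ : Y → Γ → Fin n → Bool → Bool)
           (seen≡ : ∀ x c q b → seen x c q b ≡ seen′ (h x) c q b) where
    module PX = LocalPast (λ x → site (h x)) (λ x → T (h x)) seen
    module PY = LocalPast site T seen′

    through-natural : ∀ m c q b → PX.Through m c q b ≡ PY.Through (h? m) c q b
    through-natural nothing  c q b = refl
    through-natural (just g) c q b rewrite seen≡ g c q b | seen≡ g (T (h g)) (site (h g)) true = refl

    past-natural : ∀ x pv sd c q b → PX.PastOK x pv sd c q b ≡ PY.PastOK (h x) (h? pv) (h? sd) c q b
    past-natural x pv sd c q b rewrite seen≡ x c q b | through-natural pv c q b | through-natural sd c q b = refl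

    adjacent-natural : ∀ m c q → PX.Adjacent m c q ≡ PY.Adjacent (h? m) c q
    adjacent-natural nothing  c q = refl
    adjacent-natural (just _) c q = refl

    other-natural : ∀ x pv sd c q → PX.SeenOther x pv sd c q ≡ PY.SeenOther (h x) (h? pv) (h? sd) c q
    other-natural x pv sd c q
      rewrite seen≡ x c q false | seen≡ x c q true | adjacent-natural pv c q | adjacent-natural sd c q = refl

-- The tiling of a formula

coe : {A B : Set} → A ≡ B → A → B
coe refl a = a

module Construction {n k nX : ℕ} (p₀ : Fin n) (Φ : FO2 n k nX) where

  Γ : Set
  Γ = Bits Φ

  _≟Γ_ : (c d : Γ) → Dec (c ≡ d)
  _≟Γ_ = codeEq (codeBits Φ)

  ℓ : ℕ
  ℓ = ⌈log₂ n ⌉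

  codeProcess : Code (Fin n) ℓ
  codeProcess = codeFin p₀

  codeSeen : Code (Γ × Fin n × Bool) (#bits Φ + (ℓ + 1))
  codeSeen = code× (codeBits Φ) (code× codeProcess codeBool)

  codePath : Code (Path n n) (suc n * ℓ)
  codePath = codeVec (suc n) codeProcess

  codeKey : Code (Γ × Path n n × Path n n) (#bits Φ + (suc n * ℓ + suc n * ℓ))
  codeKey = code× (codeBits Φ) (code× codePath codePath)

  module Seenᵀ = Tab codeSeen
  module Keyᵀ = Tab codeKey

  -- `to` and `fr` copy the process of the message partner into the tile. The check sees the tile of
  -- the previous event but not that event's partner, while the counters depend on whether the
  -- previous event has sent to `r`.
  record Tile : Set where
    constructor tile
    field
      sets   : Vec Bool nX
      type   : Γ
      past   : Tree Bool (#bits Φ + (ℓ + 1))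
      future : Tree Bool (#bits Φ + (ℓ + 1))
      to     : Maybe (Fin n)
      fr     : Maybe (Fin n)
      certs  : Tree (Certificate n) (#bits Φ + (suc n * ℓ + suc n * ℓ))
  open Tile

  certBits seenBits keyBits tileBits : ℕ
  certBits = 1 + (1 + (3 + (n * (3 + 3) + (n * (3 + 3) + suc n * 1))))
  seenBits = 2 ^ (#bits Φ + (ℓ + 1)) * 1
  keyBits  = 2 ^ (#bits Φ + (suc n * ℓ + suc n * ℓ)) * certBits
  tileBits = nX * 1 + (#bits Φ + (seenBits + (seenBits + (suc ℓ + (suc ℓ + keyBits)))))

  codeTile : Code Tile tileBits
  codeTile = codeMap (λ (a , b , c , d , e , f , g) → tile a b c d e f g)
    (λ (tile a b c d e f g) → a , b , c , d , e , f , g) (λ _ → refl)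
    (code× (codeVec nX codeBool) (code× (codeBits Φ) (code× (codeTree _ codeBool) (code× (codeTree _ codeBool)
      (code× (codeMaybe codeProcess) (code× (codeMaybe codeProcess) (codeTree _ (codeCertificate n))))))))

  Positive : ∀ {X : Set} → (X → Fin n) → (Γ → Path n n → Path n n → X → Certificate n) → X → Γ → Fin n → Set
  Positive site t x c q = q ≢ site x × (∀ π π′ → head π ≡ site x → head π′ ≡ site x → origin π ≡ q → origin π′ ≡ q →
                                          Certificate.diff (t c π π′ x) ≢ c0)

  module Check {X : Set} (site : X → Fin n) (sg : X → Vec Bool nX) (T : X → Γ)
    (seenP seenF : X → Γ → Fin n → Bool → Bool) (to fr : X → Maybe (Fin n))
    (t : Γ → Path n n → Path n n → X → Certificate n) where

    isType : Γ → X → Bool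
    isType c x = does (T x ≟Γ c)

    Typed : Γ → Maybe X → Set
    Typed c = maybe′ (λ y → T y ≡ c) ⊥

    Neighbour : (x : X) (pv nx sd rc : Maybe X) → Rel → Γ → Set
    Neighbour x pv nx sd rc same c = T x ≡ c
    Neighbour x pv nx sd rc sucR c = Typed c nx
    Neighbour x pv nx sd rc preR c = Typed c pv
    Neighbour x pv nx sd rc sndR c = Typed c rc
    Neighbour x pv nx sd rc rcvR c = Typed c sd
    Neighbour x pv nx sd rc bef  c = Σ (Fin n) λ q → LocalPast.SeenOther site T seenP x pv sd c q
    Neighbour x pv nx sd rc aft  c = Σ (Fin n) λ q → LocalPast.SeenOther site T seenF x nx rc c q
    Neighbour x pv nx sd rc par  c = Σ (Fin n) λ q → Positive site t x c q

    typed? : ∀ c m → Dec (Typed c m)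
    typed? c nothing  = no λ ()
    typed? c (just y) = T y ≟Γ c

    neighbour? : ∀ x pv nx sd rc r c → Dec (Neighbour x pv nx sd rc r c)
    neighbour? x pv nx sd rc same c = T x ≟Γ c
    neighbour? x pv nx sd rc sucR c = typed? c nx
    neighbour? x pv nx sd rc preR c = typed? c pv
    neighbour? x pv nx sd rc sndR c = typed? c rc
    neighbour? x pv nx sd rc rcvR c = typed? c sd
    neighbour? x pv nx sd rc bef  c = Finₚ.any? λ q → LocalPast.SeenOther? site T seenP _≟Γ_ x pv sd c q
    neighbour? x pv nx sd rc aft  c = Finₚ.any? λ q → LocalPast.SeenOther? site T seenF _≟Γ_ x nx rc c q
    neighbour? x pv nx sd rc par  c = Finₚ.any? λ q → ¬? (q Finₚ.≟ site x) ×-dec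
      all? codePath λ π → all? codePath λ π′ → (_ Finₚ.≟ _) →-dec (_ Finₚ.≟ _) →-dec (_ Finₚ.≟ _) →-dec (_ Finₚ.≟ _) →-dec
        ¬? (_ ≟C _)

    module LB (a : Fin k) (x : X) (pv nx sd rc : Maybe X) =
      LocalBits {Φ = Φ} (site x) a (sg x) (T x) (Neighbour x pv nx sd rc) (neighbour? x pv nx sd rc)

    LocalOK : Fin k → X → (pv nx sd rc : Maybe X) → Set
    LocalOK a x pv nx sd rc =
      (to x ≡ Maybe.map site rc × fr x ≡ Maybe.map site sd) ×
      LB.BitsOK a x pv nx sd rc Φ id ×
      -- The sentence itself, evaluated with both variables at `x`. As no variable is free in it,
      -- all events agree on its value.
      holds Φ (T x) (T x) same ≡ true ×
      (∀ c q b → LocalPast.PastOK site T seenP x pv sd c q b) ×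
      (∀ c q b → LocalPast.PastOK site T seenF x nx rc c q b) ×
      (∀ c π π′ → Valid π π′ → LocalCert.CertParts site to fr (isType c) (t c π π′) π π′ x pv nx sd rc)

    FinalOK : (Fin n → Maybe X) → Set
    FinalOK last = ∀ c π π′ → Valid π π′ → LocalCert.CertEnd site to fr (isType c) (t c π π′) π π′ last

    abstract
      localOK? : ∀ a x pv nx sd rc → Dec (LocalOK a x pv nx sd rc)
      localOK? a x pv nx sd rc =
        (Maybeₚ.≡-dec Finₚ._≟_ _ _ ×-dec Maybeₚ.≡-dec Finₚ._≟_ _ _) ×-dec
        LB.BitsOK? a x pv nx sd rc Φ id ×-dec
        (_ Boolₚ.≟ _) ×-dec
        (all? (codeBits Φ) λ c → Finₚ.all? λ q → all? codeBool λ b → LocalPast.PastOK? site T seenP _≟Γ_ x pv sd c q b) ×-dec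
        (all? (codeBits Φ) λ c → Finₚ.all? λ q → all? codeBool λ b → LocalPast.PastOK? site T seenF _≟Γ_ x nx rc c q b) ×-dec
        (all? (codeBits Φ) λ c → all? codePath λ π → all? codePath λ π′ → valid? π π′ →-dec
          map′ (LocalCert.toParts site to fr (isType c) (t c π π′) π π′) (LocalCert.fromParts site to fr (isType c) (t c π π′) π π′)
            (LocalCert.CertOK? site to fr (isType c) (t c π π′) π π′ x pv nx sd rc))

      finalOK? : ∀ last → Dec (FinalOK last)
      finalOK? last = all? (codeBits Φ) λ c → all? codePath λ π → all? codePath λ π′ → valid? π π′ →-dec
        LocalCert.CertEnd? site to fr (isType c) (t c π π′) π π′ last

  seenIn : Tree Bool (#bits Φ + (ℓ + 1)) → Γ → Fin n → Bool → Bool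
  seenIn tr c q b = Seenᵀ.get tr (c , q , b)

  certIn : Tree (Certificate n) (#bits Φ + (suc n * ℓ + suc n * ℓ)) → Γ → Path n n → Path n n → Certificate n
  certIn tr c π π′ = Keyᵀ.get tr (c , π , π′)

  Y : Set
  Y = Fin n × Tile

  setsY : Y → Vec Bool nX
  setsY y = sets (proj₂ y)

  typeY : Y → Γ
  typeY y = type (proj₂ y)

  pastY futureY : Y → Γ → Fin n → Bool → Bool
  pastY y   = seenIn (past (proj₂ y))
  futureY y = seenIn (future (proj₂ y))

  toY frY : Y → Maybe (Fin n)
  toY y = to (proj₂ y)
  frY y = fr (proj₂ y)

  ctY : Γ → Path n n → Path n n → Y → Certificate n
  ctY c π π′ y = certIn (certs (proj₂ y)) c π π′

  module CY = Check {Y} proj₁ setsY typeY pastY futureY toY frY ctY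

  tiling : Tiling n k
  tiling = record
    { Tile  = Tile ; bits = tileBits ; code = codeTile
    ; local = λ p a me pv nx sd rc → does (CY.localOK? a (p , me) (Maybe.map (p ,_) pv) (Maybe.map (p ,_) nx) sd rc)
    ; final = λ last → does (CY.finalOK? (λ p → Maybe.map (p ,_) (lookup last p))) }

  bits-resp : ∀ {p a sg b} {NB NB′ : Rel → Γ → Set} {NB? NB′?} → (∀ r c → NB r c ⟺ NB′ r c) →
    ∀ φ pr → LocalBits.BitsOK {Φ = Φ} p a sg b NB NB? φ pr → LocalBits.BitsOK {Φ = Φ} p a sg b NB′ NB′? φ pr
  bits-resp i (proc _ _) pr z = z
  bits-resp i (lab _ _)  pr z = z
  bits-resp i (mem _ _)  pr z = z
  bits-resp i (eq _ _)   pr z = z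
  bits-resp i (succ _ _) pr z = z
  bits-resp i (msgR _ _) pr z = z
  bits-resp i (le _ _)   pr z = z
  bits-resp {NB? = d} {d′} i (or φ ψ) pr (y , z) =
    bits-resp {NB? = d} {d′} i φ _ y , bits-resp {NB? = d} {d′} i ψ _ z
  bits-resp {NB? = d} {d′} i (neg φ) pr z = bits-resp {NB? = d} {d′} i φ pr z
  bits-resp {NB? = d} {d′} i (ex v φ) pr ((f , g) , z) =
    ((λ t → let r , c , nb , h = f t in r , c , proj₁ (i r c) nb , h) ,
     (λ (r , c , nb , h) → g (r , c , proj₂ (i r c) nb , h))) , bits-resp {NB? = d} {d′} i φ _ z

  module Transfer {X : Set} (h : X → Y)
    (seenP seenF : X → Γ → Fin n → Bool → Bool) (t : Γ → Path n n → Path n n → X → Certificate n)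
    (seenP≡ : ∀ x c q b → seenP x c q b ≡ pastY (h x) c q b)
    (seenF≡ : ∀ x c q b → seenF x c q b ≡ futureY (h x) c q b)
    (t≡ : ∀ c π π′ x → t c π π′ x ≡ ctY c π π′ (h x)) where

    module CX = Check {X} (λ x → proj₁ (h x)) (λ x → setsY (h x)) (λ x → typeY (h x))
      seenP seenF (λ x → toY (h x)) (λ x → frY (h x)) t
    module N = Natural h proj₁

    neighbour-natural : ∀ x pv nx sd rc r c →
      CX.Neighbour x pv nx sd rc r c ⟺ CY.Neighbour (h x) (N.h? pv) (N.h? nx) (N.h? sd) (N.h? rc) r c
    neighbour-natural x pv nx sd rc r c = by r
      where
      typed : ∀ m → CX.Typed c m ⟺ CY.Typed c (N.h? m)
      typed nothing  = id , id
      typed (just _) = id , id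
      by : ∀ r → CX.Neighbour x pv nx sd rc r c ⟺ CY.Neighbour (h x) (N.h? pv) (N.h? nx) (N.h? sd) (N.h? rc) r c
      by same = id , id
      by sucR = typed nx
      by preR = typed pv
      by sndR = typed rc
      by rcvR = typed sd
      by bef  = (λ (q , z) → q , coe (N.other-natural typeY seenP pastY seenP≡ x pv sd c q) z) ,
                (λ (q , z) → q , coe (sym (N.other-natural typeY seenP pastY seenP≡ x pv sd c q)) z)
      by aft  = (λ (q , z) → q , coe (N.other-natural typeY seenF futureY seenF≡ x nx rc c q) z) ,
                (λ (q , z) → q , coe (sym (N.other-natural typeY seenF futureY seenF≡ x nx rc c q)) z)
      by par  = (λ (q , ne , z) → q , ne , λ π π′ a b d e w → z π π′ a b d e (trans (cong Certificate.diff (t≡ c π π′ x)) w)) ,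
                (λ (q , ne , z) → q , ne , λ π π′ a b d e w → z π π′ a b d e (trans (cong Certificate.diff (sym (t≡ c π π′ x))) w))

    local-natural : ∀ a x pv nx sd rc →
      CX.LocalOK a x pv nx sd rc ⟺ CY.LocalOK a (h x) (N.h? pv) (N.h? nx) (N.h? sd) (N.h? rc)
    local-natural a x pv nx sd rc =
      (λ ((t₁ , f₁) , bs , rt , ps , fs , cs) →
        (trans t₁ (sites rc) , trans f₁ (sites sd)) ,
        bits-resp {NB? = CX.neighbour? x pv nx sd rc} {CY.neighbour? _ _ _ _ _} (neighbour-natural x pv nx sd rc) Φ id bs , rt ,
        (λ c q b → coe (N.past-natural typeY seenP pastY seenP≡ x pv sd c q b) (ps c q b)) ,
        (λ c q b → coe (N.past-natural typeY seenF futureY seenF≡ x nx rc c q b) (fs c q b)) ,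
        (λ c π π′ v → coe (N.cert-natural toY frY (CY.isType c) π π′ (t c π π′) (ctY c π π′) (t≡ c π π′) x pv nx sd rc) (cs c π π′ v))) ,
      (λ ((t₁ , f₁) , bs , rt , ps , fs , cs) →
        (trans t₁ (sym (sites rc)) , trans f₁ (sym (sites sd))) ,
        bits-resp {NB? = CY.neighbour? _ _ _ _ _} {CX.neighbour? x pv nx sd rc} (λ r c → let i , j = neighbour-natural x pv nx sd rc r c in j , i) Φ id bs , rt ,
        (λ c q b → coe (sym (N.past-natural typeY seenP pastY seenP≡ x pv sd c q b)) (ps c q b)) ,
        (λ c q b → coe (sym (N.past-natural typeY seenF futureY seenF≡ x nx rc c q b)) (fs c q b)) ,
        (λ c π π′ v → coe (sym (N.cert-natural toY frY (CY.isType c) π π′ (t c π π′) (ctY c π π′) (t≡ c π π′) x pv nx sd rc)) (cs c π π′ v)))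
      where
      sites : ∀ m → Maybe.map (λ x → proj₁ (h x)) m ≡ Maybe.map proj₁ (N.h? m)
      sites nothing  = refl
      sites (just _) = refl

    final-natural : ∀ last last′ → (∀ p → last′ p ≡ N.h? (last p)) → CX.FinalOK last ⟺ CY.FinalOK last′
    final-natural last last′ agree =
      (λ f c π π′ v → coe (N.end-natural toY frY (CY.isType c) π π′ (t c π π′) (ctY c π π′) (t≡ c π π′) last last′ agree) (f c π π′ v)) ,
      (λ f c π π′ v → coe (sym (N.end-natural toY frY (CY.isType c) π π′ (t c π π′) (ctY c π π′) (t≡ c π π′) last last′ agree)) (f c π π′ v))

  module Correctness (M : MSC n k) where
    open MSC M using (w)
    open FromMSC M
    open ChartBasics chart
    open Relations chart
    open Duality chart

    -- The checks of a tiled MSC, on its events and with arbitrary functions in place of the stored tables.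
    module View (t : E → Tile) (seenP seenF : E → Γ → Fin n → Bool → Bool) (ct : Γ → Path n n → Path n n → E → Certificate n)
      (seenP≡ : ∀ x c q b → seenP x c q b ≡ seenIn (past (t x)) c q b)
      (seenF≡ : ∀ x c q b → seenF x c q b ≡ seenIn (future (t x)) c q b)
      (ct≡ : ∀ c π π′ x → ct c π π′ x ≡ certIn (certs (t x)) c π π′) where
      open Transfer {E} (located tiling M t) seenP seenF ct seenP≡ seenF≡ ct≡ public

      relocate : ∀ {p} m → (∀ {g} → m ≡ just g → proj₁ g ≡ p) → Maybe.map (p ,_) (Maybe.map t m) ≡ N.h? m
      relocate nothing  s = refl
      relocate (just g) s = cong (λ p → just (p , t g)) (sym (s refl))

      prev-site : ∀ e → Maybe.map (proj₁ e ,_) (Maybe.map t (prev e)) ≡ N.h? (prev e)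
      prev-site e = relocate (prev e) (λ q → proj₁ (prev-just {e} q))

      next-site : ∀ e → Maybe.map (proj₁ e ,_) (Maybe.map t (next e)) ≡ N.h? (next e)
      next-site e = relocate (next e) (λ q → proj₁ (next-just {e} q))

      last-site : ∀ p → Maybe.map (p ,_) (lookup (tabulate λ p → Maybe.map t (lastEvent p)) p) ≡ N.h? (lastEvent p)
      last-site p = trans (cong (Maybe.map (p ,_)) (Vecₚ.lookup∘tabulate (λ p → Maybe.map t (lastEvent p)) p))
                          (relocate (lastEvent p) (λ q → proj₁ (before-just {p} {size-of p} q)))

      AllOK : Set
      AllOK = (∀ e → CX.LocalOK (label M e) e (prev e) (next e) (sender e) (receiver e)) × CX.FinalOK lastEvent

      toCheck : AllOK → LocallyOK tiling M t × Tiling.final tiling (tabulate λ p → Maybe.map t (lastEvent p)) ≡ true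
      toCheck (loc , fin) =
        (λ e → of-true (CY.localOK? _ _ _ _ _ _)
          (subst₂ (λ pv nx → CY.LocalOK (label M e) (proj₁ e , t e) pv nx (N.h? (sender e)) (N.h? (receiver e)))
            (sym (prev-site e)) (sym (next-site e)) (proj₁ (local-natural (label M e) e _ _ _ _) (loc e)))) ,
        of-true (CY.finalOK? _) (proj₁ (final-natural lastEvent _ last-site) fin)

      fromCheck : LocallyOK tiling M t → Tiling.final tiling (tabulate λ p → Maybe.map t (lastEvent p)) ≡ true → AllOK
      fromCheck loc fin =
        (λ e → proj₂ (local-natural (label M e) e _ _ _ _)
          (subst₂ (λ pv nx → CY.LocalOK (label M e) (proj₁ e , t e) pv nx (N.h? (sender e)) (N.h? (receiver e)))
            (prev-site e) (next-site e) (true-of (CY.localOK? _ _ _ _ _ _) (loc e)))) ,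
        proj₂ (final-natural lastEvent _ last-site) (true-of (CY.finalOK? _) fin)

      module Neighbours (to-ok : ∀ e → to (t e) ≡ Maybe.map proj₁ (receiver e)) (fr-ok : ∀ e → fr (t e) ≡ Maybe.map proj₁ (sender e))
        (ps : ∀ e c q b → LocalPast.PastOK proj₁ (λ e → type (t e)) seenP e (prev e) (sender e) c q b)
        (fs : ∀ e c q b → LocalPast.PastOK proj₁ (λ e → type (t e)) seenF e (next e) (receiver e) c q b)
        (cs : ∀ e c π π′ → Valid π π′ → LocalCert.CertParts proj₁ (λ e → to (t e)) (λ e → fr (t e)) (CX.isType c) (ct c π π′) π π′
                 e (prev e) (next e) (sender e) (receiver e))
        (fin : CX.FinalOK lastEvent) where

        T : E → Γ
        T e = type (t e)

        module PF = PastProofs chart T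
        module PB = PastProofs (dual chart) T
        module Par = Parallel chart T _≟Γ_ (λ e → to (t e)) (λ e → fr (t e)) to-ok fr-ok lastEvent lastEvent-ok

        certified : ∀ c π π′ → Valid π π′ → Par.Certifies c π π′ (ct c π π′)
        certified c π π′ v = (λ e → LocalCert.fromParts proj₁ (λ e → to (t e)) (λ e → fr (t e)) (CX.isType c) (ct c π π′) π π′ (cs e c π π′ v)) , fin c π π′ v

        neighbour-ok : ∀ e r c → CX.Neighbour e (prev e) (next e) (sender e) (receiver e) r c ⟺ Σ E λ f → T f ≡ c × Holds r e f
        neighbour-ok e r c = by r
          where
          typed : ∀ m → CX.Typed c m ⟺ Σ E λ f → T f ≡ c × m ≡ just f
          typed nothing  = (λ ()) , λ ()
          typed (just g) = (λ z → g , z , refl) , λ { (_ , z , refl) → z }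
          by : ∀ r → CX.Neighbour e (prev e) (next e) (sender e) (receiver e) r c ⟺ Σ E λ f → T f ≡ c × Holds r e f
          by same = (λ z → e , z , refl) , λ { (_ , z , refl) → z }
          by sucR = typed (next e)
          by preR = typed (prev e)
          by sndR = typed (receiver e)
          by rcvR = typed (sender e)
          by bef = (λ (q , z) → let f , tf , _ , o = PF.seenOther-sound seenP ps {e} z in f , tf , o) ,
                   λ { (f , refl , o) → proj₁ f , PF.seenOther-complete seenP ps {e} o }
          by aft = (λ (q , z) → let f , tf , _ , r , o = PB.seenOther-sound seenF fs {e} z in f , tf , ⊑ᵈ⇒⊒ r , o) ,
                   λ { (f , refl , r , o) → proj₁ f , PB.seenOther-complete seenF fs {e} (⊒⇒⊑ᵈ r , o) }
          by par = (λ (q , z) → let f , tf , _ , a , b = Par.parallel-sound ct certified {e} z in f , tf , a , b) ,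
                   λ { (f , refl , a , b) → proj₁ f , Par.parallel-complete ct certified {e} {f} a b }

    module _ (closed : free vx Φ ≡ false × free vy Φ ≡ false) where

      none : Var → Maybe E
      none _ = nothing

      free-nothing : ∀ v → free v Φ ≡ false
      free-nothing vx = proj₁ closed
      free-nothing vy = proj₂ closed

      agree : ∀ {ν ν′ : Var → Maybe E} v → free v Φ ≡ true → ν v ≡ ν′ v
      agree v q with () ← trans (sym q) (free-nothing v)

      some-event : E
      some-event = let p , lt = MSC.nonempty M in p , Data.Fin.fromℕ< lt

      -- Tiles speak of truth at events only. Since an MSC is nonempty, there is an event at which
      -- to read off the sentence, and closedness then discards the valuation.
      tiled⇒models : Tiled tiling M → Models M (emso nX Φ)
      tiled⇒models (t , loc , fin) = σ , S.sat-cong Φ (S.val e₀ e₀) none agree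
          (proj₂ (S.holds-sat T Φ id correct same {e₀} {e₀} refl) (proj₁ (proj₂ (proj₂ (proj₁ ok e₀)))))
        where
        open View t (λ e → seenIn (past (t e))) (λ e → seenIn (future (t e))) (λ c π π′ e → certIn (certs (t e)) c π π′)
          (λ _ _ _ _ → refl) (λ _ _ _ _ → refl) (λ _ _ _ _ → refl)
        e₀ : E
        e₀ = some-event
        ok : AllOK
        ok = fromCheck loc fin
        T : E → Γ
        T e = type (t e)
        σ : Fin nX → E → Bool
        σ X e = lookup (sets (t e)) X
        module S = Semantics M σ
        correct : S.Correct T Φ id
        correct = S.bits⇒correct T (λ e → sets (t e)) (λ _ _ → refl) _
          (λ e → CX.neighbour? e (prev e) (next e) (sender e) (receiver e))
          (Neighbours.neighbour-ok (λ e → proj₁ (proj₁ (proj₁ ok e))) (λ e → proj₂ (proj₁ (proj₁ ok e)))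
            (λ e → proj₁ (proj₂ (proj₂ (proj₂ (proj₁ ok e)))))
            (λ e → proj₁ (proj₂ (proj₂ (proj₂ (proj₂ (proj₁ ok e))))))
            (λ e → proj₂ (proj₂ (proj₂ (proj₂ (proj₂ (proj₁ ok e)))))) (proj₂ ok))
          Φ id (λ e → proj₁ (proj₂ (proj₁ ok e)))

      models⇒tiled : Models M (emso nX Φ) → Tiled tiling M
      models⇒tiled (σ , s) = t , toCheck
          ((λ e → ((refl , refl) ,
             S.correct⇒bits T sg (λ e X → Vecₚ.lookup∘tabulate (λ X → σ X e) X) _
               (λ e → CX.neighbour? e (prev e) (next e) (sender e) (receiver e))
               (Neighbours.neighbour-ok (λ _ → refl) (λ _ → refl) past-ok future-ok certs-ok final-ok) Φ id correct e ,
             proj₁ (S.holds-sat T Φ id correct same {e} {e} refl) (S.sat-cong Φ none (S.val e e) agree s) ,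
             past-ok e , future-ok e , certs-ok e)) ,
           final-ok)
        where
        module S = Semantics M σ
        T : E → Γ
        T = S.trueBits Φ
        sg : E → Vec Bool nX
        sg e = tabulate λ X → σ X e
        toT frT : E → Maybe (Fin n)
        toT e = Maybe.map proj₁ (receiver e)
        frT e = Maybe.map proj₁ (sender e)
        module PF = PastProofs chart T
        module PB = PastProofs (dual chart) T
        module Par = Parallel chart T _≟Γ_ toT frT (λ _ → refl) (λ _ → refl) lastEvent lastEvent-ok
        seenP seenF : E → Γ → Fin n → Bool → Bool
        seenP = PF.trueSeen _≟Γ_
        seenF = PB.trueSeen _≟Γ_
        ct : Γ → Path n n → Path n n → E → Certificate n
        ct = proj₁ Par.certifiable
        t : E → Tile
        t e = tile (sg e) (T e) (Seenᵀ.tab λ (c , q , b) → seenP e c q b) (Seenᵀ.tab λ (c , q , b) → seenF e c q b)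
          (toT e) (frT e) (Keyᵀ.tab λ (c , π , π′) → ct c π π′ e)
        open View t seenP seenF ct
          (λ e c q b → sym (Seenᵀ.get-tab (λ (c , q , b) → seenP e c q b) (c , q , b)))
          (λ e c q b → sym (Seenᵀ.get-tab (λ (c , q , b) → seenF e c q b) (c , q , b)))
          (λ c π π′ e → sym (Keyᵀ.get-tab (λ (c , π , π′) → ct c π π′ e) (c , π , π′)))
        past-ok : ∀ e c q b → LocalPast.PastOK proj₁ T seenP e (prev e) (sender e) c q b
        past-ok = PF.trueSeen-ok _≟Γ_
        future-ok : ∀ e c q b → LocalPast.PastOK proj₁ T seenF e (next e) (receiver e) c q b
        future-ok = PB.trueSeen-ok _≟Γ_
        certs-ok : ∀ e c π π′ → Valid π π′ → LocalCert.CertParts proj₁ toT frT (CX.isType c) (ct c π π′) π π′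
                   e (prev e) (next e) (sender e) (receiver e)
        certs-ok e c π π′ v = LocalCert.toParts proj₁ toT frT (CX.isType c) (ct c π π′) π π′ (proj₁ (proj₂ Par.certifiable c π π′ v) e)
        final-ok : CX.FinalOK lastEvent
        final-ok c π π′ v = proj₂ (proj₂ Par.certifiable c π π′ v)
        correct : S.Correct T Φ id
        correct = S.trueBits-correct {Φ} Φ id (λ _ → refl)

-- The number of states

fsize≥1 : ∀ {n k nX} (φ : FO2 n k nX) → 1 ≤ fsize φ
fsize≥1 (proc _ _) = s≤s z≤n
fsize≥1 (lab _ _)  = s≤s z≤n
fsize≥1 (mem _ _)  = s≤s z≤n
fsize≥1 (eq _ _)   = s≤s z≤n
fsize≥1 (succ _ _) = s≤s z≤n
fsize≥1 (msgR _ _) = s≤s z≤n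
fsize≥1 (le _ _)   = s≤s z≤n
fsize≥1 (or _ _)   = s≤s z≤n
fsize≥1 (neg _)    = s≤s z≤n
fsize≥1 (ex _ _)   = s≤s z≤n

m<2^m : ∀ m → m < 2 ^ m
m<2^m zero    = s≤s z≤n
m<2^m (suc m) = ≤-trans (+-mono-≤ (m^n>0 2 m) (m<2^m m)) (≤-reflexive (cong (2 ^ m +_) (sym (+-identityʳ _))))

module Bound {m k nX : ℕ} (Φ : FO2 (suc m) k nX) where
  open Construction {suc m} {k} {nX} Fin.zero Φ using (ℓ; certBits; seenBits; keyBits; tileBits; tiling)
  open ≤-Reasoning
  open +-*-Solver

  -- `B` bounds each of the seven components of a tile. The largest is the table of certificates:
  -- `4 * A` bits for a key and at most `2 ^ (6 * A)` bits per certificate give the 10. Two tiles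
  -- and two tag bits make at most `16 * B` bits per state; the factor `2 ^ 4` turns 10 into the 14
  -- of the theorem.
  n A B : ℕ
  n = suc m
  A = (2 * nX + fsize Φ) + n * ℓ
  B = 2 ^ (10 * A)

  1≤A : 1 ≤ A
  1≤A = ≤-trans (fsize≥1 Φ) (≤-trans (m≤n+m _ (2 * nX)) (m≤m+n _ (n * ℓ)))

  pow≤B : ∀ {x y} → x ≤ 2 ^ y → y ≤ 10 * A → x ≤ B
  pow≤B p q = ≤-trans p (^-monoʳ-≤ 2 q)

  A≤10A : A ≤ 10 * A
  A≤10A = m≤m+n A _

  G≤fsize : #bits Φ ≤ fsize Φ
  G≤fsize = #bits≤fsize Φ

  ℓ≤ : ℓ ≤ n * ℓ
  ℓ≤ = m≤m+n ℓ (m * ℓ)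

  small : ∀ {x} → x ≤ A → suc x ≤ B
  small {x} p = pow≤B (m<2^m x) (≤-trans p A≤10A)

  nX≤A : nX ≤ A
  nX≤A = ≤-trans (m≤m+n nX (nX + 0)) (≤-trans (m≤m+n (2 * nX) _) (m≤m+n _ (n * ℓ)))

  G≤A : #bits Φ ≤ A
  G≤A = ≤-trans G≤fsize (≤-trans (m≤n+m _ (2 * nX)) (m≤m+n _ (n * ℓ)))

  seen≤B : seenBits ≤ B
  seen≤B = ≤-trans (≤-reflexive (*-identityʳ _)) (pow≤B ≤-refl (begin
    #bits Φ + (ℓ + 1)    ≤⟨ +-mono-≤ G≤A (+-mono-≤ (≤-trans ℓ≤ (m≤n+m _ (2 * nX + fsize Φ))) 1≤A) ⟩
    A + (A + A)          ≤⟨ m≤m+n _ (7 * A) ⟩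
    A + (A + A) + 7 * A  ≡⟨ solve 1 (λ a → a :+ (a :+ a) :+ con 7 :* a := con 10 :* a) refl A ⟩
    10 * A               ∎))

  key≤B : keyBits ≤ B
  key≤B = begin
    2 ^ (#bits Φ + (suc n * ℓ + suc n * ℓ)) * certBits  ≤⟨ *-mono-≤ (^-monoʳ-≤ 2 paths) certs ⟩
    2 ^ (4 * A) * 2 ^ (6 * A)                           ≡⟨ sym (^-distribˡ-+-* 2 (4 * A) (6 * A)) ⟩
    2 ^ (4 * A + 6 * A)                                 ≡⟨ cong (2 ^_) (sym (*-distribʳ-+ A 4 6)) ⟩
    B                                                   ∎
    where
    paths : #bits Φ + (suc n * ℓ + suc n * ℓ) ≤ 4 * A
    paths = begin
      #bits Φ + (suc n * ℓ + suc n * ℓ)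
        -- A path lists one process more than there are; its extra `ℓ` bits are absorbed by a second
        -- `n * ℓ`.
        ≤⟨ +-mono-≤ G≤fsize (+-mono-≤ (+-monoˡ-≤ (n * ℓ) ℓ≤) (+-monoˡ-≤ (n * ℓ) ℓ≤)) ⟩
      fsize Φ + ((n * ℓ + n * ℓ) + (n * ℓ + n * ℓ))
        ≤⟨ m≤m+n _ (8 * nX + 3 * fsize Φ) ⟩
      fsize Φ + ((n * ℓ + n * ℓ) + (n * ℓ + n * ℓ)) + (8 * nX + 3 * fsize Φ)
        ≡⟨ solve 3 (λ x f z → f :+ ((z :+ z) :+ (z :+ z)) :+ (con 8 :* x :+ con 3 :* f) :=
                              con 4 :* ((con 2 :* x :+ f) :+ z)) refl nX (fsize Φ) (n * ℓ) ⟩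
      4 * A ∎
    certs : certBits ≤ 2 ^ (6 * A)
    certs = begin
      certBits             ≡⟨ solve 1 (λ x → con 1 :+ (con 1 :+ (con 3 :+ ((con 1 :+ x) :* con 6 :+ ((con 1 :+ x) :* con 6 :+ (con 2 :+ x) :* con 1))))
                                             := con 19 :+ con 13 :* x) refl m ⟩
      -- Both constants are rounded up to 32, so that a power of two splits off from `n`.
      19 + 13 * m          ≤⟨ +-mono-≤ (m≤m+n 19 13) (*-monoˡ-≤ m (m≤m+n 13 19)) ⟩
      32 + 32 * m          ≡⟨ solve 1 (λ x → con 32 :+ con 32 :* x := con 32 :* (con 1 :+ x)) refl m ⟩
      32 * n               ≤⟨ *-monoʳ-≤ 32 (n≤2^⌈log₂n⌉ n) ⟩
      2 ^ 5 * 2 ^ ℓ        ≡⟨ sym (^-distribˡ-+-* 2 5 ℓ) ⟩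
      2 ^ (5 + ℓ)          ≤⟨ ^-monoʳ-≤ 2 (+-mono-≤ (*-monoʳ-≤ 5 1≤A) (≤-trans ℓ≤ (m≤n+m _ (2 * nX + fsize Φ)))) ⟩
      2 ^ (5 * A + A)      ≡⟨ cong (2 ^_) (+-comm (5 * A) A) ⟩
      2 ^ (6 * A)          ∎

  tile≤7B : tileBits ≤ 7 * B
  tile≤7B = +-mono-≤ (≤-trans (≤-reflexive (*-identityʳ nX)) (<⇒≤ (small nX≤A)))
    (+-mono-≤ (<⇒≤ (small G≤A)) (+-mono-≤ seen≤B (+-mono-≤ seen≤B (+-mono-≤ small-ℓ (+-mono-≤ small-ℓ
      (≤-trans key≤B (m≤m+n B 0)))))))
    where
    small-ℓ : suc ℓ ≤ B
    small-ℓ = small (≤-trans ℓ≤ (m≤n+m _ (2 * nX + fsize Φ)))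

  states-bound : stateBits tiling ≤ 2 ^ (14 * A)
  states-bound = begin
    suc (tileBits + suc tileBits)    ≡⟨ cong suc (+-suc tileBits tileBits) ⟩
    2 + (tileBits + tileBits)        ≤⟨ +-mono-≤ (*-monoʳ-≤ 2 (m^n>0 2 (10 * A))) (+-mono-≤ tile≤7B tile≤7B) ⟩
    2 * B + (7 * B + 7 * B)          ≡⟨ solve 1 (λ b → con 2 :* b :+ (con 7 :* b :+ con 7 :* b) := con 16 :* b) refl B ⟩
    2 ^ 4 * 2 ^ (10 * A)             ≡⟨ sym (^-distribˡ-+-* 2 4 (10 * A)) ⟩
    2 ^ (4 + 10 * A)                 ≤⟨ ^-monoʳ-≤ 2 (+-monoˡ-≤ (10 * A) (*-monoʳ-≤ 4 1≤A)) ⟩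
    2 ^ (4 * A + 10 * A)             ≡⟨ cong (2 ^_) (sym (*-distribʳ-+ A 4 10)) ⟩
    2 ^ (14 * A)                     ∎

theorem8 : Σ ℕ (λ c → (n k : ℕ) (φ : EMSO2 n k) → Sentence φ →
    Σ (CFM n k) (λ A →
    ((p : Fin n) → CFM.nStates A p ≤ 2 ^ (2 ^ (c * (size φ + n * ⌈log₂ n ⌉)))) ×
    ((M : MSC n k) → (Accepts A M ⇔ Models M φ))))
theorem8 = 14 , construct
  where
  construct : (n k : ℕ) (φ : EMSO2 n k) → Sentence φ →
    Σ (CFM n k) (λ A →
    ((p : Fin n) → CFM.nStates A p ≤ 2 ^ (2 ^ (14 * (size φ + n * ⌈log₂ n ⌉)))) ×
    ((M : MSC n k) → (Accepts A M ⇔ Models M φ)))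
  -- Without processes there is no MSC, so any automaton is correct, while the construction needs a
  -- process as the default value of its codes.
  construct zero k φ _ =
    record { nMsg = 0 ; nStates = λ () ; init = λ () ; Δ = λ () ; Δ-wf = λ () ; Acc = λ _ → false } ,
    (λ ()) , (λ M → ⊥-elim (no-process (proj₁ (MSC.nonempty M))))
    where
    no-process : Fin 0 → ⊥
    no-process ()
  construct (suc m) k (emso nX Φ) closed =
    automaton tiling , (λ _ → ^-monoʳ-≤ 2 (Bound.states-bound Φ)) ,
    λ M → mk⇔ (λ (r , end) → Correctness.tiled⇒models M closed (FromRun.tiled tiling M r end))
              (λ mod → let t , loc , fin = Correctness.models⇒tiled M closed mod in ToRun.accepts tiling M t loc fin)
    where
    open Construction {suc m} {k} {nX} Fin.zero Φ
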